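{- For each $\chi \in \{TBR, SPR, rSPR\}$, both the $\chi$-diameter $D_\chi(n)$ and the $\chi$-radius $R_\chi(n)$ are $n - \Theta(\sqrt{n})$ as $n \to \infty$.
   Context: For a finite set $X$ with $|X|>1$, a binary leaf-labelled tree with label set $X$ is a finite tree whose vertices are either tree vertices of degree $3$ or leaves of degree $1$, the leaves being in bijection with $X$ (their labels); if $|X|=1$ it is the single vertex labelled by the element of $X$. $\mathcal{B}(X)$ denotes the set of all such trees; two trees are identified if there is a graph isomorphism preserving leaf labels. The leaf labelled $0$ (when $0\in X$) is called the root. A TBR (tree bisection and reconnection) move on $T\in\mathcal{B}(X)$, $|X|\ge 3$: delete an edge of $T$ and suppress all resulting degree-$2$ vertices, obtaining two binary trees $T_1,T_2$; then join them by a new edge between the midpoint of an edge of $T_1$ and the midpoint of an edge of $T_2$ (if $T_1$ or $T_2$ is a single vertex, the new edge is incident to that vertex). An SPR (subtree prune and regraft) move taking $xy$ from $ab$ to $cd$ can be performed on $T$ when $xy, ax, xb, cd$ are distinct edges (the vertices $a,b,c,d$ need not be distinct) and the path from $c$ to $y$ contains $x$: delete edges $ax, xb$ and add edge $ab$; then delete edge $cd$ and add edges $cx, xd$. It is an rSPR (rooted SPR) move if moreover $0\in X$ and the path from the leaf $0$ to $y$ passes through $x$. For $\chi\in\{TBR,SPR,rSPR\}$ and $A,B\in\mathcal{B}(X)$, $d_\chi(A,B)$ is the minimum number of $\chi$ moves needed to transform $A$ into $B$. For $n\ge1$ and $X=\{0,1,\dots,n\}$, $D_\chi(n)=\max_{A,B\in\mathcal{B}(X)}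 d_\chi(A,B)$ and $R_\chi(n)=\min_{C\in\mathcal{B}(X)}\max_{B\in\mathcal{B}(X)} d_\chi(B,C)$. -}

module Defs where

open import Data.Nat using (ℕ; zero; suc; _+_; _*_; _∸_; _≤_; _<_)
open import Data.Fin using (Fin; _≟_)
import Data.Fin as F
open import Data.Bool using (Bool; true; false; _∧_; _∨_; not; T; if_then_else_)
open import Data.List using (List; []; _∷_; map; allFin)
open import Data.Nat.ListAction using (sum)
open import Data.List.Membership.Propositional using (_∈_)
open import Data.List.Relation.Unary.Unique.Propositional using (Unique)
open import Relation.Nullary using (¬_)
open import Relation.Nullary.Decidable using (⌊_⌋)
open import Relation.Binary.PropositionalEquality using (_≡_; _≢_)
open import Data.Product using (Σ; ∃; ∃-syntax; _×_; _,_)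
open import Data.Sum using (_⊎_)
open import Function.Bundles using (_↔_; Inverse)

-- Simple graphs on the vertex set Fin m, given by a Boolean adjacency
-- function (edges are unordered pairs; symmetry is imposed for trees).

Adj : ℕ → Set
Adj m = Fin m → Fin m → Bool

private
  variable
    m : ℕ

_==_ : Fin m → Fin m → Bool
p == q = ⌊ p ≟ q ⌋

isPair : Fin m → Fin m → Fin m → Fin m → Bool
isPair u v p q = (p == u ∧ q == v) ∨ (p == v ∧ q == u)

rem : Fin m → Fin m → Adj m → Adj m
rem u v E p q = E p q ∧ not (isPair u v p q)

add : Fin m → Fin m → Adj m → Adj m
add u v E p q = E p q ∨ isPair u v p q

_≐_ : Adj m → Adj m → Set
E ≐ F = ∀ p q → E p q ≡ F p q

deg : Adj m → Fin m → ℕ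
deg {m} E v = sum (map (λ w → if E v w then 1 else 0) (allFin m))

data Walk (E : Adj m) : Fin m → Fin m → List (Fin m) → Set where
  stop : ∀ {u} → Walk E u u (u ∷ [])
  step : ∀ {u v w p} → T (E u v) → Walk E v w p → Walk E u w (u ∷ p)

Conn : Adj m → Fin m → Fin m → Set
Conn E u w = ∃[ p ] Walk E u w p

PathThrough : Adj m → Fin m → Fin m → Fin m → Set
PathThrough E c y x = ∃[ p ] (Walk E c y p × Unique p × x ∈ p)

-- Binary leaf-labelled trees with label set X = {0,…,n} = Fin (suc n),
-- realised concretely on the vertex set Fin m.  A tree is a connected
-- graph in which every edge is a bridge (minimally connected).

record BTree (n m : ℕ) : Set where
  field
    adj       : Adj m
    adj-sym   : ∀ p q → adj p q ≡ adj q p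
    adj-irr   : ∀ p → adj p p ≡ false
    connected : ∀ p q → Conn adj p q
    minimal   : ∀ p q → T (adj p q) → ¬ Conn (rem p q adj) p q
    leaf      : Fin (suc n) → Fin m
    leaf-inj  : ∀ i j → leaf i ≡ leaf j → i ≡ j
    leaf-deg  : ∀ i → deg adj (leaf i) ≡ 1
    inner-deg : ∀ v → (∀ i → leaf i ≢ v) → deg adj v ≡ 3

open BTree public

-- Moves (vertex names are kept; the new graph is specified exactly).

SameEdge : Fin m → Fin m → Fin m → Fin m → Set
SameEdge u v p q = (u ≡ p × v ≡ q) ⊎ (u ≡ q × v ≡ p)

-- hypotheses of the SPR move "taking xy from ab to cd"
SPRData : Adj m → (x y a b c d : Fin m) → Set
SPRData E x y a b c d =
  T (E x y) × T (E a x) × T (E x b) × T (E c d) ×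
  ¬ SameEdge x y a x × ¬ SameEdge x y x b × ¬ SameEdge x y c d ×
  ¬ SameEdge a x x b × ¬ SameEdge a x c d × ¬ SameEdge x b c d ×
  PathThrough E c y x

sprResult : (x a b c d : Fin m) → Adj m → Adj m
sprResult x a b c d E = add x d (add c x (rem c d (add a b (rem x b (rem a x E)))))

SPRMove : Adj m → Adj m → Set
SPRMove E E' = ∃[ x ] ∃[ y ] ∃[ a ] ∃[ b ] ∃[ c ] ∃[ d ]
  (SPRData E x y a b c d × E' ≐ sprResult x a b c d E)

-- r is the vertex of the root leaf 0
rSPRMove : Fin m → Adj m → Adj m → Set
rSPRMove r E E' = ∃[ x ] ∃[ y ] ∃[ a ] ∃[ b ] ∃[ c ] ∃[ d ]
  (SPRData E x y a b c d × PathThrough E r y x × E' ≐ sprResult x a b c d E)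

suppress : (u a b : Fin m) → Adj m → Adj m
suppress u a b G = add a b (rem u a (rem u b G))

subdivide : (u e f : Fin m) → Adj m → Adj m
subdivide u e f H = add u e (add u f (rem e f H))

-- TBR, one side: after deleting the edge uv of E (current graph G),
-- either u is a leaf (single-vertex side, kept as is), or u (degree 3,
-- other neighbours a, b) is suppressed and reinserted at the midpoint of
-- an edge ef of its side (the component of a in the suppressed graph).
TBRSide : Adj m → Adj m → (u v : Fin m) → Adj m → Set
TBRSide E G u v G' =
  (deg E u ≡ 1 × G' ≐ G) ⊎
  (∃[ a ] ∃[ b ] ∃[ e ] ∃[ f ]
    (deg E u ≡ 3 × a ≢ b × a ≢ v × b ≢ v × T (E u a) × T (E u b) ×
     T (suppress u a b G e f) × Conn (suppress u a b G) a e ×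
     G' ≐ subdivide u e f (suppress u a b G)))

TBRMove : Adj m → Adj m → Set
TBRMove E E' = ∃[ u ] ∃[ v ] ∃[ G₂ ] ∃[ G₃ ]
  (T (E u v) × TBRSide E (rem u v E) u v G₂ × TBRSide E G₂ v u G₃ ×
   E' ≐ add u v G₃)

data Model : Set where
  TBR SPR rSPR : Model

Move : Model → Fin m → Adj m → Adj m → Set
Move TBR  r = TBRMove
Move SPR  r = SPRMove
Move rSPR r = rSPRMove r

data Steps (Mv : Adj m → Adj m → Set) : ℕ → Adj m → Adj m → Set where
  done : ∀ {k E} → Steps Mv k E E
  more : ∀ {k E F G} → Mv E F → Steps Mv k F G → Steps Mv (suc k) E G

-- d_χ(A,B) ≤ k : A can be transformed by ≤ k χ-moves into a tree
-- isomorphic to B (label-preserving isomorphism).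

Reach : ∀ {n m m'} → Model → ℕ → BTree n m → BTree n m' → Set
Reach {n} {m} {m'} χ k A B = ∃[ E ]
  (Steps (Move χ (leaf A F.zero)) k (adj A) E ×
   Σ (Fin m ↔ Fin m') λ φ →
     (∀ p q → adj B (Inverse.to φ p) (Inverse.to φ q) ≡ E p q) ×
     (∀ i → Inverse.to φ (leaf A i) ≡ leaf B i))

DistGe : ∀ {n m m'} → Model → ℕ → BTree n m → BTree n m' → Set
DistGe χ k A B = ∀ j → j < k → ¬ Reach χ j A B

DiamLe : Model → ℕ → ℕ → Set
DiamLe χ n k = ∀ m m' (A : BTree n m) (B : BTree n m') → Reach χ k A B

DiamGe : Model → ℕ → ℕ → Set
DiamGe χ n k = ∃[ m ] ∃[ m' ] Σ (BTree n m) λ A → Σ (BTree n m') λ B → DistGe χ k A B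

RadLe : Model → ℕ → ℕ → Set
RadLe χ n k = ∃[ m ] Σ (BTree n m) λ C → ∀ m' (B : BTree n m') → Reach χ k B C

RadGe : Model → ℕ → ℕ → Set
RadGe χ n k = ∀ m (C : BTree n m) → ∃[ m' ] Σ (BTree n m') λ B → DistGe χ k B C

-- "P(n) is n - Θ(√n)", for P = D_χ or R_χ, given through Le/Ge:
-- there are K, N such that for all n ≥ N
--   P(n) ≤ n - g for some g ≤ n with n ≤ K g²   (g ≥ √(n/K)), and
--   P(n) ≥ n - h for some h ≤ n with h² ≤ K n   (h ≤ √(K n)).

NMinusThetaSqrt : (ℕ → ℕ → Set) → (ℕ → ℕ → Set) → Set
NMinusThetaSqrt Le Ge = ∃[ K ] ∃[ N ] ∀ n → N ≤ n →
  (∃[ g ] (g ≤ n × n ≤ K * (g * g) × Le n (n ∸ g))) ×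
  (∃[ h ] (h ≤ n × h * h ≤ K * n × Ge n (n ∸ h)))

{-# OPTIONS --safe #-}

-- Lower bound.  Say that a vertex colouring has a bad edge where its two ends differ.  One TBR
-- or SPR move raises the number of bad edges needed to extend a given leaf colouring by at
-- most one.  Cut an arbitrary tree C into O(√n) connected pieces of O(√n) leaves each, number
-- the leaves inside every piece, and let B be a caterpillar whose leaves are sorted by these
-- numbers.  The numbering costs O(√n) bad edges on B, and the pieces cost O(√n) bad edges on
-- C.  If B is k moves away from C, then the numbering costs at most k + O(√n) on C, and
-- together with the pieces it separates all leaves of C; this forces n ≤ k + O(√n).
--
-- Upper bound.  Cut A and B into pieces in the same way.  There are fewer than n/2 pairs
-- (piece of A, piece of B), so a greedy choice finds c√n pairs of leaves, each inside one
-- piece of A and one piece of B, no two in a common piece.  Moving these pairs (one rSPR move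
-- each) from the top of B downwards, and then the remaining leaves one by one, turns A into B
-- in n - c√n moves.
module Submission where

open import Defs
open import Data.Nat using (ℕ; zero; suc; _+_; _*_; _∸_; _≤_; _<_; z≤n; s≤s; _≤?_; NonZero; nonZero)
import Data.Nat as ℕ
open import Data.Nat.Properties using (≤-refl; ≤-trans; ≤-reflexive; ≤-antisym; +-mono-≤; +-comm; m≤m+n; m≤n+m; +-cancelʳ-≤; +-cancelˡ-≤; ≰⇒>; n≤1+n; <-irrefl; +-identityʳ; *-comm; *-mono-≤; ≤-pred; <⇒≤; +-suc)
import Data.Nat.Properties as ℕₚ
open import Data.Nat.DivMod using (_/_; m/n*n≤m; m≡m%n+[m/n]*n; m%n<n)
open import Data.Nat.ListAction using (sum)
open import Data.Nat.Tactic.RingSolver using (solve-∀)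
open import Data.Fin using (Fin; _≟_; _↑ˡ_; _↑ʳ_; splitAt)
import Data.Fin as F
open import Data.Fin.Properties using (splitAt-↑ˡ; splitAt-↑ʳ; ↑ˡ-injective; ↑ʳ-injective; splitAt⁻¹-↑ˡ; splitAt⁻¹-↑ʳ; any?) renaming (suc-injective to Fin-suc-injective)
open import Data.Bool using (Bool; true; false; _∧_; _∨_; _xor_; not; T; if_then_else_)
import Data.Bool as Bool
open import Data.Bool.Properties using (T?)
open import Data.List using (List; []; _∷_; map; allFin; length; _++_; filter; cartesianProduct; upTo)
open import Data.List.Properties using (length-map; ++-assoc; ++-identityʳ; length-++; length-tabulate; length-upTo; map-++; filter-all; filter-accept; filter-reject)
open import Data.List.Membership.Propositional using (_∈_; _∉_; lose; find)
import Data.List.Membership.DecPropositional as DecMembership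
open import Data.List.Membership.Propositional.Properties using (∈-++⁺ˡ; ∈-++⁺ʳ; ∈-++⁻; ∈-map⁺; ∈-map⁻; ∈-filter⁺; ∈-filter⁻; ∈-allFin; ∈-∃++; ∈-cartesianProduct⁺; ∈-upTo⁺)
open import Data.List.Relation.Unary.Any using (here; there)
import Data.List.Relation.Unary.Any as Any
open import Data.List.Relation.Unary.All using (All; []; _∷_)
import Data.List.Relation.Unary.All as All
open import Data.List.Relation.Unary.AllPairs using (AllPairs; []; _∷_)
open import Data.List.Relation.Unary.Linked using (Linked; _∷_)
open import Data.List.Relation.Unary.Unique.Propositional using (Unique)
import Data.List.Relation.Unary.Unique.Propositional.Properties as Uniq
open import Data.List.Relation.Binary.Permutation.Propositional using (_↭_; ↭-refl; ↭-sym; ↭-trans; ↭-prep; ↭-swap; ↭-reflexive)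
import Data.List.Relation.Binary.Permutation.Propositional as Perm
open import Data.List.Relation.Binary.Permutation.Propositional.Properties using (∈-resp-↭; All-resp-↭; ↭-length; shift; shifts; drop-∷; ++⁺ˡ; ++⁺ʳ; ++-comm)
import Data.List.Relation.Binary.Permutation.Propositional.Properties as PermP
import Data.List.Sort as Sort
open import Relation.Nullary using (¬_; Dec; yes; no)
open import Relation.Nullary.Decidable using (⌊_⌋; toWitness; fromWitness; ¬?)
open import Relation.Binary.Bundles using (DecTotalOrder)
import Relation.Binary.Construct.On as On
open import Relation.Binary.Definitions using (DecidableEquality)
open import Relation.Binary.PropositionalEquality using (_≡_; _≢_; refl; sym; trans; cong; cong₂; subst)
open import Data.Product using (Σ; ∃; ∃-syntax; _×_; _,_; proj₁; proj₂)
import Data.Product.Properties as Productₚ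
open import Data.Sum using (_⊎_; inj₁; inj₂; [_,_]′)
open import Data.Empty using (⊥; ⊥-elim)
open import Data.Unit using (⊤; tt)
open import Function.Bundles using (_↔_; Inverse; mk↔ₛ′)
open import Function using (_∘_; id)

private
  variable
    A B : Set
    n m : ℕ

Unique-resp-↭ : {xs ys : List A} → xs ↭ ys → Unique xs → Unique ys
Unique-resp-↭ Perm.refl u = u
Unique-resp-↭ (Perm.prep x p) (a ∷ u) = All-resp-↭ p a ∷ Unique-resp-↭ p u
Unique-resp-↭ (Perm.swap x y p) ((n ∷ a) ∷ b ∷ u) =
  ((n ∘ sym) ∷ All-resp-↭ p b) ∷ All-resp-↭ p a ∷ Unique-resp-↭ p u
Unique-resp-↭ (Perm.trans p q) u = Unique-resp-↭ q (Unique-resp-↭ p u)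

∉⇒All≢ : {x : A} {xs : List A} → x ∉ xs → All (x ≢_) xs
∉⇒All≢ {xs = []} n = []
∉⇒All≢ {xs = y ∷ xs} n = (λ e → n (here e)) ∷ ∉⇒All≢ (n ∘ there)

All≢⇒∉ : {x : A} {xs : List A} → All (x ≢_) xs → x ∉ xs
All≢⇒∉ (n ∷ a) (here e) = n e
All≢⇒∉ (n ∷ a) (there h) = All≢⇒∉ a h

∷-unique : {x : A} {xs : List A} → x ∉ xs → Unique xs → Unique (x ∷ xs)
∷-unique n u = ∉⇒All≢ n ∷ u

head∉ : {x : A} {xs : List A} → Unique (x ∷ xs) → x ∉ xs
head∉ (a ∷ u) = All≢⇒∉ a

tail-unique : {x : A} {xs : List A} → Unique (x ∷ xs) → Unique xs
tail-unique (a ∷ u) = u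

unique-++ : (xs : List A) {ys : List A} → Unique (xs ++ ys) →
  Unique xs × Unique ys × (∀ {z} → z ∈ xs → z ∉ ys)
unique-++ [] u = [] , u , λ ()
unique-++ (x ∷ xs) (a ∷ u) with unique-++ xs u
... | ux , uy , d = ∷-unique (λ h → All≢⇒∉ a (∈-++⁺ˡ h)) ux , uy ,
  λ { (here refl) h → All≢⇒∉ a (∈-++⁺ʳ xs h) ; (there k) h → d k h }

++-unique : {xs ys : List A} → Unique xs → Unique ys → (∀ {z} → z ∈ xs → z ∉ ys) → Unique (xs ++ ys)
++-unique ux uy d = Uniq.++⁺ ux uy (λ { (h , k) → d h k })

∈⇒↭ : {x : A} {xs : List A} → x ∈ xs → ∃[ ys ] xs ↭ x ∷ ys
∈⇒↭ {x = x} h with ∈-∃++ h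
... | as , bs , refl = as ++ bs , shift x as bs

unique-⊆-length : {xs ys : List A} → Unique xs → (∀ {z} → z ∈ xs → z ∈ ys) → length xs ≤ length ys
unique-⊆-length {xs = []} u s = z≤n
unique-⊆-length {xs = x ∷ xs} {ys} (a ∷ u) s with ∈⇒↭ (s (here refl))
... | zs , p = subst (suc (length xs) ≤_) (sym (↭-length p)) (s≤s (unique-⊆-length u sub))
  where
  sub : ∀ {z} → z ∈ xs → z ∈ zs
  sub h with ∈-resp-↭ p (s (there h))
  ... | here refl = ⊥-elim (All≢⇒∉ a h)
  ... | there k = k

unique-≡-length : {xs ys : List A} → Unique xs → Unique ys →
  (∀ {z} → z ∈ xs → z ∈ ys) → (∀ {z} → z ∈ ys → z ∈ xs) → length xs ≡ length ys
unique-≡-length ux uy s r = ≤-antisym (unique-⊆-length ux s) (unique-⊆-length uy r)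

unique-Fin-length : {xs : List (Fin m)} → Unique xs → length xs ≤ m
unique-Fin-length {m = m} {xs} u = subst (length xs ≤_) (length-tabulate id)
    (unique-⊆-length u (λ {z} _ → ∈-allFin z))

T⇒≡ : {a b : Bool} → (T a → T b) → (T b → T a) → a ≡ b
T⇒≡ {true} {true} f g = refl
T⇒≡ {true} {false} f g = ⊥-elim (f tt)
T⇒≡ {false} {true} f g = ⊥-elim (g tt)
T⇒≡ {false} {false} f g = refl

T-∨⁻ : (a : Bool) {b : Bool} → T (a ∨ b) → T a ⊎ T b
T-∨⁻ true h = inj₁ tt
T-∨⁻ false h = inj₂ h

T-∨ˡ : {a : Bool} {b : Bool} → T a → T (a ∨ b)
T-∨ˡ {true} h = tt

T-∨ʳ : (a : Bool) {b : Bool} → T b → T (a ∨ b)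
T-∨ʳ true h = tt
T-∨ʳ false h = h

T-∧⁻ : (a : Bool) {b : Bool} → T (a ∧ b) → T a × T b
T-∧⁻ true h = tt , h

T-∧⁺ : {a b : Bool} → T a → T b → T (a ∧ b)
T-∧⁺ {true} h k = k

T-not⁻ : {a : Bool} → T (not a) → ¬ T a
T-not⁻ {false} _ ()

T-not⁺ : {a : Bool} → ¬ T a → T (not a)
T-not⁺ {true} h = h tt
T-not⁺ {false} h = tt

isPair⁻ : (u v p q : Fin m) → T (isPair u v p q) → SameEdge u v p q
isPair⁻ u v p q h with T-∨⁻ (p == u ∧ q == v) h
... | inj₁ k = let k₁ , k₂ = T-∧⁻ (p == u) k in inj₁ (sym (toWitness k₁) , sym (toWitness k₂))
... | inj₂ k = let k₁ , k₂ = T-∧⁻ (p == v) k in inj₂ (sym (toWitness k₂) , sym (toWitness k₁))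

isPair⁺ : (u v p q : Fin m) → SameEdge u v p q → T (isPair u v p q)
isPair⁺ u v p q (inj₁ (refl , refl)) = T-∨ˡ (T-∧⁺ {p == u} (fromWitness refl) (fromWitness refl))
isPair⁺ u v p q (inj₂ (refl , refl)) = T-∨ʳ (p == u ∧ q == v) (T-∧⁺ {p == v} (fromWitness refl) (fromWitness refl))

sameEdge? : (u v p q : Fin m) → Dec (SameEdge u v p q)
sameEdge? u v p q with T? (isPair u v p q)
... | yes h = yes (isPair⁻ u v p q h)
... | no h = no (h ∘ isPair⁺ u v p q)

flipʳ : {u v p q : Fin m} → SameEdge u v p q → SameEdge u v q p
flipʳ (inj₁ (a , b)) = inj₂ (a , b)
flipʳ (inj₂ (a , b)) = inj₁ (a , b)

flipˡ : {u v p q : Fin m} → SameEdge u v p q → SameEdge v u p q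
flipˡ (inj₁ (a , b)) = inj₂ (b , a)
flipˡ (inj₂ (a , b)) = inj₁ (b , a)

sameEdge-sym : {u v p q : Fin m} → SameEdge u v p q → SameEdge p q u v
sameEdge-sym (inj₁ (a , b)) = inj₁ (sym a , sym b)
sameEdge-sym (inj₂ (a , b)) = inj₂ (sym b , sym a)

add⁻ : (u v : Fin m) (E : Adj m) (p q : Fin m) → T (add u v E p q) → T (E p q) ⊎ SameEdge u v p q
add⁻ u v E p q h with T-∨⁻ (E p q) h
... | inj₁ k = inj₁ k
... | inj₂ k = inj₂ (isPair⁻ u v p q k)

add-old : (u v : Fin m) (E : Adj m) (p q : Fin m) → T (E p q) → T (add u v E p q)
add-old u v E p q h = T-∨ˡ h

add-new : (u v : Fin m) (E : Adj m) (p q : Fin m) → SameEdge u v p q → T (add u v E p q)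
add-new u v E p q h = T-∨ʳ (E p q) (isPair⁺ u v p q h)

rem⁻ : (u v : Fin m) (E : Adj m) (p q : Fin m) → T (rem u v E p q) → T (E p q) × ¬ SameEdge u v p q
rem⁻ u v E p q h = let k₁ , k₂ = T-∧⁻ (E p q) h in k₁ , λ s → T-not⁻ k₂ (isPair⁺ u v p q s)

rem⁺ : (u v : Fin m) (E : Adj m) (p q : Fin m) → T (E p q) → ¬ SameEdge u v p q → T (rem u v E p q)
rem⁺ u v E p q h n = T-∧⁺ h (T-not⁺ (n ∘ isPair⁻ u v p q))

≐-T : {E F : Adj m} → E ≐ F → ∀ {p q} → T (E p q) → T (F p q)
≐-T e {p} {q} = subst T (e p q)

≐-T˘ : {E F : Adj m} → E ≐ F → ∀ {p q} → T (F p q) → T (E p q)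
≐-T˘ e {p} {q} = subst T (sym (e p q))

Sym : Adj m → Set
Sym E = ∀ {p q} → T (E p q) → T (E q p)

Irr : Adj m → Set
Irr E = ∀ {p} → ¬ T (E p p)

add-Sym : {u v : Fin m} {E : Adj m} → Sym E → Sym (add u v E)
add-Sym {u = u} {v} {E} s {p} {q} h with add⁻ u v E p q h
... | inj₁ k = add-old u v E q p (s k)
... | inj₂ k = add-new u v E q p (flipʳ k)

rem-Sym : {u v : Fin m} {E : Adj m} → Sym E → Sym (rem u v E)
rem-Sym {u = u} {v} {E} s {p} {q} h with rem⁻ u v E p q h
... | k , n = rem⁺ u v E q p (s k) (n ∘ flipʳ)

add-Irr : {u v : Fin m} {E : Adj m} → u ≢ v → Irr E → Irr (add u v E)
add-Irr {u = u} {v} {E} n i {p} h with add⁻ u v E p p h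
... | inj₁ k = i k
... | inj₂ (inj₁ (refl , refl)) = n refl
... | inj₂ (inj₂ (refl , refl)) = n refl

rem-Irr : {u v : Fin m} {E : Adj m} → Irr E → Irr (rem u v E)
rem-Irr {u = u} {v} {E} i {p} h = i (proj₁ (rem⁻ u v E p p h))

_∈ᶠ?_ : (i : Fin m) (xs : List (Fin m)) → Dec (i ∈ xs)
_∈ᶠ?_ = DecMembership._∈?_ _≟_

-- Degrees and colourings

indicator : Bool → ℕ
indicator b = if b then 1 else 0

nbrs : Adj m → Fin m → List (Fin m)
nbrs {m} E v = filter (λ w → T? (E v w)) (allFin m)

sum-indicator : (b : A → Bool) (xs : List A) →
  sum (map (λ w → if b w then 1 else 0) xs) ≡ length (filter (λ w → T? (b w)) xs)
sum-indicator b [] = refl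
sum-indicator b (x ∷ xs) with b x
... | true = cong suc (sum-indicator b xs)
... | false = sum-indicator b xs

deg-nbrs : (E : Adj m) (v : Fin m) → deg E v ≡ length (nbrs E v)
deg-nbrs {m} E v = sum-indicator (E v) (allFin m)

nbrs-unique : (E : Adj m) (v : Fin m) → Unique (nbrs E v)
nbrs-unique {m} E v = Uniq.filter⁺ (λ w → T? (E v w)) (Uniq.allFin⁺ m)

nbrs⁺ : (E : Adj m) {v w : Fin m} → T (E v w) → w ∈ nbrs E v
nbrs⁺ E {v} {w} h = ∈-filter⁺ (λ w → T? (E v w)) (∈-allFin w) h

nbrs⁻ : (E : Adj m) {v w : Fin m} → w ∈ nbrs E v → T (E v w)
nbrs⁻ {m} E {v} h = proj₂ (∈-filter⁻ (λ w → T? (E v w)) {xs = allFin m} h)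

deg-of-list : (E : Adj m) (v : Fin m) (ns : List (Fin m)) → Unique ns →
  (∀ {w} → T (E v w) → w ∈ ns) → (∀ {w} → w ∈ ns → T (E v w)) → deg E v ≡ length ns
deg-of-list E v ns u f g = trans (deg-nbrs E v)
  (unique-≡-length (nbrs-unique E v) u (f ∘ nbrs⁻ E) (nbrs⁺ E ∘ g))

deg-lower : (E : Adj m) (v : Fin m) (ns : List (Fin m)) → Unique ns →
  (∀ {w} → w ∈ ns → T (E v w)) → length ns ≤ deg E v
deg-lower E v ns u g = subst (length ns ≤_) (sym (deg-nbrs E v)) (unique-⊆-length u (nbrs⁺ E ∘ g))

nbr-of-deg-3 : (E : Adj m) {v a b c w : Fin m} → deg E v ≤ 3 → a ≢ b → a ≢ c → b ≢ c →
  T (E v a) → T (E v b) → T (E v c) → T (E v w) → w ≡ a ⊎ w ≡ b ⊎ w ≡ c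
nbr-of-deg-3 E {v} {a} {b} {c} {w} d ab ac bc ha hb hc hw with w ≟ a | w ≟ b | w ≟ c
... | yes e | _ | _ = inj₁ e
... | no _ | yes e | _ = inj₂ (inj₁ e)
... | no _ | no _ | yes e = inj₂ (inj₂ e)
... | no na | no nb | no nc = ⊥-elim (<-irrefl refl (≤-trans
  (deg-lower E v (w ∷ a ∷ b ∷ c ∷ [])
    ((na ∷ nb ∷ nc ∷ []) ∷ (ab ∷ ac ∷ []) ∷ (bc ∷ []) ∷ [] ∷ [])
    (λ { (here refl) → hw ; (there (here refl)) → ha ; (there (there (here refl))) → hb
       ; (there (there (there (here refl)))) → hc })) d))

sum-+ : (f g : A → ℕ) (xs : List A) → sum (map (λ x → f x + g x) xs) ≡ sum (map f xs) + sum (map g xs)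
sum-+ f g [] = refl
sum-+ f g (x ∷ xs) = trans (cong (f x + g x +_) (sum-+ f g xs)) (lem (f x) (g x) _ _)
  where
  lem : ∀ a b c d → (a + b) + (c + d) ≡ (a + c) + (b + d)
  lem = solve-∀

sum-mono : (f g : A → ℕ) (xs : List A) → (∀ x → f x ≤ g x) → sum (map f xs) ≤ sum (map g xs)
sum-mono f g [] h = z≤n
sum-mono f g (x ∷ xs) h = +-mono-≤ (h x) (sum-mono f g xs h)

sum-cong : (f g : A → ℕ) (xs : List A) → (∀ x → f x ≡ g x) → sum (map f xs) ≡ sum (map g xs)
sum-cong f g [] h = refl
sum-cong f g (x ∷ xs) h = cong₂ _+_ (h x) (sum-cong f g xs h)

deg-cong : {E F : Adj m} → E ≐ F → ∀ p → deg E p ≡ deg F p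
deg-cong {m} {E} {F} e p = sum-cong _ _ (allFin m) (λ w → cong indicator (e p w))

δ : Fin m → Fin m → ℕ
δ u p = indicator (p == u)

pairDeg : Fin m → Fin m → Fin m → ℕ
pairDeg {m} u v p = deg (isPair u v) p

δ-self : (u : Fin m) → δ u u ≡ 1
δ-self u with u ≟ u
... | yes _ = refl
... | no n = ⊥-elim (n refl)

δ-other : {u p : Fin m} → p ≢ u → δ u p ≡ 0
δ-other {u = u} {p} n with p ≟ u
... | yes e = ⊥-elim (n e)
... | no _ = refl

pairDeg-δ : {u v : Fin m} → u ≢ v → ∀ p → pairDeg u v p ≡ δ u p + δ v p
pairDeg-δ {u = u} {v} n p = go (p ≟ u) (p ≟ v)
  where
  at-u : ∀ {w} → SameEdge u v u w → w ∈ v ∷ []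
  at-u (inj₁ (_ , refl)) = here refl
  at-u (inj₂ (_ , refl)) = ⊥-elim (n refl)
  at-v : ∀ {w} → SameEdge u v v w → w ∈ u ∷ []
  at-v (inj₂ (refl , _)) = here refl
  at-v (inj₁ (refl , _)) = ⊥-elim (n refl)
  elsewhere : ∀ {w} → p ≢ u → p ≢ v → ¬ SameEdge u v p w
  elsewhere k l (inj₁ (refl , _)) = k refl
  elsewhere k l (inj₂ (_ , refl)) = l refl
  go : Dec (p ≡ u) → Dec (p ≡ v) → pairDeg u v p ≡ δ u p + δ v p
  go (yes refl) (yes refl) = ⊥-elim (n refl)
  go (yes refl) (no k) = trans (deg-of-list (isPair u v) u (v ∷ []) ([] ∷ [])
    (λ {w} h → at-u (isPair⁻ u v u w h)) (λ { (here refl) → isPair⁺ u v u v (inj₁ (refl , refl)) }))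
    (sym (cong₂ _+_ (δ-self u) (δ-other k)))
  go (no k) (yes refl) = trans (deg-of-list (isPair u v) v (u ∷ []) ([] ∷ [])
    (λ {w} h → at-v (isPair⁻ u v v w h)) (λ { (here refl) → isPair⁺ u v v u (inj₂ (refl , refl)) }))
    (sym (cong₂ _+_ (δ-other k) (δ-self v)))
  go (no k) (no l) = trans (deg-of-list (isPair u v) p [] []
    (λ {w} h → ⊥-elim (elsewhere k l (isPair⁻ u v p w h))) (λ ()))
    (sym (cong₂ _+_ (δ-other k) (δ-other l)))

deg-add : {u v : Fin m} (E : Adj m) → u ≢ v → ∀ p → deg (add u v E) p ≤ deg E p + (δ u p + δ v p)
deg-add {m} {u} {v} E n p = ≤-trans (sum-mono _ _ (allFin m) (λ w → or-≤ (E p w) (isPair u v p w)))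
  (≤-reflexive (trans (sum-+ (λ w → indicator (E p w)) (λ w → indicator (isPair u v p w)) (allFin m))
    (cong (deg E p +_) (pairDeg-δ n p))))
  where
  or-≤ : ∀ a b → indicator (a ∨ b) ≤ indicator a + indicator b
  or-≤ true b = s≤s z≤n
  or-≤ false b = ≤-refl

deg-rem : {u v : Fin m} (E : Adj m) → Sym E → u ≢ v → T (E u v) →
  ∀ p → deg E p ≡ deg (rem u v E) p + (δ u p + δ v p)
deg-rem {m} {u} {v} E s n h p = trans (sum-cong _ _ (allFin m)
    (λ w → and-≡ (E p w) (isPair u v p w) (λ k → present (isPair⁻ u v p w k))))
  (trans (sum-+ (λ w → indicator (rem u v E p w)) (λ w → indicator (isPair u v p w)) (allFin m))
    (cong (deg (rem u v E) p +_) (pairDeg-δ n p)))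
  where
  present : ∀ {w} → SameEdge u v p w → T (E p w)
  present (inj₁ (refl , refl)) = h
  present (inj₂ (refl , refl)) = s h
  and-≡ : ∀ a b → (T b → T a) → indicator a ≡ indicator (a ∧ not b) + indicator b
  and-≡ true true h = refl
  and-≡ true false h = refl
  and-≡ false true h = ⊥-elim (h tt)
  and-≡ false false h = refl

InE : Fin m → Fin m → List (Fin m × Fin m) → Set
InE p q L = (p , q) ∈ L ⊎ (q , p) ∈ L

Cov : Adj m → (Fin m → A) → List (Fin m × Fin m) → Set
Cov G f L = ∀ {p q} → T (G p q) → f p ≡ f q ⊎ InE p q L

walk-const : {G : Adj m} {f : Fin m → A} → (∀ {p q} → T (G p q) → f p ≡ f q) →
  ∀ {p q ps} → Walk G p q ps → f p ≡ f q
walk-const c stop = refl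
walk-const c (step h w) = trans (c h) (walk-const c w)

-- Merging the two colours of one bad edge loses at most one of the colours seen on xs.
colours-≤-bad-edges : DecidableEquality A → (G : Adj m) → (∀ p q → Conn G p q) →
  (L : List (Fin m × Fin m)) (f : Fin m → A) → Cov G f L →
  (xs : List (Fin m)) → Unique (map f xs) → length xs ≤ suc (length L)
colours-≤-bad-edges _≟A_ G con [] f c [] u = z≤n
colours-≤-bad-edges _≟A_ G con [] f c (x ∷ []) u = s≤s z≤n
colours-≤-bad-edges _≟A_ G con [] f c (x ∷ y ∷ xs) ((n ∷ _) ∷ _) =
  ⊥-elim (n (walk-const (λ h → [ id , (λ { (inj₁ ()) ; (inj₂ ()) }) ]′ (c h)) (proj₂ (con x y))))
colours-≤-bad-edges {A = A} {m = m} _≟A_ G con ((a , b) ∷ L) f c xs u =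
  ≤-trans (drop-one xs u) (s≤s (colours-≤-bad-edges _≟A_ G con L g cg ys uy))
  where
  other : (x : Fin m) → Dec (f x ≢ f a)
  other x with f x ≟A f a
  ... | yes e = no (λ n → n e)
  ... | no n = yes n
  ys : List (Fin m)
  ys = filter other xs
  merge : (c : A) → Dec (c ≡ f a) → A
  merge c (yes _) = f b
  merge c (no _) = c
  g : Fin m → A
  g x = merge (f x) (f x ≟A f a)
  g-a : ∀ {x} → f x ≡ f a → g x ≡ f b
  g-a {x} e with f x ≟A f a
  ... | yes _ = refl
  ... | no n = ⊥-elim (n e)
  g-other : ∀ {x} → f x ≢ f a → g x ≡ f x
  g-other {x} n with f x ≟A f a
  ... | yes e = ⊥-elim (n e)
  ... | no _ = refl
  g-b : g b ≡ f b
  g-b with f b ≟A f a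
  ... | yes _ = refl
  ... | no _ = refl
  g-cong : ∀ {p q} → f p ≡ f q → g p ≡ g q
  g-cong e rewrite e = refl
  cg : Cov G g L
  cg {p} {q} h with c h
  ... | inj₁ e = inj₁ (g-cong e)
  ... | inj₂ (inj₁ (here refl)) = inj₁ (trans (g-a refl) (sym g-b))
  ... | inj₂ (inj₁ (there k)) = inj₂ (inj₁ k)
  ... | inj₂ (inj₂ (here refl)) = inj₁ (trans g-b (sym (g-a refl)))
  ... | inj₂ (inj₂ (there k)) = inj₂ (inj₂ k)
  uniq : ∀ zs → Unique (map f zs) → Unique (map g (filter other zs))
  uniq [] u = []
  uniq (z ∷ zs) (n ∷ u) with other z
  ... | no _ = uniq zs u
  ... | yes k = ∉⇒All≢ notin ∷ uniq zs u
    where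
    notin : g z ∉ map g (filter other zs)
    notin h with ∈-map⁻ g h
    ... | w , w∈ , e with ∈-filter⁻ other {xs = zs} w∈
    ... | w∈zs , k′ = All≢⇒∉ n (subst (_∈ map f zs)
      (trans (sym (g-other k′)) (trans (sym e) (g-other k))) (∈-map⁺ f w∈zs))
  uy : Unique (map g ys)
  uy = uniq xs u
  drop-one : ∀ zs → Unique (map f zs) → length zs ≤ suc (length (filter other zs))
  drop-one [] u = z≤n
  drop-one (z ∷ zs) (n ∷ u) with f z ≟A f a
  ... | no _ = s≤s (drop-one zs u)
  ... | yes e = s≤s (≤-reflexive (cong length (sym (filter-all other {xs = zs}
    (All.tabulate (λ {w} w∈ e′ → All≢⇒∉ n (subst (_∈ map f zs) (trans e′ (sym e)) (∈-map⁺ f w∈))))))))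

-- Moving one vertex of degree two

Edge : ℕ → Set
Edge m = Fin m × Fin m

redirect : (u v : Fin m) → Edge m → Edge m → Edge m
redirect u v n (p , q) with sameEdge? u v p q
... | yes _ = n
... | no _ = p , q

redirect-keep : (u v : Fin m) (n : Edge m) {p q : Fin m} → ¬ SameEdge u v p q → redirect u v n (p , q) ≡ (p , q)
redirect-keep u v n {p} {q} k with sameEdge? u v p q
... | yes e = ⊥-elim (k e)
... | no _ = refl

redirect-hit : (u v : Fin m) (n : Edge m) {p q : Fin m} → SameEdge u v p q → redirect u v n (p , q) ≡ n
redirect-hit u v n {p} {q} k with sameEdge? u v p q
... | yes e = refl
... | no l = ⊥-elim (l k)

redirect-keep-∈ : (u v : Fin m) (n : Edge m) {L : List (Edge m)} {p q : Fin m} → ¬ SameEdge u v p q →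
  InE p q L → InE p q (map (redirect u v n) L)
redirect-keep-∈ u v n {L} k (inj₁ h) = inj₁ (subst (_∈ map (redirect u v n) L) (redirect-keep u v n k) (∈-map⁺ (redirect u v n) h))
redirect-keep-∈ u v n {L} k (inj₂ h) = inj₂ (subst (_∈ map (redirect u v n) L) (redirect-keep u v n (k ∘ flipʳ)) (∈-map⁺ (redirect u v n) h))

redirect-hit-∈ : (u v : Fin m) (n : Edge m) {L : List (Edge m)} →
  InE u v L → n ∈ map (redirect u v n) L
redirect-hit-∈ u v n {L} (inj₁ h) = subst (_∈ map (redirect u v n) L) (redirect-hit u v n (inj₁ (refl , refl))) (∈-map⁺ (redirect u v n) h)
redirect-hit-∈ u v n {L} (inj₂ h) = subst (_∈ map (redirect u v n) L) (redirect-hit u v n (inj₂ (refl , refl))) (∈-map⁺ (redirect u v n) h)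

∈-InE : {p q p′ q′ : Fin m} {L : List (Edge m)} → (p , q) ∈ L → SameEdge p q p′ q′ → InE p′ q′ L
∈-InE h (inj₁ (refl , refl)) = inj₁ h
∈-InE h (inj₂ (refl , refl)) = inj₂ h

upd : (Fin m → A) → Fin m → A → Fin m → A
upd f u c p with p ≟ u
... | yes _ = c
... | no _ = f p

upd-self : (f : Fin m → A) (u : Fin m) (c : A) → upd f u c u ≡ c
upd-self f u c with u ≟ u
... | yes _ = refl
... | no n = ⊥-elim (n refl)

upd-other : (f : Fin m → A) {u : Fin m} (c : A) {p : Fin m} → p ≢ u → upd f u c p ≡ f p
upd-other f {u} c {p} n with p ≟ u
... | yes e = ⊥-elim (n e)
... | no _ = refl

CutAt : Adj m → Fin m → Fin m → Set
CutAt {m} G p q = Σ (Fin m → Bool) λ g →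
  g p ≢ g q × (∀ {p′ q′} → T (G p′ q′) → g p′ ≡ g q′ ⊎ SameEdge p q p′ q′)

Cut : Adj m → Set
Cut G = ∀ {p q} → T (G p q) → CutAt G p q

CutAt-same : {G : Adj m} {p q p′ q′ : Fin m} → SameEdge p q p′ q′ → CutAt G p q → CutAt G p′ q′
CutAt-same (inj₁ (refl , refl)) c = c
CutAt-same (inj₂ (refl , refl)) (g , n , c) = g , (n ∘ sym) , λ h → [ inj₁ , inj₂ ∘ flipˡ ]′ (c h)

const-same : {f : Fin m → A} {p q p′ q′ : Fin m} → SameEdge p q p′ q′ → f p ≡ f q → f p′ ≡ f q′
const-same (inj₁ (refl , refl)) e = e
const-same (inj₂ (refl , refl)) e = sym e

Const : Adj m → (Fin m → A) → Set
Const G f = ∀ {p q} → T (G p q) → f p ≡ f q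

module Regraft {m} (G : Adj m) (s : Sym G) (i : Irr G) (u a b : Fin m) (a≢b : a ≢ b)
  (ua : T (G u a)) (ub : T (G u b)) (nb : ∀ {w} → T (G u w) → w ≡ a ⊎ w ≡ b)
  (e f : Fin m) (ef : T (suppress u a b G e f)) where

  G₁ G₂ H H₁ H₂ S : Adj m
  G₁ = rem u b G
  G₂ = rem u a G₁
  H = suppress u a b G
  H₁ = rem e f H
  H₂ = add u f H₁
  S = subdivide u e f H

  u≢a : u ≢ a
  u≢a refl = i ua
  u≢b : u ≢ b
  u≢b refl = i ub

  H⁻ : ∀ {p q} → T (H p q) → (T (G p q) × ¬ SameEdge u a p q × ¬ SameEdge u b p q) ⊎ SameEdge a b p q
  H⁻ {p} {q} h with add⁻ a b G₂ p q h
  ... | inj₂ k = inj₂ k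
  ... | inj₁ k with rem⁻ u a G₁ p q k
  ... | k₁ , k₂ with rem⁻ u b G p q k₁
  ... | k₃ , k₄ = inj₁ (k₃ , k₂ , k₄)

  H-old : ∀ {p q} → T (G p q) → ¬ SameEdge u a p q → ¬ SameEdge u b p q → T (H p q)
  H-old {p} {q} h k l = add-old a b G₂ p q (rem⁺ u a G₁ p q (rem⁺ u b G p q h l) k)

  H-new : ∀ {p q} → SameEdge a b p q → T (H p q)
  H-new {p} {q} = add-new a b G₂ p q

  H-Sym : Sym H
  H-Sym = add-Sym {E = rem u a (rem u b G)} (rem-Sym {E = rem u b G} (rem-Sym {E = G} s))

  H-Irr : Irr H
  H-Irr = add-Irr {E = rem u a (rem u b G)} a≢b (rem-Irr {E = rem u b G} (rem-Irr {E = G} i))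

  isolated : ∀ {w} → ¬ T (H u w)
  isolated h with H⁻ h
  ... | inj₂ (inj₁ (refl , _)) = u≢a refl
  ... | inj₂ (inj₂ (_ , refl)) = u≢b refl
  ... | inj₁ (k , k₁ , k₂) with nb k
  ... | inj₁ refl = k₁ (inj₁ (refl , refl))
  ... | inj₂ refl = k₂ (inj₁ (refl , refl))

  e≢u : e ≢ u
  e≢u refl = isolated ef
  f≢u : f ≢ u
  f≢u refl = isolated (H-Sym ef)
  e≢f : e ≢ f
  e≢f refl = H-Irr ef

  S⁻ : ∀ {p q} → T (S p q) → (T (H p q) × ¬ SameEdge e f p q) ⊎ SameEdge u f p q ⊎ SameEdge u e p q
  S⁻ {p} {q} h with add⁻ u e H₂ p q h
  ... | inj₂ k = inj₂ (inj₂ k)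
  ... | inj₁ k with add⁻ u f H₁ p q k
  ... | inj₂ l = inj₂ (inj₁ l)
  ... | inj₁ l = inj₁ (rem⁻ e f H p q l)

  S-old : ∀ {p q} → T (H p q) → ¬ SameEdge e f p q → T (S p q)
  S-old {p} {q} h k = add-old u e H₂ p q (add-old u f H₁ p q (rem⁺ e f H p q h k))

  S-uf : ∀ {p q} → SameEdge u f p q → T (S p q)
  S-uf {p} {q} k = add-old u e H₂ p q (add-new u f H₁ p q k)

  S-ue : ∀ {p q} → SameEdge u e p q → T (S p q)
  S-ue {p} {q} k = add-new u e H₂ p q k

  S-Sym : Sym S
  S-Sym = add-Sym {E = add u f (rem e f H)} (add-Sym {E = rem e f H} (rem-Sym {E = H} H-Sym))

  S-Irr : Irr S
  S-Irr = add-Irr {E = add u f (rem e f H)} (e≢u ∘ sym) (add-Irr {E = rem e f H} (f≢u ∘ sym) (rem-Irr {E = H} H-Irr))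

  H-≢u : ∀ {p q} → T (H p q) → p ≢ u × q ≢ u
  H-≢u h = (λ { refl → isolated h }) , (λ { refl → isolated (H-Sym h) })

  ua≁ab : ¬ SameEdge u a a b
  ua≁ab (inj₁ (refl , _)) = u≢a refl
  ua≁ab (inj₂ (refl , _)) = u≢b refl

  H-Cov : {c : Fin m → A} {L : List (Edge m)} → Cov G c L →
    Cov H c (map (redirect u a (a , b)) (map (redirect u b (a , b)) L))
  H-Cov {c = c} {L} cov h with H⁻ h
  ... | inj₁ (k , k₁ , k₂) = [ inj₁ , (λ x → inj₂ (redirect-keep-∈ u a (a , b) k₁ (redirect-keep-∈ u b (a , b) k₂ x))) ]′ (cov k)
  ... | inj₂ k with cov ua | cov ub
  ... | inj₁ x | inj₁ y = inj₁ (const-same {f = c} k (trans (sym x) y))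
  ... | inj₂ x | _ = inj₂ (∈-InE (redirect-hit-∈ u a (a , b) (redirect-keep-∈ u b (a , b)
          (λ { (inj₁ (_ , e)) → a≢b (sym e) ; (inj₂ (e , _)) → u≢a e }) x)) k)
  ... | inj₁ _ | inj₂ y with redirect-keep-∈ u a (a , b) ua≁ab (inj₁ (redirect-hit-∈ u b (a , b) y))
  ... | inj₁ z = inj₂ (∈-InE z k)
  ... | inj₂ z = inj₂ (∈-InE z (flipˡ k))

  S-Cov : {c : Fin m → A} {L : List (Edge m)} → Cov H c L →
    Cov S (upd c u (c e)) (map (redirect e f (u , f)) L)
  S-Cov {c = c} {L} cov {p} {q} h with S⁻ h
  ... | inj₂ (inj₂ k) = inj₁ (const-same {f = upd c u (c e)} k (trans (upd-self c u (c e)) (sym (upd-other c (c e) e≢u))))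
  ... | inj₂ (inj₁ k) with cov ef
  ... | inj₁ x = inj₁ (const-same {f = upd c u (c e)} k
          (trans (upd-self c u (c e)) (trans x (sym (upd-other c (c e) f≢u)))))
  ... | inj₂ x = inj₂ (∈-InE (redirect-hit-∈ e f (u , f) x) k)
  S-Cov {c = c} {L} cov {p} {q} h | inj₁ (k , n) with cov k
  ... | inj₂ x = inj₂ (redirect-keep-∈ e f (u , f) n x)
  ... | inj₁ x = inj₁ (trans (upd-other c (c e) (proj₁ (H-≢u k))) (trans x (sym (upd-other c (c e) (proj₂ (H-≢u k))))))

  relist : List (Edge m) → List (Edge m)
  relist L = map (redirect e f (u , f)) (map (redirect u a (a , b)) (map (redirect u b (a , b)) L))

  relist-length : ∀ L → length (relist L) ≡ length L
  relist-length L = trans (length-map (redirect e f (u , f)) (map (redirect u a (a , b)) (map (redirect u b (a , b)) L)))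
    (trans (length-map (redirect u a (a , b)) (map (redirect u b (a , b)) L)) (length-map (redirect u b (a , b)) L))

  H-Cut : Cut G → Cut H
  H-Cut cut {p} {q} h with H⁻ h
  ... | inj₁ (k , k₁ , k₂) with cut k
  ... | g , n , c = g , n , λ {p′} {q′} h′ → go (H⁻ h′)
    where
    keep : ∀ {x} → T (G u x) → ¬ SameEdge u x p q → g u ≡ g x
    keep t no′ with c t
    ... | inj₁ x = x
    ... | inj₂ x = ⊥-elim (no′ (sameEdge-sym x))
    go : ∀ {p′ q′} → _ → g p′ ≡ g q′ ⊎ SameEdge p q p′ q′
    go (inj₁ (x , _ , _)) = c x
    go (inj₂ x) = inj₁ (const-same {f = g} x (trans (sym (keep ua k₁)) (keep ub k₂)))
  H-Cut cut {p} {q} h | inj₂ k with cut ua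
  ... | g , n , c = CutAt-same k (g , (λ x → n (trans gub (sym x))) , λ h′ → go (H⁻ h′))
    where
    gub : g u ≡ g b
    gub with c ub
    ... | inj₁ x = x
    ... | inj₂ (inj₁ (_ , x)) = ⊥-elim (a≢b x)
    ... | inj₂ (inj₂ (x , _)) = ⊥-elim (u≢b x)
    go : ∀ {p′ q′} → _ → g p′ ≡ g q′ ⊎ SameEdge a b p′ q′
    go (inj₂ x) = inj₂ x
    go (inj₁ (x , y , _)) with c x
    ... | inj₁ z = inj₁ z
    ... | inj₂ z = ⊥-elim (y z)

  S-cut-by : (g : Fin m → Bool) (c : Bool) {p q : Fin m} →
    (∀ {p′ q′} → T (H p′ q′) → ¬ SameEdge e f p′ q′ → g p′ ≡ g q′ ⊎ SameEdge p q p′ q′) →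
    c ≡ g f ⊎ SameEdge p q u f → c ≡ g e ⊎ SameEdge p q u e →
    ∀ {p′ q′} → T (S p′ q′) → upd g u c p′ ≡ upd g u c q′ ⊎ SameEdge p q p′ q′
  S-cut-by g c {p} {q} old uf ue h with S⁻ h
  ... | inj₁ (x , y) with old x y | H-≢u x
  ... | inj₁ z | p≢ , q≢ = inj₁ (trans (upd-other g c p≢) (trans z (sym (upd-other g c q≢))))
  ... | inj₂ z | _ = inj₂ z
  S-cut-by g c {p} {q} old uf ue h | inj₂ k = [ new f≢u uf , new e≢u ue ]′ k
    where
    new : ∀ {z} → z ≢ u → c ≡ g z ⊎ SameEdge p q u z → ∀ {p′ q′} → SameEdge u z p′ q′ →
      upd g u c p′ ≡ upd g u c q′ ⊎ SameEdge p q p′ q′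
    new z≢u (inj₁ x) k = inj₁ (const-same {f = upd g u c} k (trans (upd-self g u c) (trans x (sym (upd-other g c z≢u)))))
    new z≢u (inj₂ x) (inj₁ (refl , refl)) = inj₂ x
    new z≢u (inj₂ x) (inj₂ (refl , refl)) = inj₂ (flipʳ x)

  S-Cut : Cut H → Cut S
  S-Cut cut {p} {q} h with S⁻ h
  ... | inj₁ (k , k₁) with cut k | H-≢u k
  ... | g , n , c | p≢ , q≢ = upd g u (g e) , (λ x → n (trans (sym (upd-other g (g e) p≢)) (trans x (upd-other g (g e) q≢)))) ,
      S-cut-by g (g e) (λ x _ → c x) (inj₁ gef) (inj₁ refl)
    where
    gef : g e ≡ g f
    gef with c ef
    ... | inj₁ x = x
    ... | inj₂ x = ⊥-elim (k₁ (sameEdge-sym x))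
  S-Cut cut {p} {q} h | inj₂ (inj₁ k) with cut ef
  ... | g , n , c = CutAt-same k (upd g u (g e) , (λ x → n (trans (sym (upd-self g u (g e))) (trans x (upd-other g (g e) f≢u)))) ,
      S-cut-by g (g e) (λ x y → [ inj₁ , ⊥-elim ∘ y ]′ (c x)) (inj₂ (inj₁ (refl , refl))) (inj₁ refl))
  S-Cut cut {p} {q} h | inj₂ (inj₂ k) with cut ef
  ... | g , n , c = CutAt-same k (upd g u (g f) , (λ x → n (sym (trans (sym (upd-self g u (g f))) (trans x (upd-other g (g f) e≢u))))) ,
      S-cut-by g (g f) (λ x y → [ inj₁ , ⊥-elim ∘ y ]′ (c x)) (inj₁ refl) (inj₂ (inj₁ (refl , refl))))

  H-Const : {h : Fin m → A} → Const G h → Const H h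
  H-Const {h = h} c k with H⁻ k
  ... | inj₁ (x , _) = c x
  ... | inj₂ x = const-same {f = h} x (trans (sym (c ua)) (c ub))

  S-Const : {h : Fin m → A} → Const G h → h u ≡ h e → Const S h
  S-Const {h = h} c ue k with S⁻ k
  ... | inj₁ (x , _) = H-Const c x
  ... | inj₂ (inj₁ x) = const-same {f = h} x (trans ue (H-Const c ef))
  ... | inj₂ (inj₂ x) = const-same {f = h} x ue

  S-local⁻ : ∀ {v w} → v ≢ u → v ≢ a → v ≢ b → v ≢ e → v ≢ f → T (S v w) → T (G v w)
  S-local⁻ nu na nb′ ne nf h with S⁻ h
  ... | inj₂ (inj₁ (inj₁ (x , _))) = ⊥-elim (nu (sym x))
  ... | inj₂ (inj₁ (inj₂ (_ , x))) = ⊥-elim (nf (sym x))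
  ... | inj₂ (inj₂ (inj₁ (x , _))) = ⊥-elim (nu (sym x))
  ... | inj₂ (inj₂ (inj₂ (_ , x))) = ⊥-elim (ne (sym x))
  ... | inj₁ (k , _) with H⁻ k
  ... | inj₁ (x , _) = x
  ... | inj₂ (inj₁ (x , _)) = ⊥-elim (na (sym x))
  ... | inj₂ (inj₂ (_ , x)) = ⊥-elim (nb′ (sym x))

  S-local⁺ : ∀ {v w} → v ≢ u → v ≢ a → v ≢ b → v ≢ e → v ≢ f → T (G v w) → T (S v w)
  S-local⁺ nu na nb′ ne nf h = S-old (H-old h
    (λ { (inj₁ (x , _)) → nu (sym x) ; (inj₂ (_ , x)) → na (sym x) })
    (λ { (inj₁ (x , _)) → nu (sym x) ; (inj₂ (_ , x)) → nb′ (sym x) }))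
    (λ { (inj₁ (x , _)) → ne (sym x) ; (inj₂ (_ , x)) → nf (sym x) })

  S-deg : ∀ p → deg S p ≤ deg G p
  S-deg p = ≤-trans d₁ (≤-trans (≤-reflexive (shuffle₁ (deg H₁ p) (δ u p) (δ f p) (δ e p)))
    (≤-trans (+-mono-≤ (≤-trans (≤-reflexive (sym d₂)) d₃) (≤-refl {δ u p + δ u p}))
      (≤-reflexive (trans (shuffle₂ (deg G₂ p) (δ a p) (δ b p) (δ u p))
        (sym (trans d₄ (cong (_+ (δ u p + δ b p)) d₅)))))))
    where
    d₁ : deg S p ≤ deg H₁ p + (δ u p + δ f p) + (δ u p + δ e p)
    d₁ = ≤-trans (deg-add (add u f H₁) (e≢u ∘ sym) p) (+-mono-≤ (deg-add H₁ (f≢u ∘ sym) p) ≤-refl)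
    d₂ : deg H p ≡ deg H₁ p + (δ e p + δ f p)
    d₂ = deg-rem H H-Sym e≢f ef p
    d₃ : deg H p ≤ deg G₂ p + (δ a p + δ b p)
    d₃ = deg-add G₂ a≢b p
    d₄ : deg G p ≡ deg G₁ p + (δ u p + δ b p)
    d₄ = deg-rem G s u≢b ub p
    d₅ : deg G₁ p ≡ deg G₂ p + (δ u p + δ a p)
    d₅ = deg-rem G₁ (rem-Sym {E = G} s) u≢a (rem⁺ u b G u a ua
      (λ { (inj₁ (_ , x)) → a≢b (sym x) ; (inj₂ (x , _)) → u≢a x })) p
    shuffle₁ : ∀ h x y z → h + (x + y) + (x + z) ≡ h + (z + y) + (x + x)
    shuffle₁ = solve-∀
    shuffle₂ : ∀ g x y z → g + (x + y) + (z + z) ≡ g + (z + x) + (z + y)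
    shuffle₂ = solve-∀

-- Parsimony along a sequence of moves

record SideOut (E G : Adj m) (u v : Fin m) (c : Fin m → A) (L : List (Edge m)) (h : Fin m → Bool) (G′ : Adj m) : Set where
  field
    sym′ : Sym G′
    irr′ : Irr G′
    cut′ : Cut G′
    const′ : Const G′ h
    c′ : Fin m → A
    L′ : List (Edge m)
    cov′ : Cov G′ c′ L′
    len′ : length L′ ≡ length L
    off′ : ∀ p → deg E p ≢ 3 → c′ p ≡ c p
    deg′ : ∀ p → deg G′ p ≤ deg G p
    loc⁻ : ∀ {w} → T (G′ v w) → T (G v w)
    loc⁺ : ∀ {w} → T (G v w) → T (G′ v w)

SideOut-≐ : {E G : Adj m} {u v : Fin m} {c : Fin m → A} {L : List (Edge m)} {h : Fin m → Bool} {G′ G″ : Adj m} →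
  G″ ≐ G′ → SideOut E G u v c L h G′ → SideOut E G u v c L h G″
SideOut-≐ {G′ = G′} {G″} e o = record
  { sym′ = λ x → bk (sym′ (fw x)) ; irr′ = λ x → irr′ (fw x)
  ; cut′ = λ x → let g , n , k = cut′ (fw x) in g , n , λ y → k (fw y)
  ; const′ = λ x → const′ (fw x) ; c′ = c′ ; L′ = L′ ; cov′ = λ x → cov′ (fw x) ; len′ = len′ ; off′ = off′
  ; deg′ = λ p → ≤-trans (≤-reflexive (deg-cong e p)) (deg′ p)
  ; loc⁻ = λ x → loc⁻ (fw x) ; loc⁺ = λ x → bk (loc⁺ x) }
  where
  open SideOut o
  fw : ∀ {p q} → T (G″ p q) → T (G′ p q)
  fw = ≐-T e
  bk : ∀ {p q} → T (G′ p q) → T (G″ p q)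
  bk = ≐-T˘ e

module _ (E G : Adj m) (u v : Fin m) (c : Fin m → A) (L : List (Edge m)) (h : Fin m → Bool)
  (s : Sym G) (i : Irr G) (cut : Cut G) (co : Const G h) (hn : h u ≢ h v) (cov : Cov G c L)
  (uv : T (E u v)) (lf : ∀ {w} → T (G u w) → T (E u w) × w ≢ v)
  (lb : ∀ {w} → T (E u w) → w ≢ v → T (G u w)) where

  side : {G′ : Adj m} → TBRSide E G u v G′ → SideOut E G u v c L h G′
  side (inj₁ (_ , e)) = SideOut-≐ e (record
    { sym′ = s ; irr′ = i ; cut′ = cut ; const′ = co ; c′ = c ; L′ = L ; cov′ = cov ; len′ = refl
    ; off′ = λ p _ → refl ; deg′ = λ p → ≤-refl ; loc⁻ = id ; loc⁺ = id })
  side (inj₂ (a , b , e , f , d3 , a≢b , a≢v , b≢v , ua , ub , ef , con , eq)) = SideOut-≐ eq (record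
    { sym′ = S-Sym ; irr′ = S-Irr ; cut′ = S-Cut (H-Cut cut)
    ; const′ = S-Const co hue ; c′ = upd c u (c e)
    ; L′ = relist L
    ; cov′ = S-Cov (H-Cov cov)
    ; len′ = relist-length L
    ; off′ = λ p n → upd-other c (c e) (λ { refl → n d3 })
    ; deg′ = S-deg
    ; loc⁻ = S-local⁻ v≢u (a≢v ∘ sym) (b≢v ∘ sym) v≢e v≢f
    ; loc⁺ = S-local⁺ v≢u (a≢v ∘ sym) (b≢v ∘ sym) v≢e v≢f })
    where
    nb : ∀ {w} → T (G u w) → w ≡ a ⊎ w ≡ b
    nb x with lf x
    ... | y , n with nbr-of-deg-3 E (≤-reflexive d3) a≢b a≢v b≢v ua ub uv y
    ... | inj₁ z = inj₁ z
    ... | inj₂ (inj₁ z) = inj₂ z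
    ... | inj₂ (inj₂ z) = ⊥-elim (n z)
    ga = lb ua a≢v
    gb = lb ub b≢v
    open Regraft G s i u a b a≢b ga gb nb e f ef
    hue : h u ≡ h e
    hue = trans (co ga) (walk-const {f = h} (H-Const co) (proj₂ con))
    v≢u : v ≢ u
    v≢u refl = hn refl
    v≢e : v ≢ e
    v≢e refl = hn hue
    v≢f : v ≢ f
    v≢f refl = hn (trans hue (H-Const co ef))

record Inv (D : Fin m → ℕ) (E : Adj m) : Set where
  field
    isym : Sym E
    iirr : Irr E
    ideg : ∀ p → deg E p ≤ D p

record StepOut (D : Fin m → ℕ) (c : Fin m → A) (L : List (Edge m)) (E′ : Adj m) : Set where
  field
    inv′ : Inv D E′
    c′ : Fin m → A
    L′ : List (Edge m)
    cov′ : Cov E′ c′ L′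
    len′ : length L′ ≡ suc (length L)
    off′ : ∀ p → D p ≤ 1 → c′ p ≡ c p

xor-≡ : ∀ a b c d → a ≡ b → c ≡ d → a xor c ≡ b xor d
xor-≡ a b c d refl refl = refl

xor-≢≢ : ∀ a b c d → a ≢ b → c ≢ d → a xor c ≡ b xor d
xor-≢≢ false false _ _ n _ = ⊥-elim (n refl)
xor-≢≢ true true _ _ n _ = ⊥-elim (n refl)
xor-≢≢ false true false false _ n = ⊥-elim (n refl)
xor-≢≢ false true true true _ n = ⊥-elim (n refl)
xor-≢≢ true false false false _ n = ⊥-elim (n refl)
xor-≢≢ true false true true _ n = ⊥-elim (n refl)
xor-≢≢ false true false true _ n = refl
xor-≢≢ false true true false _ n = refl
xor-≢≢ true false false true _ n = refl
xor-≢≢ true false true false _ n = refl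

xor-cancelʳ : ∀ a b c d → c ≡ d → a xor c ≡ b xor d → a ≡ b
xor-cancelʳ false false c .c refl _ = refl
xor-cancelʳ true true c .c refl _ = refl
xor-cancelʳ false true false .false refl ()
xor-cancelʳ false true true .true refl ()
xor-cancelʳ true false false .false refl ()
xor-cancelʳ true false true .true refl ()

join-Cut : {G : Adj m} {u v : Fin m} (h : Fin m → Bool) → Const G h → h u ≢ h v → Cut G → Cut (add u v G)
join-Cut {G = G} {u} {v} h co hn cut {p} {q} x with add⁻ u v G p q x
... | inj₂ k = CutAt-same k (h , hn , λ {p′} {q′} y → [ (λ z → inj₁ (co z)) , inj₂ ]′ (add⁻ u v G p′ q′ y))
... | inj₁ k with cut k
... | g , n , c with g u Bool.≟ g v
... | yes e = g , n , λ {p′} {q′} y → [ c , (λ z → inj₁ (const-same {f = g} z e)) ]′ (add⁻ u v G p′ q′ y)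
... | no e = g′ , (λ z → n (xor-cancelʳ (g p) (g q) (h p) (h q) (co k) z)) , λ {p′} {q′} y → go (add⁻ u v G p′ q′ y)
  where
  g′ : Fin _ → Bool
  g′ z = g z xor h z
  go : ∀ {p′ q′} → T (G p′ q′) ⊎ SameEdge u v p′ q′ → g′ p′ ≡ g′ q′ ⊎ SameEdge p q p′ q′
  go {p′} {q′} (inj₁ z) = [ (λ w → inj₁ (xor-≡ (g p′) (g q′) (h p′) (h q′) w (co z))) , inj₂ ]′ (c z)
  go (inj₂ z) = inj₁ (const-same {f = g′} z (xor-≢≢ (g u) (g v) (h u) (h v) e hn))

join-Cov : {G : Adj m} {u v : Fin m} {c : Fin m → A} {L : List (Edge m)} → Cov G c L → Cov (add u v G) c ((u , v) ∷ L)
join-Cov {G = G} {u} {v} cov {p} {q} x with add⁻ u v G p q x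
... | inj₂ k = inj₂ (∈-InE (here refl) k)
... | inj₁ k with cov k
... | inj₁ y = inj₁ y
... | inj₂ (inj₁ y) = inj₂ (inj₁ (there y))
... | inj₂ (inj₂ y) = inj₂ (inj₂ (there y))

Inv-≐ : {D : Fin m → ℕ} {E F : Adj m} → E ≐ F → Inv D F → Inv D E
Inv-≐ {E = E} {F} e o = record
  { isym = λ x → ≐-T˘ e (isym (≐-T e x)) ; iirr = λ x → iirr (≐-T e x)
  ; ideg = λ p → ≤-trans (≤-reflexive (deg-cong e p)) (ideg p) }
  where open Inv o

1≢3 : ∀ {d e} → d ≤ e → e ≤ 1 → d ≢ 3
1≢3 le le′ refl with ≤-trans le le′
... | s≤s ()

TBR-step : {D : Fin m → ℕ} {E E′ : Adj m} {c : Fin m → A} {L : List (Edge m)} →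
  Inv D E → Cut E → Cov E c L → TBRMove E E′ → StepOut D c L E′ × Cut E′
TBR-step {D = D} {E} {E′} {c} {L} I cut cov (u , v , G₂ , G₃ , uv , s₁ , s₂ , eq) = out , λ x →
    let g , n , k = join-Cut h (O₂.const′) hn O₂.cut′ (≐-T eq x) in g , n , λ y → k (≐-T eq y)
  where
  open Inv I
  G = rem u v E
  u≢v : u ≢ v
  u≢v refl = iirr uv
  h = proj₁ (cut uv)
  hn = proj₁ (proj₂ (cut uv))
  G-E : ∀ {p q} → T (G p q) → T (E p q) × ¬ SameEdge u v p q
  G-E {p} {q} = rem⁻ u v E p q
  hc : Const G h
  hc x with proj₂ (proj₂ (cut uv)) (proj₁ (G-E x))
  ... | inj₁ y = y
  ... | inj₂ y = ⊥-elim (proj₂ (G-E x) y)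
  G-Cut : Cut G
  G-Cut x = let g , n , k = cut (proj₁ (G-E x)) in g , n , λ y → k (proj₁ (G-E y))
  o₁ : SideOut E G u v c L h G₂
  o₁ = side E G u v c L h (rem-Sym {E = E} isym) (rem-Irr {E = E} iirr) G-Cut hc hn (λ x → cov (proj₁ (G-E x))) uv
    (λ x → proj₁ (G-E x) , λ { refl → proj₂ (G-E x) (inj₁ (refl , refl)) })
    (λ {w} x n → rem⁺ u v E u w x (λ { (inj₁ (_ , y)) → n (sym y) ; (inj₂ (_ , y)) → u≢v (sym y) })) s₁
  module O₁ = SideOut o₁
  o₂ : SideOut E G₂ v u O₁.c′ O₁.L′ h G₃
  o₂ = side E G₂ v u O₁.c′ O₁.L′ h O₁.sym′ O₁.irr′ O₁.cut′ O₁.const′ (hn ∘ sym) O₁.cov′ (isym uv)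
    (λ x → proj₁ (G-E (O₁.loc⁻ x)) , λ { refl → proj₂ (G-E (O₁.loc⁻ x)) (inj₂ (refl , refl)) })
    (λ {w} x n → O₁.loc⁺ (rem⁺ u v E v w x (λ { (inj₁ (y , _)) → u≢v y ; (inj₂ (y , _)) → n (sym y) }))) s₂
  module O₂ = SideOut o₂
  out : StepOut D c L E′
  out = record
    { inv′ = Inv-≐ eq (record
        { isym = add-Sym {E = G₃} O₂.sym′ ; iirr = add-Irr {E = G₃} u≢v O₂.irr′
        ; ideg = λ p → ≤-trans (deg-add G₃ u≢v p) (≤-trans (+-mono-≤ (≤-trans (O₂.deg′ p) (O₁.deg′ p)) ≤-refl)
            (≤-trans (≤-reflexive (sym (deg-rem E isym u≢v uv p))) (ideg p))) })
    ; c′ = O₂.c′ ; L′ = (u , v) ∷ O₂.L′ ; cov′ = λ x → join-Cov O₂.cov′ (≐-T eq x)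
    ; len′ = cong suc (trans O₂.len′ O₁.len′)
    ; off′ = λ p le → trans (O₂.off′ p (1≢3 (ideg p) le)) (O₁.off′ p (1≢3 (ideg p) le)) }

module SPRFacts {m} (E : Adj m) (isym : Sym E) (iirr : Irr E) (x y a b e f : Fin m) (dx : deg E x ≤ 3)
  (xy : T (E x y)) (ax : T (E a x)) (xb : T (E x b)) (ef : T (E e f))
  (n₁ : ¬ SameEdge x y a x) (n₂ : ¬ SameEdge x y x b) (n₃ : ¬ SameEdge x y e f)
  (n₄ : ¬ SameEdge a x x b) (n₅ : ¬ SameEdge a x e f) (n₆ : ¬ SameEdge x b e f) where

  G = rem x y E
  x≢y : x ≢ y
  x≢y refl = iirr xy
  x≢a : x ≢ a
  x≢a refl = iirr ax
  x≢b : x ≢ b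
  x≢b refl = iirr xb
  a≢b : a ≢ b
  a≢b refl = n₄ (inj₂ (refl , refl))
  a≢y : a ≢ y
  a≢y refl = n₁ (inj₂ (refl , refl))
  b≢y : b ≢ y
  b≢y refl = n₂ (inj₁ (refl , refl))
  G-E : ∀ {p q} → T (G p q) → T (E p q) × ¬ SameEdge x y p q
  G-E {p} {q} = rem⁻ x y E p q
  nb : ∀ {w} → T (G x w) → w ≡ a ⊎ w ≡ b
  nb z with G-E z
  ... | k , n with nbr-of-deg-3 E dx a≢b a≢y b≢y (isym ax) xb xy k
  ... | inj₁ r = inj₁ r
  ... | inj₂ (inj₁ r) = inj₂ r
  ... | inj₂ (inj₂ refl) = ⊥-elim (n (inj₁ (refl , refl)))
  three-nbrs : ¬ deg E x ≤ 1
  three-nbrs le with ≤-trans (deg-lower E x (a ∷ b ∷ []) ((a≢b ∷ []) ∷ [] ∷ []) (λ { (here refl) → isym ax ; (there (here refl)) → xb })) le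
  ... | s≤s ()
  xa∈ : T (G x a)
  xa∈ = rem⁺ x y E x a (isym ax) (λ { (inj₁ (_ , r)) → a≢y (sym r) ; (inj₂ (r , _)) → x≢a r })
  xb∈ : T (G x b)
  xb∈ = rem⁺ x y E x b xb (λ { (inj₁ (_ , r)) → b≢y (sym r) ; (inj₂ (r , _)) → x≢b r })
  efH : T (suppress x a b G e f)
  efH = add-old a b (rem x a (rem x b G)) e f (rem⁺ x a (rem x b G) e f (rem⁺ x b G e f (rem⁺ x y E e f ef n₃) n₆) (n₅ ∘ flipˡ))
  open Regraft G (rem-Sym {E = E} isym) (rem-Irr {E = E} iirr) x a b a≢b xa∈ xb∈ nb e f efH public
  R₁ = rem a x E
  R₂ = rem x b R₁
  R₃ = add a b R₂
  R₄ = rem e f R₃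
  R₅ = add e x R₄
  to : ∀ {p q} → T (sprResult x a b e f E p q) → T (add x y S p q)
  to {p} {q} t with add⁻ x f R₅ p q t
  ... | inj₂ k = add-old x y S p q (S-uf k)
  ... | inj₁ t₁ with add⁻ e x R₄ p q t₁
  ... | inj₂ k = add-old x y S p q (S-ue (flipˡ k))
  ... | inj₁ t₂ with rem⁻ e f R₃ p q t₂
  ... | t₃ , ne with add⁻ a b R₂ p q t₃
  ... | inj₂ k = add-old x y S p q (S-old (H-new k) ne)
  ... | inj₁ t₄ with rem⁻ x b R₁ p q t₄
  ... | t₅ , nxb with rem⁻ a x E p q t₅
  ... | t₆ , nax with sameEdge? x y p q
  ... | yes k = add-new x y S p q k
  ... | no k = add-old x y S p q (S-old (H-old (rem⁺ x y E p q t₆ k) (nax ∘ flipˡ) nxb) ne)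
  keep : ∀ {p q} → T (E p q) → ¬ SameEdge a x p q → ¬ SameEdge x b p q → ¬ SameEdge e f p q → T (sprResult x a b e f E p q)
  keep {p} {q} t k₁ k₂ k₃ = add-old x f R₅ p q (add-old e x R₄ p q (rem⁺ e f R₃ p q (add-old a b R₂ p q (rem⁺ x b R₁ p q (rem⁺ a x E p q t k₁) k₂)) k₃))
  present : ∀ {p q} → SameEdge x y p q → T (E p q)
  present (inj₁ (refl , refl)) = xy
  present (inj₂ (refl , refl)) = isym xy
  disj : ∀ {u v p q} → SameEdge x y p q → ¬ SameEdge x y u v → ¬ SameEdge u v p q
  disj (inj₁ (refl , refl)) n k = n (sameEdge-sym k)
  disj (inj₂ (refl , refl)) n k = n (flipˡ (sameEdge-sym k))
  from : ∀ {p q} → T (add x y S p q) → T (sprResult x a b e f E p q)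
  from {p} {q} t with add⁻ x y S p q t
  ... | inj₂ k = keep (present k) (disj k n₁) (disj k n₂) (disj k n₃)
  ... | inj₁ t₁ with S⁻ t₁
  ... | inj₂ (inj₁ k) = add-new x f R₅ p q k
  ... | inj₂ (inj₂ k) = add-old x f R₅ p q (add-new e x R₄ p q (flipˡ k))
  ... | inj₁ (t₂ , ne) with H⁻ t₂
  ... | inj₁ (t₃ , k₁ , k₂) = keep (proj₁ (G-E t₃)) (k₁ ∘ flipˡ) k₂ ne
  ... | inj₂ k = add-old x f R₅ p q (add-old e x R₄ p q (rem⁺ e f R₃ p q (add-new a b R₂ p q k) ne))
  spr-≐ : sprResult x a b e f E ≐ add x y S
  spr-≐ p q = T⇒≡ to from

SPR-step : {D : Fin m → ℕ} {E E′ : Adj m} {c : Fin m → A} {L : List (Edge m)} → (∀ p → D p ≤ 3) →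
  Inv D E → Cov E c L → SPRMove E E′ → StepOut D c L E′
SPR-step {D = D} {E} {E′} {c} {L} D3 I cov (x , y , a , b , e , f , (xy , ax , xb , ef , n₁ , n₂ , n₃ , n₄ , n₅ , n₆ , _) , eq) = record
    { inv′ = Inv-≐ eq′ (record
        { isym = add-Sym {E = S} S-Sym ; iirr = add-Irr {E = S} x≢y S-Irr
        ; ideg = λ p → ≤-trans (deg-add S x≢y p) (≤-trans (+-mono-≤ (S-deg p) ≤-refl)
            (≤-trans (≤-reflexive (sym (deg-rem E isym x≢y xy p))) (ideg p))) })
    ; c′ = upd c x (c e)
    ; L′ = (x , y) ∷ relist L
    ; cov′ = λ z → join-Cov (S-Cov (H-Cov (λ w → cov (proj₁ (G-E w))))) (≐-T eq′ z)
    ; len′ = cong suc (relist-length L)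
    ; off′ = λ p le → upd-other c (c e) (λ { refl → three-nbrs (≤-trans (ideg x) le) }) }
  where
  open Inv I
  open SPRFacts E isym iirr x y a b e f (≤-trans (ideg x) (D3 x)) xy ax xb ef n₁ n₂ n₃ n₄ n₅ n₆
  eq′ : E′ ≐ add x y S
  eq′ p q = trans (eq p q) (spr-≐ p q)

rSPR⇒SPR : {r : Fin m} {E E′ : Adj m} → rSPRMove r E E′ → SPRMove E E′
rSPR⇒SPR (x , y , a , b , c , d , s , _ , e) = x , y , a , b , c , d , s , e

StepsOut : (D : Fin m → ℕ) (k : ℕ) (c : Fin m → A) (L : List (Edge m)) (E′ : Adj m) → Set
StepsOut {m} {A} D k c L E′ = Σ (Fin m → A) λ c′ → ∃[ L′ ]
  (Cov E′ c′ L′ × length L′ ≤ k + length L × (∀ p → D p ≤ 1 → c′ p ≡ c p))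

steps-SPR : {Mv : Adj m → Adj m → Set} {D : Fin m → ℕ} {k : ℕ} {E E′ : Adj m} {c : Fin m → A} {L : List (Edge m)} →
  (∀ {E E′} → Mv E E′ → SPRMove E E′) →
  (∀ p → D p ≤ 3) → Inv D E → Cov E c L → Steps Mv k E E′ → StepsOut D k c L E′
steps-SPR {c = c} {L} f D3 I cov (done {k}) = c , L , cov , m≤n+m _ k , λ p _ → refl
steps-SPR f D3 I cov (more {k} s ss) with SPR-step D3 I cov (f s)
... | o with steps-SPR f D3 (StepOut.inv′ o) (StepOut.cov′ o) ss
... | c″ , L″ , cov″ , le , off = c″ , L″ , cov″ ,
  ≤-trans le (≤-reflexive (trans (cong (k +_) (StepOut.len′ o)) (+-suc k _))) ,
  λ p d → trans (off p d) (StepOut.off′ o p d)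

steps-TBR : {D : Fin m → ℕ} {k : ℕ} {E E′ : Adj m} {c : Fin m → A} {L : List (Edge m)} →
  Inv D E → Cut E → Cov E c L → Steps TBRMove k E E′ → StepsOut D k c L E′
steps-TBR {c = c} {L} I cut cov (done {k}) = c , L , cov , m≤n+m _ k , λ p _ → refl
steps-TBR I cut cov (more {k} s ss) with TBR-step I cut cov s
... | o , cut′ with steps-TBR (StepOut.inv′ o) cut′ (StepOut.cov′ o) ss
... | c″ , L″ , cov″ , le , off = c″ , L″ , cov″ ,
  ≤-trans le (≤-reflexive (trans (cong (k +_) (StepOut.len′ o)) (+-suc k _))) ,
  λ p d → trans (off p d) (StepOut.off′ o p d)

steps-parsimony : (χ : Model) {r : Fin m} {D : Fin m → ℕ} {k : ℕ} {E E′ : Adj m} {c : Fin m → A} {L : List (Edge m)} →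
  (∀ p → D p ≤ 3) → Inv D E → Cut E → Cov E c L → Steps (Move χ r) k E E′ → StepsOut D k c L E′
steps-parsimony TBR D3 I cut cov ss = steps-TBR I cut cov ss
steps-parsimony SPR D3 I cut cov ss = steps-SPR id D3 I cov ss
steps-parsimony rSPR D3 I cut cov ss = steps-SPR rSPR⇒SPR D3 I cov ss

-- Rooted binary terms

-- A term is the part of a tree below the leaf 0: inner nodes carry their vertex and a colour,
-- leaves their label.  The colours are bookkeeping and do not enter the edges.
data Tr (n m : ℕ) : Set where
  lf : Fin (suc n) → Tr n m
  nd : Fin m → ℕ → Tr n m → Tr n m → Tr n m

labels : Tr n m → List (Fin (suc n))
labels (lf i) = i ∷ []
labels (nd v c l r) = labels l ++ labels r

-- Ins Y x c t₀ t: t arises from t₀ by subdividing an edge (or the edge above the top) by x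
-- and hanging Y from x.  An rSPR move takes t to t′ with Ins Y x _ t₀ t and Ins Y x _ t₀ t′.
data Ins (Y : Tr n m) (x : Fin m) (c : ℕ) : Tr n m → Tr n m → Set where
  hereL : ∀ {D} → Ins Y x c D (nd x c Y D)
  hereR : ∀ {D} → Ins Y x c D (nd x c D Y)
  left  : ∀ {v d l l′ r} → Ins Y x c l l′ → Ins Y x c (nd v d l r) (nd v d l′ r)
  right : ∀ {v d l r r′} → Ins Y x c r r′ → Ins Y x c (nd v d l r) (nd v d l r′)

Ins-labels : {Y t₀ t : Tr n m} {x : Fin m} {c : ℕ} → Ins Y x c t₀ t → labels t ↭ labels Y ++ labels t₀
Ins-labels hereL = ↭-refl
Ins-labels {Y = Y} {t₀} hereR = ++-comm (labels t₀) (labels Y)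
Ins-labels {Y = Y} (left {r = r} i) = ↭-trans (++⁺ʳ (labels r) (Ins-labels i)) (↭-reflexive (++-assoc (labels Y) _ (labels r)))
Ins-labels {Y = Y} (right {l = l} i) = ↭-trans (++⁺ˡ (labels l) (Ins-labels i)) (shifts (labels l) (labels Y))

data PathIn {m} (E : Adj m) (P : Fin m → Set) : Fin m → Fin m → Set where
  nil  : ∀ {a} → P a → PathIn E P a a
  cons : ∀ {a b c} → P a → T (E a b) → PathIn E P b c → PathIn E P a c

path-map : {E : Adj m} {P Q : Fin m → Set} → (∀ {z} → P z → Q z) → ∀ {a b} → PathIn E P a b → PathIn E Q a b
path-map f (nil p) = nil (f p)
path-map f (cons p e q) = cons (f p) e (path-map f q)

path-++ : {E : Adj m} {P : Fin m → Set} → ∀ {a b c} → PathIn E P a b → PathIn E P b c → PathIn E P a c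
path-++ (nil p) q = q
path-++ (cons p e q) q′ = cons p e (path-++ q q′)

path-start : {E : Adj m} {P : Fin m → Set} → ∀ {a b} → PathIn E P a b → P a
path-start (nil p) = p
path-start (cons p _ _) = p

path-rev : {E : Adj m} {P : Fin m → Set} → Sym E → ∀ {a b} → PathIn E P a b → PathIn E P b a
path-rev s (nil p) = nil p
path-rev s (cons p e q) = path-++ (path-rev s q) (cons (path-start q) (s e) (nil p))

path-graph : {E F : Adj m} {P : Fin m → Set} → (∀ {p q} → P p → P q → T (E p q) → T (F p q)) →
  ∀ {a b} → PathIn E P a b → PathIn F P a b
path-graph f (nil p) = nil p
path-graph f (cons p e q) = cons p (f p (path-start q) e) (path-graph f q)

path-conn : {E : Adj m} {P : Fin m → Set} → ∀ {a b} → PathIn E P a b → Conn E a b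
path-conn (nil p) = _ , stop
path-conn (cons p e q) = _ , step e (proj₂ (path-conn q))

module Named {n m} (ℓ : Fin (suc n) → Fin m) where

  top : Tr n m → Fin m
  top (lf i) = ℓ i
  top (nd v c l r) = v

  verts : Tr n m → List (Fin m)
  verts (lf i) = ℓ i ∷ []
  verts (nd v c l r) = v ∷ verts l ++ verts r

  inner : Tr n m → List (Edge m)
  edges : Fin m → Tr n m → List (Edge m)
  inner (lf i) = []
  inner (nd v c l r) = edges v l ++ edges v r
  edges p t = (p , top t) ∷ inner t

  top∈ : ∀ t → top t ∈ verts t
  top∈ (lf i) = here refl
  top∈ (nd v c l r) = here refl

  inl : ∀ {v c l r z} → z ∈ verts l → z ∈ verts (nd v c l r)
  inl h = there (∈-++⁺ˡ h)

  inr : ∀ {v c} l {r z} → z ∈ verts r → z ∈ verts (nd v c l r)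
  inr l h = there (∈-++⁺ʳ (verts l) h)

  inner-ends : ∀ t {p q} → (p , q) ∈ inner t → p ∈ verts t × q ∈ verts t
  edges-ends : ∀ r t {p q} → (p , q) ∈ edges r t → p ∈ r ∷ verts t × q ∈ verts t
  inner-ends (nd v c l r) h with ∈-++⁻ (edges v l) h
  ... | inj₁ k with edges-ends v l k
  ... | here refl , b = here refl , inl {v} {c} {l} {r} b
  ... | there a , b = inl {v} {c} {l} {r} a , inl {v} {c} {l} {r} b
  inner-ends (nd v c l r) h | inj₂ k with edges-ends v r k
  ... | here refl , b = here refl , inr {v} {c} l {r} b
  ... | there a , b = inr {v} {c} l {r} a , inr {v} {c} l {r} b
  edges-ends r t (here refl) = here refl , top∈ t
  edges-ends r t (there h) = let a , b = inner-ends t h in there a , b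

  node-unique : ∀ {v c} l {r} → Unique (verts (nd v c l r)) →
    Unique (v ∷ verts l) × Unique (v ∷ verts r) × (∀ {z} → z ∈ verts l → z ∉ verts r)
  node-unique l u with unique-++ (verts l) (tail-unique u)
  ... | ul , ur , d = ∷-unique (λ h → head∉ u (∈-++⁺ˡ h)) ul , ∷-unique (λ h → head∉ u (∈-++⁺ʳ (verts l) h)) ur , d

  DiffEdge : Edge m → Edge m → Set
  DiffEdge (p , q) (p′ , q′) = ¬ SameEdge p q p′ q′

  DiffEdge-resp-↭ : {xs ys : List (Edge m)} → xs ↭ ys → AllPairs DiffEdge xs → AllPairs DiffEdge ys
  DiffEdge-resp-↭ Perm.refl u = u
  DiffEdge-resp-↭ (Perm.prep x p) (a ∷ u) = All-resp-↭ p a ∷ DiffEdge-resp-↭ p u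
  DiffEdge-resp-↭ (Perm.swap x y p) ((k ∷ a) ∷ b ∷ u) =
    ((k ∘ sameEdge-sym) ∷ All-resp-↭ p b) ∷ All-resp-↭ p a ∷ DiffEdge-resp-↭ p u
  DiffEdge-resp-↭ (Perm.trans p q) u = DiffEdge-resp-↭ q (DiffEdge-resp-↭ p u)

  AllPairs-++ : {xs ys : List (Edge m)} → AllPairs DiffEdge xs → AllPairs DiffEdge ys →
    (∀ {x y} → x ∈ xs → y ∈ ys → DiffEdge x y) → AllPairs DiffEdge (xs ++ ys)
  AllPairs-++ [] b d = b
  AllPairs-++ {xs = x ∷ xs} {ys} (p ∷ a) b d = All.tabulate (λ {y} h → [ All.lookup p , d (here refl) ]′ (∈-++⁻ xs h))
    ∷ AllPairs-++ a b (λ h k → d (there h) k)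

  edges-distinct : ∀ r t → Unique (r ∷ verts t) → AllPairs DiffEdge (edges r t)
  edges-distinct r (lf i) u = [] ∷ []
  edges-distinct r (nd v c l s) u = All.tabulate first ∷
      AllPairs-++ (edges-distinct v l ul) (edges-distinct v s us) cross
    where
    ul = proj₁ (node-unique {v} {c} l {s} (tail-unique u))
    us = proj₁ (proj₂ (node-unique {v} {c} l {s} (tail-unique u)))
    dj = proj₂ (proj₂ (node-unique {v} {c} l {s} (tail-unique u)))
    first : ∀ {e} → e ∈ inner (nd v c l s) → DiffEdge (r , v) e
    first h (inj₁ (refl , _)) = head∉ u (proj₁ (inner-ends (nd v c l s) h))
    first h (inj₂ (refl , _)) = head∉ u (proj₂ (inner-ends (nd v c l s) h))
    cross : ∀ {x y} → x ∈ edges v l → y ∈ edges v s → DiffEdge x y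
    cross h k (inj₁ (_ , refl)) = dj (proj₂ (edges-ends v l h)) (proj₂ (edges-ends v s k))
    cross h k (inj₂ (_ , refl)) with proj₁ (edges-ends v s k)
    ... | here refl = head∉ ul (proj₂ (edges-ends v l h))
    ... | there z = dj (proj₂ (edges-ends v l h)) z

  stalk : Tr n m → Fin m → Fin m → Fin m → List (Edge m)
  stalk Y x a b = (a , x) ∷ (x , b) ∷ (x , top Y) ∷ inner Y

  Ins-edges : ∀ {Y x c t₀ t} → Ins Y x c t₀ t → ∀ p → ∃[ a ] ∃[ b ] ∃[ R ]
    (edges p t₀ ↭ (a , b) ∷ R × edges p t ↭ stalk Y x a b ++ R)
  Ins-edges {Y} {x} {t₀ = t₀} hereL p = p , top t₀ , inner t₀ , ↭-refl ,
    ↭-prep _ (shift (x , top t₀) (edges x Y) (inner t₀))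
  Ins-edges {Y} {x} {t₀ = t₀} hereR p = p , top t₀ , inner t₀ , ↭-refl ,
    ↭-prep _ (↭-prep _ (++-comm (inner t₀) (edges x Y)))
  Ins-edges {Y} {x} (left {v} {l = l} {r = r} i) p with Ins-edges i v
  ... | a , b , R , e₀ , e = a , b , (p , v) ∷ R ++ edges v r ,
    ↭-trans (↭-prep _ (++⁺ʳ (edges v r) e₀)) (↭-swap _ _ ↭-refl) ,
    ↭-trans (↭-prep _ (↭-trans (++⁺ʳ (edges v r) e) (↭-reflexive (++-assoc (stalk Y x a b) R (edges v r)))))
      (↭-sym (shift (p , v) (stalk Y x a b) (R ++ edges v r)))
  Ins-edges {Y} {x} (right {v} {l = l} {r = r} i) p with Ins-edges i v
  ... | a , b , R , e₀ , e = a , b , (p , v) ∷ edges v l ++ R ,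
    ↭-trans (++⁺ˡ ((p , v) ∷ edges v l) e₀) (shift (a , b) ((p , v) ∷ edges v l) R) ,
    ↭-trans (++⁺ˡ ((p , v) ∷ edges v l) e) (shifts ((p , v) ∷ edges v l) (stalk Y x a b))

  Ins-verts : ∀ {Y x c t₀ t} → Ins Y x c t₀ t → verts t ↭ x ∷ verts Y ++ verts t₀
  Ins-verts hereL = ↭-refl
  Ins-verts {Y} {x} {t₀ = t₀} hereR = ↭-prep x (++-comm (verts t₀) (verts Y))
  Ins-verts {Y} {x} (left {v} {l = l} {r = r} i) =
    ↭-trans (↭-prep v (↭-trans (++⁺ʳ (verts r) (Ins-verts i)) (↭-reflexive (++-assoc (x ∷ verts Y) (verts l) (verts r)))))
      (↭-sym (shift v (x ∷ verts Y) (verts l ++ verts r)))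
  Ins-verts {Y} {x} (right {v} {l = l} {r = r} i) =
    ↭-trans (++⁺ˡ (v ∷ verts l) (Ins-verts i)) (shifts (v ∷ verts l) (x ∷ verts Y))

  down : (E : Adj m) → ∀ t → (∀ {p q} → (p , q) ∈ inner t → T (E p q)) →
    ∀ {z} → z ∈ verts t → PathIn E (_∈ verts t) (top t) z
  down E (lf i) f (here refl) = nil (here refl)
  down E (nd v c l r) f (here refl) = nil (here refl)
  down E (nd v c l r) f (there h) with ∈-++⁻ (verts l) h
  ... | inj₁ k = cons (here refl) (f (here refl))
    (path-map (inl {v} {c} {l} {r}) (down E l (λ e → f (∈-++⁺ˡ {xs = edges v l} (there e))) k))
  ... | inj₂ k = cons (here refl) (f (∈-++⁺ʳ (edges v l) (here refl)))
    (path-map (inr {v} {c} l {r}) (down E r (λ e → f (∈-++⁺ʳ (edges v l) (there e))) k))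

  TermCut : Fin m → Tr n m → Fin m → Fin m → Set
  TermCut r t a b = Σ (Fin m → Bool) λ g →
    g a ≢ g b × (∀ {p q} → (p , q) ∈ edges r t → g p ≡ g q ⊎ (p , q) ≡ (a , b))

  constant-outside : (V : List (Fin m)) (v : Fin m) → (Fin m → Bool) → Fin m → Bool
  constant-outside V v g z with z ∈ᶠ? V
  ... | yes _ = g z
  ... | no _ = g v

  outside-∈ : (V : List (Fin m)) (v : Fin m) (g : Fin m → Bool) → ∀ {z} → z ∈ v ∷ V → constant-outside V v g z ≡ g z
  outside-∈ V v g {z} k with z ∈ᶠ? V
  ... | yes _ = refl
  outside-∈ V v g (here refl) | no _ = refl
  outside-∈ V v g (there k) | no x = ⊥-elim (x k)

  outside-∉ : (V : List (Fin m)) (v : Fin m) (g : Fin m → Bool) → ∀ {z} → z ∉ V → constant-outside V v g z ≡ g v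
  outside-∉ V v g {z} k with z ∈ᶠ? V
  ... | yes x = ⊥-elim (k x)
  ... | no _ = refl

  -- A cut of the subterm w hanging from v becomes a cut of t when it is made constant outside w.
  cut-extend : ∀ r v c l s w → Unique (r ∷ verts (nd v c l s)) → Unique (v ∷ verts w) →
    (∀ {z} → z ∈ verts w → z ∈ verts (nd v c l s)) →
    (∀ {e} → e ∈ edges v l ++ edges v s → e ∈ edges v w ⊎ (proj₁ e ∉ verts w × proj₂ e ∉ verts w)) →
    ∀ {a b} → (a , b) ∈ edges v w → TermCut v w a b → TermCut r (nd v c l s) a b
  cut-extend r v c l s w u uw sub away {a} {b} k (g , gn , gc) = g′ ,
      (λ e → gn (trans (sym (at (proj₁ ends))) (trans e (at (there (proj₂ ends)))))) , go
    where
    ends = edges-ends v w k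
    g′ : Fin m → Bool
    g′ = constant-outside (verts w) v g
    at : ∀ {z} → z ∈ v ∷ verts w → g′ z ≡ g z
    at = outside-∈ (verts w) v g
    off : ∀ {z} → z ∉ verts w → g′ z ≡ g v
    off = outside-∉ (verts w) v g
    go : ∀ {p q} → (p , q) ∈ edges r (nd v c l s) → g′ p ≡ g′ q ⊎ (p , q) ≡ (a , b)
    go (here refl) = inj₁ (trans (off (head∉ u ∘ sub)) (sym (off (head∉ uw))))
    go (there h) with away h
    ... | inj₂ (x , y) = inj₁ (trans (off x) (sym (off y)))
    ... | inj₁ z with gc z | edges-ends v w z
    ... | inj₂ e | _ = inj₂ e
    ... | inj₁ e | x , y = inj₁ (trans (at x) (trans e (sym (at (there y)))))

  term-cut : ∀ r t → Unique (r ∷ verts t) → ∀ {a b} → (a , b) ∈ edges r t → TermCut r t a b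
  term-cut r t u (here refl) = g , (λ e → bool (trans (sym (out (head∉ u))) (trans e (ins (top∈ t))))) , go
    where
    g : Fin m → Bool
    g z = ⌊ z ∈ᶠ? verts t ⌋
    ins : ∀ {z} → z ∈ verts t → g z ≡ true
    ins {z} h with z ∈ᶠ? verts t
    ... | yes _ = refl
    ... | no k = ⊥-elim (k h)
    out : ∀ {z} → z ∉ verts t → g z ≡ false
    out {z} h with z ∈ᶠ? verts t
    ... | yes k = ⊥-elim (h k)
    ... | no _ = refl
    bool : false ≢ true
    bool ()
    go : ∀ {p q} → (p , q) ∈ edges r t → g p ≡ g q ⊎ (p , q) ≡ (r , top t)
    go (here e) = inj₂ e
    go (there h) = let x , y = inner-ends t h in inj₁ (trans (ins x) (sym (ins y)))
  term-cut r (nd v c l s) u {a} {b} (there h) with ∈-++⁻ (edges v l) h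
  ... | inj₁ k = cut-extend r v c l s l u (proj₁ N) (inl {v} {c} {l} {s}) away-l k (term-cut v l (proj₁ N) k)
    where
    N = node-unique {v} {c} l {s} (tail-unique u)
    away-l : ∀ {e} → e ∈ edges v l ++ edges v s → e ∈ edges v l ⊎ (proj₁ e ∉ verts l × proj₂ e ∉ verts l)
    away-l k′ with ∈-++⁻ (edges v l) k′
    ... | inj₁ z = inj₁ z
    ... | inj₂ z with edges-ends v s z
    ... | here refl , y = inj₂ (head∉ (proj₁ N) , λ w → proj₂ (proj₂ N) w y)
    ... | there x , y = inj₂ ((λ w → proj₂ (proj₂ N) w x) , λ w → proj₂ (proj₂ N) w y)
  ... | inj₂ k = cut-extend r v c l s s u (proj₁ (proj₂ N)) (inr {v} {c} l {s}) away-s k (term-cut v s (proj₁ (proj₂ N)) k)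
    where
    N = node-unique {v} {c} l {s} (tail-unique u)
    away-s : ∀ {e} → e ∈ edges v l ++ edges v s → e ∈ edges v s ⊎ (proj₁ e ∉ verts s × proj₂ e ∉ verts s)
    away-s k′ with ∈-++⁻ (edges v l) k′
    ... | inj₂ z = inj₁ z
    ... | inj₁ z with edges-ends v l z
    ... | here refl , y = inj₂ (head∉ (proj₁ (proj₂ N)) , proj₂ (proj₂ N) y)
    ... | there x , y = inj₂ (proj₂ (proj₂ N) x , proj₂ (proj₂ N) y)

-- Graphs represented by terms

InE-++⁻ : {p q : Fin m} (xs : List (Edge m)) {ys : List (Edge m)} → InE p q (xs ++ ys) → InE p q xs ⊎ InE p q ys
InE-++⁻ xs (inj₁ h) = [ inj₁ ∘ inj₁ , inj₂ ∘ inj₁ ]′ (∈-++⁻ xs h)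
InE-++⁻ xs (inj₂ h) = [ inj₁ ∘ inj₂ , inj₂ ∘ inj₂ ]′ (∈-++⁻ xs h)

InE-⊆ : {p q : Fin m} {xs ys : List (Edge m)} → (∀ {e} → e ∈ xs → e ∈ ys) → InE p q xs → InE p q ys
InE-⊆ f (inj₁ h) = inj₁ (f h)
InE-⊆ f (inj₂ h) = inj₂ (f h)

InE-flip : {p q : Fin m} {xs : List (Edge m)} → InE p q xs → InE q p xs
InE-flip (inj₁ h) = inj₂ h
InE-flip (inj₂ h) = inj₁ h

graphOf : List (Edge m) → Adj m
graphOf [] _ _ = false
graphOf ((u , v) ∷ L) = add u v (graphOf L)

graphOf⁻ : (L : List (Edge m)) {p q : Fin m} → T (graphOf L p q) → InE p q L
graphOf⁻ ((u , v) ∷ L) {p} {q} h with add⁻ u v (graphOf L) p q h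
... | inj₁ k = InE-⊆ there (graphOf⁻ L k)
... | inj₂ k = ∈-InE (here refl) k

graphOf⁺ : (L : List (Edge m)) {p q : Fin m} → (p , q) ∈ L → T (graphOf L p q)
graphOf⁺ ((u , v) ∷ L) {p} {q} (here refl) = add-new u v (graphOf L) p q (inj₁ (refl , refl))
graphOf⁺ ((u , v) ∷ L) {p} {q} (there h) = add-old u v (graphOf L) p q (graphOf⁺ L h)

graphOf-Sym : (L : List (Edge m)) → Sym (graphOf L)
graphOf-Sym ((u , v) ∷ L) = add-Sym {E = graphOf L} (graphOf-Sym L)

proper-labels : (n : ℕ) → List (Fin (suc n))
proper-labels n = map F.suc (allFin n)

proper-unique : ∀ n → Unique (proper-labels n)
proper-unique n = Uniq.map⁺ Fin-suc-injective (Uniq.allFin⁺ n)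

proper-∈ : ∀ {n} {i : Fin (suc n)} → i ≢ F.zero → i ∈ proper-labels n
proper-∈ {i = F.zero} k = ⊥-elim (k refl)
proper-∈ {i = F.suc i} k = ∈-map⁺ F.suc (∈-allFin i)

proper-length : ∀ n → length (proper-labels n) ≡ n
proper-length n = trans (length-map F.suc (allFin n)) (length-tabulate id)

record Rep (E : Adj m) (ℓ : Fin (suc n) → Fin m) (t : Tr n m) : Set where
  open Named ℓ
  field
    edge⁻ : ∀ {p q} → T (E p q) → InE p q (edges (ℓ F.zero) t)
    edge⁺ : ∀ {p q} → (p , q) ∈ edges (ℓ F.zero) t → T (E p q)
    rsym  : Sym E
    uniq  : Unique (ℓ F.zero ∷ verts t)
    compl : ∀ v → v ∈ ℓ F.zero ∷ verts t
    labs  : labels t ↭ proper-labels n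

module RepProps {E : Adj m} {ℓ : Fin (suc n) → Fin m} {t : Tr n m} (R : Rep E ℓ t) where
  open Named ℓ
  open Rep R

  from-root : ∀ z → PathIn E (λ _ → ⊤) (ℓ F.zero) z
  from-root z with compl z
  ... | here refl = nil tt
  ... | there h = cons tt (edge⁺ (here refl)) (path-map (λ _ → tt) (down E t (edge⁺ ∘ there) h))

  rep-connected : ∀ p q → Conn E p q
  rep-connected p q = path-conn (path-++ (path-rev rsym (from-root p)) (from-root q))

  same-InE : ∀ {p q a b} → InE p q (edges (ℓ F.zero) t) → (g : Fin m → A) →
    (∀ {p q} → (p , q) ∈ edges (ℓ F.zero) t → g p ≡ g q ⊎ (p , q) ≡ (a , b)) → g p ≡ g q ⊎ SameEdge a b p q
  same-InE (inj₁ h) g c with c h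
  ... | inj₁ e = inj₁ e
  ... | inj₂ refl = inj₂ (inj₁ (refl , refl))
  same-InE (inj₂ h) g c with c h
  ... | inj₁ e = inj₁ (sym e)
  ... | inj₂ refl = inj₂ (inj₂ (refl , refl))

  rep-Cut : Cut E
  rep-Cut x with edge⁻ x
  ... | inj₁ h = let g , k , c = term-cut (ℓ F.zero) t uniq h in g , k , λ y → same-InE (edge⁻ y) g c
  ... | inj₂ h = let g , k , c = term-cut (ℓ F.zero) t uniq h in
    CutAt-same (inj₂ (refl , refl)) (g , k , λ y → same-InE (edge⁻ y) g c)

  labs-∈ : ∀ {i} → i ≢ F.zero → i ∈ labels t
  labs-∈ k = ∈-resp-↭ (↭-sym labs) (proper-∈ k)

  labs-unique : Unique (labels t)
  labs-unique = Unique-resp-↭ (↭-sym labs) (proper-unique n)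

  labs-length : length (labels t) ≡ n
  labs-length = trans (↭-length labs) (proper-length n)

cut-minimal : {E : Adj m} → Cut E → ∀ p q → T (E p q) → ¬ Conn (rem p q E) p q
cut-minimal {E = E} cut p q x (_ , w) with cut x
... | g , k , c = k (walk-const {f = g} (λ {p′} {q′} y → let y₁ , y₂ = rem⁻ p q E p′ q′ y in
  [ id , (λ s → ⊥-elim (y₂ s)) ]′ (c y₁)) w)

module MkTree {n m} (ℓ : Fin (suc n) → Fin m) where
  open Named ℓ

  NbrIs : Fin m → Tr n m → Fin m → List (Fin m) → Set
  NbrIs r t w ns = Unique ns × (∀ {q} → InE w q (edges r t) → q ∈ ns) × (∀ {q} → q ∈ ns → InE w q (edges r t))

  InE-ends : ∀ r t {w q} → InE w q (edges r t) → w ∈ r ∷ verts t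
  InE-ends r t (inj₁ h) = proj₁ (edges-ends r t h)
  InE-ends r t (inj₂ h) = there (proj₂ (edges-ends r t h))

  lift-left : ∀ r v c l s {w ns} → Unique (r ∷ verts (nd v c l s)) → w ∈ verts l → NbrIs v l w ns → NbrIs r (nd v c l s) w ns
  lift-left r v c l s {w} u h (un , f , g) = un , to , λ k → InE-⊆ (λ e → there (∈-++⁺ˡ e)) (g k)
    where
    N = node-unique {v} {c} l {s} (tail-unique u)
    to′ : ∀ {q} → InE w q (edges v l) ⊎ InE w q (edges v s) → q ∈ _
    to′ (inj₁ x) = f x
    to′ (inj₂ x) with InE-ends v s x
    ... | here refl = ⊥-elim (head∉ (proj₁ N) h)
    ... | there y = ⊥-elim (proj₂ (proj₂ N) h y)
    to : ∀ {q} → InE w q (edges r (nd v c l s)) → q ∈ _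
    to (inj₁ (here refl)) = ⊥-elim (head∉ u (inl {v} {c} {l} {s} h))
    to (inj₂ (here refl)) = ⊥-elim (head∉ (proj₁ N) h)
    to (inj₁ (there k)) = to′ (InE-++⁻ (edges v l) (inj₁ k))
    to (inj₂ (there k)) = to′ (InE-++⁻ (edges v l) (inj₂ k))

  lift-right : ∀ r v c l s {w ns} → Unique (r ∷ verts (nd v c l s)) → w ∈ verts s → NbrIs v s w ns → NbrIs r (nd v c l s) w ns
  lift-right r v c l s {w} u h (un , f , g) = un , to , λ k → InE-⊆ (λ e → there (∈-++⁺ʳ (edges v l) e)) (g k)
    where
    N = node-unique {v} {c} l {s} (tail-unique u)
    to′ : ∀ {q} → InE w q (edges v l) ⊎ InE w q (edges v s) → q ∈ _
    to′ (inj₂ x) = f x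
    to′ (inj₁ x) with InE-ends v l x
    ... | here refl = ⊥-elim (head∉ (proj₁ (proj₂ N)) h)
    ... | there y = ⊥-elim (proj₂ (proj₂ N) y h)
    to : ∀ {q} → InE w q (edges r (nd v c l s)) → q ∈ _
    to (inj₁ (here refl)) = ⊥-elim (head∉ u (inr {v} {c} l {s} h))
    to (inj₂ (here refl)) = ⊥-elim (head∉ (proj₁ (proj₂ N)) h)
    to (inj₁ (there k)) = to′ (InE-++⁻ (edges v l) (inj₁ k))
    to (inj₂ (there k)) = to′ (InE-++⁻ (edges v l) (inj₂ k))

  root-nbr : ∀ r t → Unique (r ∷ verts t) → NbrIs r t r (top t ∷ [])
  root-nbr r t u = ([] ∷ []) , to , λ { (here refl) → inj₁ (here refl) }
    where
    to : ∀ {q} → InE r q (edges r t) → q ∈ top t ∷ []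
    to (inj₁ (here refl)) = here refl
    to (inj₂ (here e)) = ⊥-elim (head∉ u (subst (_∈ verts t) (sym (cong proj₂ e)) (top∈ t)))
    to (inj₁ (there k)) = ⊥-elim (head∉ u (proj₁ (inner-ends t k)))
    to (inj₂ (there k)) = ⊥-elim (head∉ u (proj₂ (inner-ends t k)))

  leaf-nbr : ∀ r t → Unique (r ∷ verts t) → ∀ {i} → i ∈ labels t → ∃[ p ] (NbrIs r t (ℓ i) (p ∷ []) × ℓ i ∈ verts t)
  leaf-nbr r (lf i) u (here refl) = r , (([] ∷ []) , to , λ { (here refl) → inj₂ (here refl) }) , here refl
    where
    to : ∀ {q} → InE (ℓ i) q (edges r (lf i)) → q ∈ r ∷ []
    to (inj₁ (here e)) = ⊥-elim (head∉ u (here (sym (cong proj₁ e))))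
    to (inj₂ (here refl)) = here refl
  leaf-nbr r (nd v c l s) u h with ∈-++⁻ (labels l) h
  ... | inj₁ k = let p , nb , x = leaf-nbr v l (proj₁ (node-unique {v} {c} l {s} (tail-unique u))) k in
    p , lift-left r v c l s u x nb , inl {v} {c} {l} {s} x
  ... | inj₂ k = let p , nb , x = leaf-nbr v s (proj₁ (proj₂ (node-unique {v} {c} l {s} (tail-unique u)))) k in
    p , lift-right r v c l s u x nb , inr {v} {c} l {s} x

  node-nbr : ∀ r t → Unique (r ∷ verts t) → ∀ {w} → w ∈ verts t → (∀ i → ℓ i ≢ w) →
    ∃[ a ] ∃[ b ] ∃[ c ] NbrIs r t w (a ∷ b ∷ c ∷ [])
  node-nbr r (lf i) u (here refl) k = ⊥-elim (k i refl)
  node-nbr r (nd v c l s) u (here refl) k = r , top l , top s , un , to , from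
    where
    N = node-unique {v} {c} l {s} (tail-unique u)
    un : Unique (r ∷ top l ∷ top s ∷ [])
    un = ((λ { refl → head∉ u (inl {v} {c} {l} {s} (top∈ l)) }) ∷ (λ { refl → head∉ u (inr {v} {c} l {s} (top∈ s)) }) ∷ [])
       ∷ ((λ e → proj₂ (proj₂ N) (top∈ l) (subst (_∈ verts s) (sym e) (top∈ s))) ∷ []) ∷ [] ∷ []
    nl = root-nbr v l (proj₁ N)
    ns = root-nbr v s (proj₁ (proj₂ N))
    from : ∀ {q} → q ∈ r ∷ top l ∷ top s ∷ [] → InE v q (edges r (nd v c l s))
    from (here refl) = inj₂ (here refl)
    from (there (here refl)) = inj₁ (there (here refl))
    from (there (there (here refl))) = inj₁ (there (∈-++⁺ʳ (edges v l) (here refl)))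
    to′ : ∀ {q} → InE v q (edges v l) ⊎ InE v q (edges v s) → q ∈ r ∷ top l ∷ top s ∷ []
    to′ (inj₁ x) with proj₁ (proj₂ nl) x
    ... | here e = there (here e)
    to′ (inj₂ x) with proj₁ (proj₂ ns) x
    ... | here e = there (there (here e))
    to : ∀ {q} → InE v q (edges r (nd v c l s)) → q ∈ r ∷ top l ∷ top s ∷ []
    to (inj₁ (here refl)) = ⊥-elim (head∉ u (here refl))
    to (inj₂ (here refl)) = here refl
    to (inj₁ (there h)) = to′ (InE-++⁻ (edges v l) (inj₁ h))
    to (inj₂ (there h)) = to′ (InE-++⁻ (edges v l) (inj₂ h))
  node-nbr r (nd v c l s) u (there h) k with ∈-++⁻ (verts l) h
  ... | inj₁ x = let a , b , d , nb = node-nbr v l (proj₁ (node-unique {v} {c} l {s} (tail-unique u))) x k in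
    a , b , d , lift-left r v c l s u x nb
  ... | inj₂ x = let a , b , d , nb = node-nbr v s (proj₁ (proj₂ (node-unique {v} {c} l {s} (tail-unique u)))) x k in
    a , b , d , lift-right r v c l s u x nb

  module _ {E : Adj m} {t : Tr n m} (R : Rep E ℓ t) where
    open Rep R
    open RepProps R

    rep-degree : ∀ {w ns} → NbrIs (ℓ F.zero) t w ns → deg E w ≡ length ns
    rep-degree {w} {ns} (un , f , g) = deg-of-list E w ns un (f ∘ edge⁻) (InE-T ∘ g)
      where
      InE-T : ∀ {p q} → InE p q (edges (ℓ F.zero) t) → T (E p q)
      InE-T (inj₁ h) = edge⁺ h
      InE-T (inj₂ h) = rsym (edge⁺ h)

    rep-Irr : Irr E
    rep-Irr h with rep-Cut h
    ... | g , k , _ = k refl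

    rep-leaf-degree : ∀ i → deg E (ℓ i) ≡ 1
    rep-leaf-degree F.zero = rep-degree (root-nbr (ℓ F.zero) t uniq)
    rep-leaf-degree (F.suc i) = rep-degree (proj₁ (proj₂ (leaf-nbr (ℓ F.zero) t uniq (labs-∈ {F.suc i} (λ ())))))

    rep-inner-degree : ∀ v → (∀ i → ℓ i ≢ v) → deg E v ≡ 3
    rep-inner-degree v k with compl v
    ... | here refl = ⊥-elim (k F.zero refl)
    ... | there h = rep-degree (proj₂ (proj₂ (proj₂ (node-nbr (ℓ F.zero) t uniq h k))))

    rep-degree-1-3 : ∀ v → deg E v ≡ 1 ⊎ deg E v ≡ 3
    rep-degree-1-3 v with any? (λ i → ℓ i ≟ v)
    ... | yes (i , refl) = inj₁ (rep-leaf-degree i)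
    ... | no k = inj₂ (rep-inner-degree v (λ i e → k (i , e)))

  module _ (inj : ∀ i j → ℓ i ≡ ℓ j → i ≡ j) (t : Tr n m) (uniq : Unique (ℓ F.zero ∷ verts t))
    (compl : ∀ v → v ∈ ℓ F.zero ∷ verts t) (labs : labels t ↭ proper-labels n) where

    private
      r = ℓ F.zero
      L = edges r t
      E = graphOf L

    tree-rep : Rep E ℓ t
    tree-rep = record { edge⁻ = graphOf⁻ L ; edge⁺ = graphOf⁺ L ; rsym = graphOf-Sym L ; uniq = uniq ; compl = compl ; labs = labs }

    private
      open RepProps tree-rep
      f≡ : {b : Bool} → ¬ T b → b ≡ false
      f≡ {true} k = ⊥-elim (k tt)
      f≡ {false} k = refl

    mkTree : BTree n m
    mkTree = record
      { adj = E ; adj-sym = λ p q → T⇒≡ (graphOf-Sym L) (graphOf-Sym L) ; adj-irr = λ p → f≡ (rep-Irr tree-rep)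
      ; connected = rep-connected ; minimal = cut-minimal rep-Cut
      ; leaf = ℓ ; leaf-inj = inj ; leaf-deg = rep-leaf-degree tree-rep ; inner-deg = rep-inner-degree tree-rep }

-- Rooting a tree at the leaf 0

unique-set-↭ : {xs ys : List A} → Unique xs → Unique ys →
  (∀ {z} → z ∈ xs → z ∈ ys) → (∀ {z} → z ∈ ys → z ∈ xs) → xs ↭ ys
unique-set-↭ {xs = []} {[]} ux uy f g = ↭-refl
unique-set-↭ {xs = []} {y ∷ ys} ux uy f g with g (here refl)
... | ()
unique-set-↭ {xs = x ∷ xs} {ys} ux uy f g with ∈⇒↭ (f (here refl))
... | zs , p = ↭-trans (↭-prep x (unique-set-↭ (tail-unique ux) (tail-unique uz) to from)) (↭-sym p)
  where
  uz : Unique (x ∷ zs)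
  uz = Unique-resp-↭ p uy
  to : ∀ {z} → z ∈ xs → z ∈ zs
  to h with ∈-resp-↭ p (f (there h))
  ... | here refl = ⊥-elim (head∉ ux h)
  ... | there k = k
  from : ∀ {z} → z ∈ zs → z ∈ xs
  from h with g (∈-resp-↭ (↭-sym p) (there h))
  ... | here refl = ⊥-elim (head∉ uz h)
  ... | there k = k

module _ (ℓ : Fin (suc n) → Fin m) where
  open Named ℓ

  label-vert : ∀ t {i} → i ∈ labels t → ℓ i ∈ verts t
  label-vert (lf i) (here refl) = here refl
  label-vert (nd v c l s) h with ∈-++⁻ (labels l) h
  ... | inj₁ k = inl {v} {c} {l} {s} (label-vert l k)
  ... | inj₂ k = inr {v} {c} l {s} (label-vert s k)

  labels-unique : ∀ t → Unique (verts t) → Unique (labels t)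
  labels-unique (lf i) u = [] ∷ []
  labels-unique (nd v c l s) u = let ul , us , d = node-unique {v} {c} l {s} u in
    ++-unique (labels-unique l (tail-unique ul)) (labels-unique s (tail-unique us))
      (λ h k → d (label-vert l h) (label-vert s k))

module Traverse (A : BTree n m) where
  private
    E = adj A
    ℓ = leaf A
  open Named ℓ

  T-Sym : Sym E
  T-Sym {p} {q} = subst T (adj-sym A p q)

  T-Irr : Irr E
  T-Irr {p} = subst T (adj-irr A p)

  leaf-nbr-≡ : ∀ {i p q} → T (E (ℓ i) p) → T (E (ℓ i) q) → q ≡ p
  leaf-nbr-≡ {i} {p} {q} hp hq with q ≟ p
  ... | yes e = e
  ... | no k with ≤-trans (deg-lower E (ℓ i) (q ∷ p ∷ []) ((k ∷ []) ∷ [] ∷ [])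
          (λ { (here refl) → hq ; (there (here refl)) → hp })) (≤-reflexive (leaf-deg A i))
  ... | s≤s ()

  inner-nbrs : ∀ {v p} → (∀ i → ℓ i ≢ v) → T (E v p) → ∃[ a ] ∃[ b ]
    (Unique (p ∷ a ∷ b ∷ []) × T (E v a) × T (E v b) × (∀ {q} → T (E v q) → q ∈ p ∷ a ∷ b ∷ []))
  inner-nbrs {v} {p} k hp with ∈⇒↭ (nbrs⁺ E hp)
  ... | ys , π = go ys π (ℕₚ.suc-injective (trans (sym (↭-length π)) (trans (sym (deg-nbrs E v)) (inner-deg A v k))))
    where
    go : ∀ ys → nbrs E v ↭ p ∷ ys → length ys ≡ 2 → ∃[ a ] ∃[ b ]
      (Unique (p ∷ a ∷ b ∷ []) × T (E v a) × T (E v b) × (∀ {q} → T (E v q) → q ∈ p ∷ a ∷ b ∷ []))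
    go (a ∷ b ∷ []) π refl = a , b , Unique-resp-↭ π (nbrs-unique E v) ,
      nbrs⁻ E (∈-resp-↭ (↭-sym π) (there (here refl))) ,
      nbrs⁻ E (∈-resp-↭ (↭-sym π) (there (there (here refl)))) ,
      λ h → ∈-resp-↭ π (nbrs⁺ E h)

  avoid : ∀ {v w p q} → p ≢ v → q ≢ v → T (E p q) → T (rem v w E p q)
  avoid {v} {w} {p} {q} a b h = rem⁺ v w E p q h (λ { (inj₁ (e , _)) → a (sym e) ; (inj₂ (e , _)) → b (sym e) })

  avoid-path : ∀ {v w a b} {P : Fin m → Set} → (∀ {z} → P z → z ≢ v) → PathIn E P a b → PathIn (rem v w E) (λ _ → ⊤) a b
  avoid-path f p = path-map (λ _ → tt) (path-graph (λ x y → avoid (f x) (f y)) p)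

  no-cycle : ∀ {v a b} → T (E v a) → T (E v b) → a ≢ b → PathIn (rem v b E) (λ _ → ⊤) a b → ⊥
  no-cycle {v} {a} {b} ha hb k p = minimal A v b hb (path-conn (cons tt (rem⁺ v b E v a ha distinct) p))
    where
    distinct : ¬ SameEdge v b v a
    distinct (inj₁ (_ , e)) = k (sym e)
    distinct (inj₂ (refl , _)) = T-Irr ha

  record Sub (p v : Fin m) (vs : List (Fin m)) : Set where
    field
      tm : Tr n m
      tm-top : top tm ≡ v
      tm-edges : ∀ {a b} → (a , b) ∈ inner tm → T (E a b)
      tm-closed : ∀ {w q} → w ∈ verts tm → T (E w q) → InE w q (edges p tm)
      tm-unique : Unique (verts tm)
      tm-fresh : ∀ {z} → z ∈ verts tm → z ∉ vs
      tm-labels : ∀ i → ℓ i ∈ verts tm → i ∈ labels tm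

  build : ∀ fuel p v vs → T (E p v) → v ∉ p ∷ vs → Unique (p ∷ vs) → m ≤ fuel + length (p ∷ vs) →
    (∀ {z} → z ∈ p ∷ vs → PathIn E (_∈ p ∷ vs) p z) → Sub p v (p ∷ vs)
  build zero p v vs pv fr un le pa = ⊥-elim (<-irrefl refl (≤-trans (unique-Fin-length (∷-unique fr un)) le))
  build (suc fuel) p v vs pv fr un le pa with any? (λ i → ℓ i ≟ v)
  ... | yes (i , refl) = record
    { tm = lf i ; tm-top = refl ; tm-edges = λ ()
    ; tm-closed = λ { (here refl) h → inj₂ (here (cong (_, ℓ i) (leaf-nbr-≡ (T-Sym pv) h))) }
    ; tm-unique = [] ∷ [] ; tm-fresh = λ { (here refl) → fr }
    ; tm-labels = λ { j (here e) → here (leaf-inj A j i e) } }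
  ... | no k with inner-nbrs (λ i e → k (i , e)) (T-Sym pv)
  ... | a , b , ((p≢a ∷ p≢b ∷ []) ∷ (a≢b ∷ []) ∷ _) , va , vb , all = result
    where
    ws = v ∷ p ∷ vs
    un′ : Unique ws
    un′ = ∷-unique fr un
    pa′ : ∀ {z} → z ∈ ws → PathIn E (_∈ ws) v z
    pa′ (here refl) = nil (here refl)
    pa′ (there h) = cons (here refl) (T-Sym pv) (path-map there (pa h))
    fresh : ∀ {w} → T (E v w) → p ≢ w → w ∉ ws
    fresh h pw (here refl) = T-Irr h
    fresh h pw (there x) = no-cycle (T-Sym pv) h pw (avoid-path (λ y → λ { refl → fr y }) (pa x))
    le′ : m ≤ fuel + length ws
    le′ = subst (m ≤_) (sym (+-suc fuel (length (p ∷ vs)))) le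
    module L = Sub (build fuel v a (p ∷ vs) va (fresh va p≢a) un′ le′ pa′)
    module R = Sub (build fuel v b (p ∷ vs) vb (fresh vb p≢b) un′ le′ pa′)
    t = nd v 0 L.tm R.tm
    ≢v : ∀ {z} → z ∉ ws → z ≢ v
    ≢v h refl = h (here refl)
    disjoint : ∀ {z} → z ∈ verts L.tm → z ∉ verts R.tm
    disjoint {z} x y = no-cycle va vb a≢b (path-++
      (avoid-path (≢v ∘ L.tm-fresh) (subst (λ w → PathIn E (_∈ verts L.tm) w z) L.tm-top (down E L.tm L.tm-edges x)))
      (avoid-path (≢v ∘ R.tm-fresh) (path-rev T-Sym (subst (λ w → PathIn E (_∈ verts R.tm) w z) R.tm-top (down E R.tm R.tm-edges y)))))
    es : ∀ {x y} → (x , y) ∈ inner t → T (E x y)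
    es h with ∈-++⁻ (edges v L.tm) h
    ... | inj₁ (here refl) = subst (λ w → T (E v w)) (sym L.tm-top) va
    ... | inj₁ (there x) = L.tm-edges x
    ... | inj₂ (here refl) = subst (λ w → T (E v w)) (sym R.tm-top) vb
    ... | inj₂ (there x) = R.tm-edges x
    closed : ∀ {w q} → w ∈ verts t → T (E w q) → InE w q (edges p t)
    closed (here refl) h with all h
    ... | here refl = inj₂ (here refl)
    ... | there (here refl) = inj₁ (there (here (cong (v ,_) (sym L.tm-top))))
    ... | there (there (here refl)) = inj₁ (there (∈-++⁺ʳ (edges v L.tm) (here (cong (v ,_) (sym R.tm-top)))))
    closed (there x) h with ∈-++⁻ (verts L.tm) x
    ... | inj₁ y = InE-⊆ (λ e → there (∈-++⁺ˡ e)) (L.tm-closed y h)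
    ... | inj₂ y = InE-⊆ (λ e → there (∈-++⁺ʳ (edges v L.tm) e)) (R.tm-closed y h)
    fresh′ : ∀ {z} → z ∈ verts t → z ∉ p ∷ vs
    fresh′ (here refl) = fr
    fresh′ (there x) with ∈-++⁻ (verts L.tm) x
    ... | inj₁ y = L.tm-fresh y ∘ there
    ... | inj₂ y = R.tm-fresh y ∘ there
    labs : ∀ i → ℓ i ∈ verts t → i ∈ labels t
    labs i (here e) = ⊥-elim (k (i , e))
    labs i (there x) with ∈-++⁻ (verts L.tm) x
    ... | inj₁ y = ∈-++⁺ˡ (L.tm-labels i y)
    ... | inj₂ y = ∈-++⁺ʳ (labels L.tm) (R.tm-labels i y)
    notin : v ∉ verts L.tm ++ verts R.tm
    notin x with ∈-++⁻ (verts L.tm) x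
    ... | inj₁ y = L.tm-fresh y (here refl)
    ... | inj₂ y = R.tm-fresh y (here refl)
    result : Sub p v (p ∷ vs)
    result = record { tm = t ; tm-top = refl ; tm-edges = es ; tm-closed = closed
      ; tm-unique = ∷-unique notin (++-unique L.tm-unique R.tm-unique disjoint)
      ; tm-fresh = fresh′ ; tm-labels = labs }

  root-child : ∃[ w ] T (E (ℓ F.zero) w)
  root-child = go (nbrs E (ℓ F.zero)) refl (trans (sym (deg-nbrs E (ℓ F.zero))) (leaf-deg A F.zero))
    where
    go : ∀ ys → nbrs E (ℓ F.zero) ≡ ys → length ys ≡ 1 → ∃[ w ] T (E (ℓ F.zero) w)
    go (w ∷ ys) e _ = w , nbrs⁻ E (subst (w ∈_) (sym e) (here refl))

  represent : ∃[ t ] Rep E ℓ t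
  represent = tm , record
      { edge⁻ = edge⁻ ; edge⁺ = edge⁺ ; rsym = T-Sym ; uniq = uniq ; compl = λ v → closure (here refl) (proj₂ (connected A r v))
      ; labs = unique-set-↭ (labels-unique ℓ tm tm-unique) (proper-unique n)
          (λ h → proper-∈ (λ { refl → head∉ uniq (label-vert ℓ tm h) })) from }
    where
    r = ℓ F.zero
    w = proj₁ root-child
    rw = proj₂ root-child
    start : Sub r w (r ∷ [])
    start = build m r w [] rw (λ { (here e) → T-Irr (subst (λ z → T (E r z)) e rw) }) ([] ∷ [])
      (m≤m+n m 1) (λ { (here refl) → nil (here refl) })
    open Sub start
    uniq : Unique (r ∷ verts tm)
    uniq = ∷-unique (λ h → tm-fresh h (here refl)) tm-unique
    nbr-in : ∀ {p q} → p ∈ r ∷ verts tm → T (E p q) → InE p q (edges r tm)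
    nbr-in (here refl) h = inj₁ (here (cong (r ,_) (trans (leaf-nbr-≡ rw h) (sym tm-top))))
    nbr-in (there x) h = tm-closed x h
    InE-end : ∀ {p q} → InE p q (edges r tm) → q ∈ r ∷ verts tm
    InE-end (inj₁ h) = there (proj₂ (edges-ends r tm h))
    InE-end (inj₂ h) = proj₁ (edges-ends r tm h)
    closure : ∀ {p q ps} → p ∈ r ∷ verts tm → Walk E p q ps → q ∈ r ∷ verts tm
    closure h stop = h
    closure h (step e x) = closure (InE-end (nbr-in h e)) x
    edge⁻ : ∀ {p q} → T (E p q) → InE p q (edges r tm)
    edge⁻ {p} h = nbr-in (closure (here refl) (proj₂ (connected A r p))) h
    edge⁺ : ∀ {p q} → (p , q) ∈ edges r tm → T (E p q)
    edge⁺ (here refl) = subst (λ z → T (E r z)) (sym tm-top) rw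
    edge⁺ (there h) = tm-edges h
    from : ∀ {z} → z ∈ proper-labels n → z ∈ labels tm
    from {z} h with closure (here refl) (proj₂ (connected A r (ℓ z)))
    ... | there x = tm-labels z x
    ... | here e with ∈-map⁻ F.suc h
    ... | y , _ , refl with leaf-inj A (F.suc y) F.zero e
    ... | ()

-- Cutting a term into pieces

size : Tr n m → ℕ
size t = length (labels t)

Ins-size : {Y t₀ t : Tr n m} {x : Fin m} {c : ℕ} → Ins Y x c t₀ t → size t ≡ size Y + size t₀
Ins-size {Y = Y} {t₀} i = trans (↭-length (Ins-labels i)) (length-++ (labels Y))

data Dec-of (s : ℕ) {n m} : ℕ → Tr n m → Set where
  whole : ∀ {t} → size t ≤ 2 * s → Dec-of s 0 t
  split  : ∀ {k Y x c t₀ t} → Ins Y x c t₀ t → s ≤ size Y → size Y ≤ 2 * s → Dec-of s k t₀ → Dec-of s (suc k) t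

size-pos : (t : Tr n m) → 1 ≤ size t
size-pos (lf i) = ≤-refl
size-pos (nd v c l r) = ≤-trans (size-pos l) (≤-trans (m≤m+n _ _) (≤-reflexive (sym (length-++ (labels l)))))

split-piece : (s : ℕ) → 1 ≤ s → (t : Tr n m) → 2 * s < size t →
  ∃[ Y ] ∃[ x ] ∃[ c ] ∃[ t₀ ] (Ins Y x c t₀ t × s ≤ size Y × size Y ≤ 2 * s)
split-piece s 1≤s (lf i) (s≤s le) with ≤-trans (*-mono-≤ (≤-refl {2}) 1≤s) le
... | ()
split-piece s 1≤s (nd v c l r) lt with s ≤? size l
... | yes a with size l ≤? 2 * s
... | yes b = l , v , c , r , hereL , a , b
... | no b = let Y , x , d , t₀ , i , p , q = split-piece s 1≤s l (≰⇒> b) in Y , x , d , nd v c t₀ r , left i , p , q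
split-piece s 1≤s (nd v c l r) lt | no a with size r ≤? 2 * s
... | no b = let Y , x , d , t₀ , i , p , q = split-piece s 1≤s r (≰⇒> b) in Y , x , d , nd v c l t₀ , right i , p , q
... | yes b = r , v , c , l , hereR , s≤r , b
  where
  s≤r : s ≤ size r
  s≤r with s ≤? size r
  ... | yes p = p
  ... | no p = ⊥-elim (<-irrefl refl (≤-trans lt (≤-trans (≤-reflexive (length-++ (labels l)))
    (≤-trans (+-mono-≤ (<⇒≤ (≰⇒> a)) (<⇒≤ (≰⇒> p))) (≤-reflexive (cong (s +_) (sym (+-identityʳ s))))))))

decompose : (s : ℕ) → 1 ≤ s → (fuel : ℕ) → (t : Tr n m) → size t ≤ fuel → ∃[ k ] Dec-of s k t
decompose s 1≤s zero t le with ≤-trans (size-pos t) le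
... | ()
decompose s 1≤s (suc fuel) t le with size t ≤? 2 * s
... | yes p = 0 , whole p
... | no p with split-piece s 1≤s t (≰⇒> p)
... | Y , x , c , t₀ , i , a , b with decompose s 1≤s fuel t₀
      (≤-pred (≤-trans (+-mono-≤ (size-pos Y) ≤-refl) (≤-trans (≤-reflexive (sym (Ins-size i))) le)))
... | k , d = suc k , split i a b d

pieces-bound : {s k : ℕ} {t : Tr n m} → Dec-of s k t → k * s ≤ size t
pieces-bound (whole _) = z≤n
pieces-bound (split i a _ d) = ≤-trans (+-mono-≤ a (pieces-bound d)) (≤-reflexive (sym (Ins-size i)))

piece : {s k : ℕ} {t : Tr n m} → Dec-of s k t → Fin (suc n) → ℕ
piece (whole _) i = 0
piece (split {k} {Y} _ _ _ d) i with i ∈ᶠ? labels Y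
... | yes _ = suc k
... | no _ = piece d i

piece-≤ : {s k : ℕ} {t : Tr n m} (d : Dec-of s k t) (i : Fin (suc n)) → piece d i ≤ k
piece-≤ (whole _) i = z≤n
piece-≤ (split {k} {Y} _ _ _ d) i with i ∈ᶠ? labels Y
... | yes _ = ≤-refl
... | no _ = ≤-trans (piece-≤ d i) (n≤1+n _)

piece-in : {s k : ℕ} {Y t₀ t : Tr n m} {x : Fin m} {c : ℕ} (j : Ins Y x c t₀ t) (a : s ≤ size Y) (b : size Y ≤ 2 * s)
  (d : Dec-of s k t₀) {i : Fin (suc n)} → i ∈ labels Y → piece (split j a b d) i ≡ suc k
piece-in {Y = Y} j a b d {i} h with i ∈ᶠ? labels Y
... | yes _ = refl
... | no x = ⊥-elim (x h)

piece-out : {s k : ℕ} {Y t₀ t : Tr n m} {x : Fin m} {c : ℕ} (j : Ins Y x c t₀ t) (a : s ≤ size Y) (b : size Y ≤ 2 * s)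
  (d : Dec-of s k t₀) {i : Fin (suc n)} → i ∉ labels Y → piece (split j a b d) i ≡ piece d i
piece-out {Y = Y} j a b d {i} h with i ∈ᶠ? labels Y
... | yes x = ⊥-elim (h x)
... | no _ = refl

Ins-label-cases : {Y t₀ t : Tr n m} {x : Fin m} {c : ℕ} → Ins Y x c t₀ t → ∀ {i} → i ∈ labels t → i ∉ labels Y → i ∈ labels t₀
Ins-label-cases {Y = Y} j h k with ∈-++⁻ (labels Y) (∈-resp-↭ (Ins-labels j) h)
... | inj₁ x = ⊥-elim (k x)
... | inj₂ x = x

piece-list : {s k : ℕ} {t : Tr n m} (d : Dec-of s k t) (c : ℕ) →
  ∃[ cl ] (length cl ≤ 2 * s × (∀ {i} → i ∈ labels t → piece d i ≡ c → i ∈ cl))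
piece-list {t = t} (whole le) c = labels t , le , λ h _ → h
piece-list {t = t} (split {k} {Y} j a b d) c with c ℕ.≟ suc k
... | yes refl = labels Y , b , go
  where
  go : ∀ {i} → i ∈ labels t → piece (split j a b d) i ≡ suc k → i ∈ labels Y
  go {i} h e with i ∈ᶠ? labels Y
  ... | yes x = x
  ... | no x = ⊥-elim (<-irrefl refl (subst (_≤ k) e (piece-≤ d i)))
... | no c≢ with piece-list d c
... | cl , le , f = cl , le , go
  where
  go : ∀ {i} → i ∈ labels t → piece (split j a b d) i ≡ c → i ∈ cl
  go {i} h e with i ∈ᶠ? labels Y
  ... | yes x = ⊥-elim (c≢ (sym e))
  ... | no x = f (Ins-label-cases j h x) e

piece-size : {s k : ℕ} {t : Tr n m} (d : Dec-of s k t) (c : ℕ) (W : List (Fin (suc n))) → Unique W →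
  (∀ {i} → i ∈ W → i ∈ labels t) → length (filter (λ i → piece d i ℕ.≟ c) W) ≤ 2 * s
piece-size d c W u f with piece-list d c
... | cl , le , g = ≤-trans (unique-⊆-length (Uniq.filter⁺ (λ i → piece d i ℕ.≟ c) u)
  (λ h → let h₁ , h₂ = ∈-filter⁻ (λ i → piece d i ℕ.≟ c) {xs = W} h in g (f h₁) h₂)) le

module _ (ℓ : Fin (suc n) → Fin m) where
  open Named ℓ

  piece-colouring : ∀ r {s k t} (d : Dec-of s k t) → Unique (r ∷ verts t) → Σ (Fin m → ℕ) λ f → ∃[ L ]
    (length L ≤ k × (∀ {p q} → (p , q) ∈ edges r t → f p ≡ f q ⊎ InE p q L) × (∀ {i} → i ∈ labels t → f (ℓ i) ≡ piece d i))
  piece-colouring r (whole le) u = (λ _ → 0) , [] , z≤n , (λ _ → inj₁ refl) , λ _ → refl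
  piece-colouring r (split {k} {Y} {x} {c} {t₀} {t} j a′ b′ d) u with Ins-edges j r
  ... | a , b , R , e₀ , e with piece-colouring r d u₀
    where
    u₀ : Unique (r ∷ verts t₀)
    u₀ = proj₁ (proj₂ (unique-++ (x ∷ verts Y) (Unique-resp-↭ (↭-trans (↭-prep r (Ins-verts j)) (↭-sym (shift r (x ∷ verts Y) (verts t₀)))) u)))
  ... | f , L , le , cov , lab = g , (x , top Y) ∷ map (redirect a b (x , b)) L ,
      s≤s (≤-trans (≤-reflexive (length-map (redirect a b (x , b)) L)) le) , cov′ ∘ ∈-resp-↭ e , lab′
    where
    W : Unique (x ∷ verts Y ++ r ∷ verts t₀)
    W = Unique-resp-↭ (↭-trans (↭-prep r (Ins-verts j)) (↭-sym (shift r (x ∷ verts Y) (verts t₀)))) u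
    U = unique-++ (x ∷ verts Y) W
    u₀ = proj₁ (proj₂ U)
    g : Fin m → ℕ
    g z with z ∈ᶠ? verts Y
    ... | yes _ = suc k
    ... | no _ = upd f x (f a) z
    g-Y : ∀ {z} → z ∈ verts Y → g z ≡ suc k
    g-Y {z} h with z ∈ᶠ? verts Y
    ... | yes _ = refl
    ... | no y = ⊥-elim (y h)
    g-x : g x ≡ f a
    g-x with x ∈ᶠ? verts Y
    ... | yes y = ⊥-elim (head∉ (proj₁ U) y)
    ... | no _ = upd-self f x (f a)
    g-0 : ∀ {z} → z ∈ r ∷ verts t₀ → g z ≡ f z
    g-0 {z} h with z ∈ᶠ? verts Y
    ... | yes y = ⊥-elim (proj₂ (proj₂ U) (there y) h)
    ... | no _ = upd-other f (f a) (λ { refl → proj₂ (proj₂ U) (here refl) h })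
    old : ∀ {p q} → (p , q) ∈ (a , b) ∷ R → (p , q) ∈ edges r t₀
    old h = ∈-resp-↭ (↭-sym e₀) h
    distinct : ∀ {p q} → (p , q) ∈ R → ¬ SameEdge a b p q
    distinct h with DiffEdge-resp-↭ e₀ (edges-distinct r t₀ u₀)
    ... | p ∷ _ = All.lookup p h
    a∈ = proj₁ (edges-ends r t₀ (old (here refl)))
    b∈ = proj₂ (edges-ends r t₀ (old (here refl)))
    cov′ : ∀ {p q} → (p , q) ∈ stalk Y x a b ++ R → g p ≡ g q ⊎ InE p q ((x , top Y) ∷ map (redirect a b (x , b)) L)
    cov′ (here refl) = inj₁ (trans (g-0 a∈) (sym g-x))
    cov′ (there (here refl)) with cov (old (here refl))
    ... | inj₁ y = inj₁ (trans g-x (trans y (sym (g-0 (there b∈)))))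
    ... | inj₂ y = inj₂ (inj₁ (there (redirect-hit-∈ a b (x , b) y)))
    cov′ (there (there (here refl))) = inj₂ (inj₁ (here refl))
    cov′ (there (there (there h))) with ∈-++⁻ (inner Y) h
    ... | inj₁ y = let y₁ , y₂ = inner-ends Y y in inj₁ (trans (g-Y y₁) (sym (g-Y y₂)))
    ... | inj₂ y with cov (old (there y)) | edges-ends r t₀ (old (there y))
    ... | inj₁ z | z₁ , z₂ = inj₁ (trans (g-0 z₁) (trans z (sym (g-0 (there z₂)))))
    ... | inj₂ z | _ = inj₂ (InE-⊆ there (redirect-keep-∈ a b (x , b) (distinct y) z))
    lab′ : ∀ {i} → i ∈ labels t → g (ℓ i) ≡ piece (split j a′ b′ d) i
    lab′ {i} h with i ∈ᶠ? labels Y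
    ... | yes y = g-Y (label-vert ℓ Y y)
    ... | no y = let z = Ins-label-cases j h y in trans (g-0 (there (label-vert ℓ t₀ z))) (lab z)

count : (A → ℕ) → ℕ → List A → ℕ
count P c W = length (filter (λ i → P i ℕ.≟ c) W)

count-hit : (P : A → ℕ) (c : ℕ) (i : A) (W : List A) → P i ≡ c → count P c (i ∷ W) ≡ suc (count P c W)
count-hit P c i W e = cong length (filter-accept (λ i → P i ℕ.≟ c) {xs = W} e)

count-≤ : (P : A → ℕ) (c : ℕ) (i : A) (W : List A) → count P c W ≤ count P c (i ∷ W)
count-≤ P c i W = go (P i ℕ.≟ c)
  where
  go : Dec (P i ≡ c) → count P c W ≤ count P c (i ∷ W)
  go (yes e) = ≤-trans (n≤1+n _) (≤-reflexive (sym (count-hit P c i W e)))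
  go (no k) = ≤-reflexive (cong length (sym (filter-reject (λ i → P i ℕ.≟ c) {xs = W} k)))

transversal : (P : Fin m → ℕ) (W : List (Fin m)) → Unique W → Σ (Fin m → ℕ) λ Q →
  (∀ {i} → i ∈ W → Q i < count P (P i) W) × (∀ {i j} → i ∈ W → j ∈ W → P i ≡ P j → Q i ≡ Q j → i ≡ j)
transversal P [] u = (λ _ → 0) , (λ ()) , λ ()
transversal {m} P (x ∷ W) u with transversal P W (tail-unique u)
... | Q , lt , inj = Q′ , lt′ , inj′
  where
  Q′ : Fin m → ℕ
  Q′ = upd Q x (count P (P x) W)
  off : ∀ {i} → i ∈ W → Q′ i ≡ Q i
  off h = upd-other Q (count P (P x) W) (λ { refl → head∉ u h })
  at : Q′ x ≡ count P (P x) W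
  at = upd-self Q x (count P (P x) W)
  lt′ : ∀ {i} → i ∈ x ∷ W → Q′ i < count P (P i) (x ∷ W)
  lt′ (here refl) = ≤-reflexive (trans (cong suc at) (sym (count-hit P (P x) x W refl)))
  lt′ {i} (there h) = ≤-trans (≤-trans (≤-reflexive (cong suc (off h))) (lt h)) (count-≤ P (P i) x W)
  clash : ∀ {j} → j ∈ W → P x ≡ P j → Q′ x ≢ Q′ j
  clash {j} h e e′ = <-irrefl (trans (sym (off h)) (trans (sym e′) (trans at (cong (λ c → count P c W) e)))) (lt h)
  inj′ : ∀ {i j} → i ∈ x ∷ W → j ∈ x ∷ W → P i ≡ P j → Q′ i ≡ Q′ j → i ≡ j
  inj′ (here refl) (here refl) e e′ = refl
  inj′ (here refl) (there h) e e′ = ⊥-elim (clash h e e′)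
  inj′ (there h) (here refl) e e′ = ⊥-elim (clash h (sym e) (sym e′))
  inj′ (there h) (there k) e e′ = inj h k e (trans (sym (off h)) (trans e′ (off k)))

-- The lower bound

module Caterpillar (n′ : ℕ) where
  private
    N = suc n′

  size-m : ℕ
  size-m = suc N + n′

  ℓ : Fin (suc N) → Fin size-m
  ℓ i = i ↑ˡ n′

  spine : Fin n′ → Fin size-m
  spine j = suc N ↑ʳ j

  open Named ℓ

  grow : Tr N size-m → List (Fin n′ × Fin (suc N)) → Tr N size-m
  grow t [] = t
  grow t ((j , i) ∷ zs) = grow (nd (spine j) 0 (lf i) t) zs

  new-verts : List (Fin n′ × Fin (suc N)) → List (Fin size-m)
  new-verts [] = []
  new-verts ((j , i) ∷ zs) = spine j ∷ ℓ i ∷ new-verts zs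

  grow-verts : ∀ t zs → verts (grow t zs) ↭ verts t ++ new-verts zs
  grow-verts t [] = ↭-sym (PermP.++-identityʳ (verts t))
  grow-verts t ((j , i) ∷ zs) = ↭-trans (grow-verts _ zs) (shifts (spine j ∷ ℓ i ∷ []) (verts t))

  new-verts-↭ : ∀ zs → new-verts zs ↭ map ℓ (map proj₂ zs) ++ map spine (map proj₁ zs)
  new-verts-↭ [] = ↭-refl
  new-verts-↭ ((j , i) ∷ zs) = ↭-trans (↭-swap _ _ (new-verts-↭ zs))
    (↭-prep _ (↭-sym (shift (spine j) (map ℓ (map proj₂ zs)) (map spine (map proj₁ zs)))))

  grow-labels : ∀ t zs → labels (grow t zs) ↭ labels t ++ map proj₂ zs
  grow-labels t [] = ↭-sym (PermP.++-identityʳ (labels t))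
  grow-labels t ((j , i) ∷ zs) = ↭-trans (grow-labels _ zs) (↭-sym (shift i (labels t) (map proj₂ zs)))

  grow-cover : (f : Fin size-m → ℕ) (Q : Fin (suc N) → ℕ) → (∀ i → f (ℓ i) ≡ Q i) →
    ∀ t zs i L → f (top t) ≡ Q i → (∀ {p q} → (p , q) ∈ inner t → f p ≡ f q ⊎ InE p q L) → length L ≤ Q i →
    Linked (λ a b → Q a ≤ Q b) (i ∷ map proj₂ zs) → (∀ {j i} → (j , i) ∈ zs → f (spine j) ≡ Q i) →
    ∃[ i′ ] ∃[ L′ ] (i′ ∈ i ∷ map proj₂ zs × length L′ ≤ Q i′ ×
      (∀ {p q} → (p , q) ∈ inner (grow t zs) → f p ≡ f q ⊎ InE p q L′))
  grow-cover f Q fℓ t [] i L ft cov le _ fs = i , L , here refl , le , cov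
  grow-cover f Q fℓ t ((j , i₁) ∷ zs) i L ft cov le (q≤ ∷ lk) fs with Q i ℕ.≟ Q i₁
  ... | yes e = let i′ , L′ , a , b , c = grow-cover f Q fℓ (nd (spine j) 0 (lf i₁) t) zs i₁ L (fs (here refl)) cov′
                      (≤-trans le q≤) lk (fs ∘ there) in i′ , L′ , there a , b , c
    where
    cov′ : ∀ {p q} → (p , q) ∈ inner (nd (spine j) 0 (lf i₁) t) → f p ≡ f q ⊎ InE p q L
    cov′ (here refl) = inj₁ (trans (fs (here refl)) (sym (fℓ i₁)))
    cov′ (there (here refl)) = inj₁ (trans (fs (here refl)) (trans (sym e) (sym ft)))
    cov′ (there (there h)) = cov h
  ... | no k = let i′ , L′ , a , b , c = grow-cover f Q fℓ (nd (spine j) 0 (lf i₁) t) zs i₁ ((spine j , top t) ∷ L) (fs (here refl)) cov′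
                      (≤-trans (s≤s le) (ℕₚ.≤∧≢⇒< q≤ k)) lk (fs ∘ there) in i′ , L′ , there a , b , c
    where
    cov′ : ∀ {p q} → (p , q) ∈ inner (nd (spine j) 0 (lf i₁) t) → f p ≡ f q ⊎ InE p q ((spine j , top t) ∷ L)
    cov′ (here refl) = inj₁ (trans (fs (here refl)) (sym (fℓ i₁)))
    cov′ (there (here refl)) = inj₂ (inj₁ (here refl))
    cov′ (there (there h)) with cov h
    ... | inj₁ x = inj₁ x
    ... | inj₂ x = inj₂ (InE-⊆ there x)

  look : List (Fin n′ × A) → A → Fin n′ → A
  look [] d j = d
  look ((j′ , i) ∷ zs) d j with j ≟ j′
  ... | yes _ = i
  ... | no _ = look zs d j

  look-∈ : (zs : List (Fin n′ × A)) (d : A) → Unique (map proj₁ zs) → ∀ {j i} → (j , i) ∈ zs → look zs d j ≡ i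
  look-∈ ((j′ , i′) ∷ zs) d u {j} h with j ≟ j′
  look-∈ ((j′ , i′) ∷ zs) d u (here refl) | yes _ = refl
  look-∈ ((j′ , i′) ∷ zs) d u (there h) | yes refl = ⊥-elim (head∉ u (∈-map⁺ proj₁ h))
  look-∈ ((j′ , i′) ∷ zs) d u (here refl) | no k = ⊥-elim (k refl)
  look-∈ ((j′ , i′) ∷ zs) d u (there h) | no k = look-∈ zs d (tail-unique u) h

  zip-lists : (xs : List (Fin n′)) (ys : List A) → length xs ≡ length ys → ∃[ zs ] (map proj₁ zs ≡ xs × map proj₂ zs ≡ ys)
  zip-lists [] [] e = [] , refl , refl
  zip-lists (x ∷ xs) (y ∷ ys) e with zip-lists xs ys (ℕₚ.suc-injective e)
  ... | zs , refl , refl = (x , y) ∷ zs , refl , refl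

  ℓ≢spine : ∀ {i j} → ℓ i ≢ spine j
  ℓ≢spine {i} {j} e with trans (sym (splitAt-↑ˡ (suc N) i n′)) (trans (cong (splitAt (suc N)) e) (splitAt-↑ʳ (suc N) n′ j))
  ... | ()

  module Sorted-tree (i₀ : Fin (suc N)) (rest : List (Fin (suc N))) (π : i₀ ∷ rest ↭ proper-labels N) where
    private
      len : length (allFin n′) ≡ length rest
      len = trans (length-tabulate id) (ℕₚ.suc-injective (sym (trans (↭-length π) (proper-length N))))
      Z = zip-lists (allFin n′) rest len
    zs = proj₁ Z
    keys : map proj₁ zs ≡ allFin n′
    keys = proj₁ (proj₂ Z)
    vals : map proj₂ zs ≡ rest
    vals = proj₂ (proj₂ Z)
    cat : Tr N size-m
    cat = grow (lf i₀) zs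

    keys-unique : Unique (map proj₁ zs)
    keys-unique = subst Unique (sym keys) (Uniq.allFin⁺ n′)

    all-verts : ℓ F.zero ∷ verts cat ↭ map ℓ (F.zero ∷ i₀ ∷ rest) ++ map spine (allFin n′)
    all-verts = ↭-prep _ (↭-trans (grow-verts (lf i₀) zs) (↭-prep _ (↭-trans (new-verts-↭ zs)
      (↭-reflexive (cong₂ (λ a b → map ℓ a ++ map spine b) vals keys)))))

    cat-unique : Unique (ℓ F.zero ∷ verts cat)
    cat-unique = Unique-resp-↭ (↭-sym all-verts) (++-unique
      (Uniq.map⁺ (↑ˡ-injective n′ _ _) (∷-unique 0∉ (Unique-resp-↭ (↭-sym π) (proper-unique N))))
      (Uniq.map⁺ (↑ʳ-injective (suc N) _ _) (Uniq.allFin⁺ n′)) dj)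
      where
      0∉ : F.zero ∉ i₀ ∷ rest
      0∉ h with ∈-map⁻ F.suc (∈-resp-↭ π h)
      ... | _ , _ , ()
      dj : ∀ {z} → z ∈ map ℓ (F.zero ∷ i₀ ∷ rest) → z ∉ map spine (allFin n′)
      dj h k with ∈-map⁻ ℓ h | ∈-map⁻ spine k
      ... | _ , _ , refl | _ , _ , e = ℓ≢spine e

    cat-complete : ∀ v → v ∈ ℓ F.zero ∷ verts cat
    cat-complete v = ∈-resp-↭ (↭-sym all-verts) (go (splitAt (suc N) v) refl)
      where
      go : (x : Fin (suc N) ⊎ Fin n′) → splitAt (suc N) v ≡ x → v ∈ map ℓ (F.zero ∷ i₀ ∷ rest) ++ map spine (allFin n′)
      go (inj₂ j) e = ∈-++⁺ʳ (map ℓ (F.zero ∷ i₀ ∷ rest)) (subst (_∈ map spine (allFin n′)) (splitAt⁻¹-↑ʳ {m = suc N} e) (∈-map⁺ spine (∈-allFin j)))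
      go (inj₁ F.zero) e = ∈-++⁺ˡ {xs = map ℓ (F.zero ∷ i₀ ∷ rest)} (here (sym (splitAt⁻¹-↑ˡ {m = suc N} e)))
      go (inj₁ (F.suc i)) e = ∈-++⁺ˡ {xs = map ℓ (F.zero ∷ i₀ ∷ rest)} (subst (_∈ map ℓ (F.zero ∷ i₀ ∷ rest)) (splitAt⁻¹-↑ˡ {m = suc N} e)
        (there (∈-map⁺ ℓ (∈-resp-↭ (↭-sym π) (proper-∈ (λ ()))))))

    cat-labels : labels cat ↭ proper-labels N
    cat-labels = ↭-trans (grow-labels (lf i₀) zs) (↭-trans (↭-reflexive (cong (i₀ ∷_) vals)) π)

    open MkTree ℓ
    inj : ∀ i j → ℓ i ≡ ℓ j → i ≡ j
    inj i j = ↑ˡ-injective n′ i j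
    tree : BTree N size-m
    tree = mkTree inj cat cat-unique cat-complete cat-labels
    rep : Rep (adj tree) ℓ cat
    rep = tree-rep inj cat cat-unique cat-complete cat-labels

    module Coloured (Q : Fin (suc N) → ℕ) (lk : Linked (λ a b → Q a ≤ Q b) (i₀ ∷ rest)) where
      colour : Fin size-m → ℕ
      colour v = [ Q , (λ j → Q (look zs F.zero j)) ]′ (splitAt (suc N) v)
      colour-ℓ : ∀ i → colour (ℓ i) ≡ Q i
      colour-ℓ i = cong [ Q , (λ j → Q (look zs F.zero j)) ]′ (splitAt-↑ˡ (suc N) i n′)
      colour-spine : ∀ {j i} → (j , i) ∈ zs → colour (spine j) ≡ Q i
      colour-spine {j} h = trans (cong [ Q , (λ j → Q (look zs F.zero j)) ]′ (splitAt-↑ʳ (suc N) n′ j))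
        (cong Q (look-∈ zs F.zero keys-unique h))

      coloured : (K : ℕ) → (∀ {i} → i ∈ proper-labels N → Q i < K) → ∃[ L ] (Cov (adj tree) colour L × length L ≤ K)
      coloured K lt with grow-cover colour Q colour-ℓ (lf i₀) zs i₀ [] (colour-ℓ i₀) (λ ()) z≤n
            (subst (λ r → Linked (λ a b → Q a ≤ Q b) (i₀ ∷ r)) (sym vals) lk) colour-spine
      ... | i′ , L , i′∈ , le , cov = (ℓ F.zero , top cat) ∷ L , (λ x → cov″ (Rep.edge⁻ rep x)) ,
          ≤-trans (s≤s le) (lt (∈-resp-↭ π (subst (λ r → i′ ∈ i₀ ∷ r) vals i′∈)))
        where
        cov′ : ∀ {p q} → (p , q) ∈ edges (ℓ F.zero) cat → colour p ≡ colour q ⊎ InE p q ((ℓ F.zero , top cat) ∷ L)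
        cov′ (here refl) = inj₂ (inj₁ (here refl))
        cov′ (there h) = [ inj₁ , inj₂ ∘ InE-⊆ there ]′ (cov h)
        cov″ : ∀ {p q} → InE p q (edges (ℓ F.zero) cat) → colour p ≡ colour q ⊎ InE p q ((ℓ F.zero , top cat) ∷ L)
        cov″ (inj₁ h) = cov′ h
        cov″ (inj₂ h) = [ inj₁ ∘ sym , inj₂ ∘ InE-flip ]′ (cov′ h)

  module _ (Q : Fin (suc N) → ℕ) where
    private
      O : DecTotalOrder _ _ _
      O = On.decTotalOrder ℕₚ.≤-decTotalOrder Q
      module Srt = Sort O

    record Sorted-by : Set where
      field
        first : Fin (suc N)
        others : List (Fin (suc N))
        perm : first ∷ others ↭ proper-labels N
        linked : Linked (λ a b → Q a ≤ Q b) (first ∷ others)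

    sorted : Sorted-by
    sorted = go (Srt.sort (proper-labels N)) (Srt.sort-↭ (proper-labels N)) (Srt.sort-↗ (proper-labels N))
      where
      go : ∀ is → is ↭ proper-labels N → Linked (λ a b → Q a ≤ Q b) is → Sorted-by
      go [] π _ with trans (↭-length π) (proper-length N)
      ... | ()
      go (i ∷ is) π lk = record { first = i ; others = is ; perm = π ; linked = lk }

map-unique : (f : A → B) (xs : List A) → Unique xs → (∀ {x y} → x ∈ xs → y ∈ xs → f x ≡ f y → x ≡ y) → Unique (map f xs)
map-unique f [] u inj = []
map-unique f (x ∷ xs) u inj = ∷-unique notin (map-unique f xs (tail-unique u) (λ h k → inj (there h) (there k)))
  where
  notin : f x ∉ map f xs
  notin h with ∈-map⁻ f h
  ... | y , y∈ , e = head∉ u (subst (_∈ xs) (sym (inj (here refl) (there y∈) e)) y∈)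

degree-≤-3 : {n : ℕ} (A : BTree n m) → ∀ p → deg (adj A) p ≤ 3
degree-≤-3 A p with any? (λ i → leaf A i ≟ p)
... | yes (i , refl) = ≤-trans (≤-reflexive (leaf-deg A i)) (s≤s z≤n)
... | no k = ≤-reflexive (inner-deg A p (λ i e → k (i , e)))

-- The colourings of the two trees multiply to an injective colouring of the leaves of C.
parsimony-bound : {n m₁ m₂ : ℕ} (B : BTree n m₁) (C : BTree n m₂) → Cut (adj B) →
  (Q P : Fin (suc n) → ℕ) (c : Fin m₁ → ℕ) (L₂ : List (Edge m₁)) → Cov (adj B) c L₂ → (∀ i → c (leaf B i) ≡ Q i) →
  (d : Fin m₂ → ℕ) (L₁ : List (Edge m₂)) → Cov (adj C) d L₁ → (∀ {i} → i ∈ proper-labels n → d (leaf C i) ≡ P i) →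
  (∀ {i j} → i ∈ proper-labels n → j ∈ proper-labels n → P i ≡ P j → Q i ≡ Q j → i ≡ j) →
  ∀ χ k → Reach χ k B C → n ≤ suc (k + length L₂ + length L₁)
parsimony-bound {n} {m₁} {m₂} B C cutB Q P c L₂ cov₂ c-leaf d L₁ cov₁ d-leaf inj χ k (E , steps , φ , φ-adj , φ-leaf)
  with steps-parsimony χ (degree-≤-3 B)
    (record { isym = Traverse.T-Sym B ; iirr = Traverse.T-Irr B ; ideg = λ p → ≤-refl }) cutB cov₂ steps
... | c′ , L′ , cov′ , le , off = ≤-trans (≤-reflexive (sym (trans (length-map (leaf C) (proper-labels n)) (proper-length n))))
    (≤-trans (colours-≤-bad-edges (Productₚ.≡-dec ℕ._≟_ ℕ._≟_) (adj C) (connected C) M g covg (map (leaf C) (proper-labels n)) ug)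
      (s≤s (≤-trans (≤-reflexive (trans (length-++ (map φφ L′)) (cong (_+ length L₁) (length-map φφ L′))))
        (+-mono-≤ le ≤-refl))))
  where
  open Inverse φ using (to; from; strictlyInverseˡ; strictlyInverseʳ)
  φφ : Edge m₁ → Edge m₂
  φφ (p , q) = to p , to q
  M : List (Edge m₂)
  M = map φφ L′ ++ L₁
  g : Fin m₂ → ℕ × ℕ
  g v = c′ (from v) , d v
  E-of : ∀ {p q} → T (adj C p q) → T (E (from p) (from q))
  E-of {p} {q} x = subst T (φ-adj (from p) (from q))
    (subst T (sym (cong₂ (adj C) (strictlyInverseˡ p) (strictlyInverseˡ q))) x)
  φ-InE : ∀ {p q} → InE (from p) (from q) L′ → InE p q (map φφ L′)
  φ-InE {p} {q} (inj₁ h) = inj₁ (subst (_∈ map φφ L′) (cong₂ _,_ (strictlyInverseˡ p) (strictlyInverseˡ q)) (∈-map⁺ φφ h))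
  φ-InE {p} {q} (inj₂ h) = inj₂ (subst (_∈ map φφ L′) (cong₂ _,_ (strictlyInverseˡ q) (strictlyInverseˡ p)) (∈-map⁺ φφ h))
  covg : Cov (adj C) g M
  covg {p} {q} x with cov′ (E-of x) | cov₁ x
  ... | inj₁ a | inj₁ b = inj₁ (cong₂ _,_ a b)
  ... | inj₂ a | _ = inj₂ (InE-⊆ (∈-++⁺ˡ {xs = map φφ L′}) (φ-InE a))
  ... | inj₁ _ | inj₂ b = inj₂ (InE-⊆ (∈-++⁺ʳ (map φφ L′)) b)
  c′-leaf : ∀ i → c′ (from (leaf C i)) ≡ Q i
  c′-leaf i = trans (cong c′ (trans (cong from (sym (φ-leaf i))) (strictlyInverseʳ (leaf B i))))
    (trans (off (leaf B i) (≤-reflexive (leaf-deg B i))) (c-leaf i))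
  inj-g : ∀ {x y} → x ∈ map (leaf C) (proper-labels n) → y ∈ map (leaf C) (proper-labels n) → g x ≡ g y → x ≡ y
  inj-g h k e with ∈-map⁻ (leaf C) h | ∈-map⁻ (leaf C) k
  ... | i , i∈ , refl | i′ , i′∈ , refl = cong (leaf C) (inj i∈ i′∈
    (trans (sym (d-leaf i∈)) (trans (cong proj₂ e) (d-leaf i′∈)))
    (trans (sym (c′-leaf i)) (trans (cong proj₁ e) (c′-leaf i′))))
  ug : Unique (map g (map (leaf C) (proper-labels n)))
  ug = map-unique g _ (Uniq.map⁺ (λ {x} {y} → leaf-inj C x y) (proper-unique n)) inj-g

record SortedCaterpillar (n : ℕ) (Q : Fin (suc n) → ℕ) (K : ℕ) : Set where
  field
    {verts#} : ℕ
    tree : BTree n verts#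
    tree-cut : Cut (adj tree)
    colour : Fin verts# → ℕ
    bad : List (Edge verts#)
    bad-cov : Cov (adj tree) colour bad
    bad-len : length bad ≤ K
    colour-leaf : ∀ i → colour (leaf tree i) ≡ Q i

sorted-caterpillar : ∀ n′ (Q : Fin (suc (suc n′)) → ℕ) (K : ℕ) →
  (∀ {i} → i ∈ proper-labels (suc n′) → Q i < K) → SortedCaterpillar (suc n′) Q K
sorted-caterpillar n′ Q K lt = record
  { tree = tree ; tree-cut = RepProps.rep-Cut rep ; colour = colour ; bad = proj₁ (coloured K lt)
  ; bad-cov = proj₁ (proj₂ (coloured K lt)) ; bad-len = proj₂ (proj₂ (coloured K lt)) ; colour-leaf = colour-ℓ }
  where
  open Caterpillar n′
  open Sorted-by (sorted Q)
  open Sorted-tree first others perm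
  open Coloured Q linked

far-tree : ∀ {m} n′ (s : ℕ) → 1 ≤ s → (C : BTree (suc n′) m) →
  ∃[ m′ ] Σ (BTree (suc n′) m′) λ B → ∃[ k ] (k * s ≤ suc n′ × (∀ χ j → Reach χ j B C → suc n′ ≤ suc (j + 2 * s + k)))
far-tree n′ s 1≤s C with Traverse.represent C
... | t , R with decompose s 1≤s (size t) t ≤-refl
... | k , D with piece-colouring (leaf C) (leaf C F.zero) D (Rep.uniq R) | transversal (piece D) (labels t) (RepProps.labs-unique R)
... | P , L₁ , |L₁| , cov₁ , P-leaf | Q , Q-lt , Q-inj = _ , tree , k ,
    subst (k * s ≤_) (RepProps.labs-length R) (pieces-bound D) ,
    λ χ j re → ≤-trans (parsimony-bound tree C tree-cut Q (piece D) colour bad bad-cov colour-leaf P L₁ covC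
        (λ h → P-leaf (lab∈ h)) (λ h h′ → Q-inj (lab∈ h) (lab∈ h′)) χ j re)
      (s≤s (+-mono-≤ (+-mono-≤ (≤-refl {j}) bad-len) |L₁|))
  where
  lab∈ : ∀ {i} → i ∈ proper-labels (suc n′) → i ∈ labels t
  lab∈ = ∈-resp-↭ (↭-sym (Rep.labs R))
  open SortedCaterpillar (sorted-caterpillar n′ Q (2 * s) (λ {i} h → ≤-trans (Q-lt (lab∈ h))
    (piece-size D (piece D i) (labels t) (RepProps.labs-unique R) id)))
  covC : Cov (adj C) P L₁
  covC x with Rep.edge⁻ R x
  ... | inj₁ h = cov₁ h
  ... | inj₂ h = [ inj₁ ∘ sym , inj₂ ∘ InE-flip ]′ (cov₁ h)

-- Moves realised on terms

walk-suffix : {E : Adj m} {a b z : Fin m} {p : List (Fin m)} → Walk E a b p → Unique p → z ∈ p →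
  ∃[ q ] (Walk E z b q × Unique q)
walk-suffix w@stop u (here refl) = _ , w , u
walk-suffix w@(step _ _) u (here refl) = _ , w , u
walk-suffix (step e w) u (there h) = walk-suffix w (tail-unique u) h

simple-path : {E : Adj m} {a b : Fin m} {p : List (Fin m)} → Walk E a b p → ∃[ q ] (Walk E a b q × Unique q)
simple-path stop = _ , stop , [] ∷ []
simple-path {a = a} (step e w) with simple-path w
... | q , w′ , u with a ∈ᶠ? q
... | yes h = walk-suffix w′ u h
... | no k = a ∷ q , step e w′ , ∷-unique k u

walk-start : {E : Adj m} {a b : Fin m} {p : List (Fin m)} → Walk E a b p → a ∈ p
walk-start stop = here refl
walk-start (step _ _) = here refl

crossing : {E : Adj m} {x y : Fin m} (g : Fin m → Bool) → (∀ {p q} → T (E p q) → g p ≡ g q ⊎ SameEdge x y p q) →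
  ∀ {a b p} → Walk E a b p → g a ≢ g b → x ∈ p
crossing g c stop k = ⊥-elim (k refl)
crossing g c (step e w) k with c e
... | inj₁ eq = there (crossing g c w (λ z → k (trans eq z)))
... | inj₂ (inj₁ (refl , _)) = here refl
... | inj₂ (inj₂ (refl , _)) = there (walk-start w)

path-through : {E : Adj m} {x y : Fin m} (g : Fin m → Bool) → (∀ {p q} → T (E p q) → g p ≡ g q ⊎ SameEdge x y p q) →
  ∀ {a b} → Conn E a b → g a ≢ g b → PathThrough E a b x
path-through g c (_ , w) k with simple-path w
... | q , w′ , u = q , w′ , u , crossing g c w′ k

other-two-nbrs : (E : Adj m) {v w : Fin m} → deg E v ≡ 3 → T (E v w) →
  ∃[ a ] ∃[ b ] (a ≢ b × a ≢ w × b ≢ w × T (E v a) × T (E v b))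
other-two-nbrs E {v} {w} d h with ∈⇒↭ (nbrs⁺ E h)
... | ys , π = go ys π (ℕₚ.suc-injective (trans (sym (↭-length π)) (trans (sym (deg-nbrs E v)) d)))
  where
  go : ∀ ys → nbrs E v ↭ w ∷ ys → length ys ≡ 2 → ∃[ a ] ∃[ b ] (a ≢ b × a ≢ w × b ≢ w × T (E v a) × T (E v b))
  go (a ∷ b ∷ []) π refl with Unique-resp-↭ π (nbrs-unique E v)
  ... | (w≢a ∷ w≢b ∷ []) ∷ (a≢b ∷ []) ∷ _ = a , b , a≢b , w≢a ∘ sym , w≢b ∘ sym ,
    nbrs⁻ E (∈-resp-↭ (↭-sym π) (there (here refl))) , nbrs⁻ E (∈-resp-↭ (↭-sym π) (there (there (here refl))))

-- An SPR move is a TBR move that reinserts the other end of the pruned edge where it was.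
module _ (E : Adj m) (isym : Sym E) (iirr : Irr E) (cut : Cut E) (deg-1-3 : ∀ v → deg E v ≡ 1 ⊎ deg E v ≡ 3)
  (x y a b c d : Fin m) (xy : T (E x y)) (ax : T (E a x)) (xb : T (E x b)) (cd : T (E c d))
  (n₁ : ¬ SameEdge x y a x) (n₂ : ¬ SameEdge x y x b) (n₃ : ¬ SameEdge x y c d)
  (n₄ : ¬ SameEdge a x x b) (n₅ : ¬ SameEdge a x c d) (n₆ : ¬ SameEdge x b c d)
  (g : Fin m → Bool) (gE : ∀ {p q} → T (E p q) → g p ≡ g q ⊎ SameEdge x y p q)
  (gy : g y ≡ true) (gx : g x ≡ false) (ga : g a ≡ false) (gb : g b ≡ false) (gc : g c ≡ false) (gd : g d ≡ false)
  (a-c : Conn (suppress x a b (rem x y E)) a c) where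
  private
    x-deg : deg E x ≤ 3
    x-deg with deg-1-3 x
    ... | inj₁ z = ≤-trans (≤-reflexive z) (s≤s z≤n)
    ... | inj₂ z = ≤-reflexive z
  open SPRFacts E isym iirr x y a b c d x-deg xy ax xb cd n₁ n₂ n₃ n₄ n₅ n₆
    using (G; G-E; x≢y; a≢b; a≢y; b≢y; three-nbrs; efH; S; S-Sym; S-local⁺; S-local⁻; spr-≐)
  private
    x-deg-3 : deg E x ≡ 3
    x-deg-3 with deg-1-3 x
    ... | inj₁ z = ⊥-elim (three-nbrs (≤-reflexive z))
    ... | inj₂ z = z
    apart : ∀ {z w} → g z ≡ true → g w ≡ false → z ≢ w
    apart gz gw refl with trans (sym gz) gw
    ... | ()
    side-x : TBRSide E G x y S
    side-x = inj₂ (a , b , c , d , x-deg-3 , a≢b , a≢y , b≢y , isym ax , xb , efH , a-c , λ p q → refl)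
    S-at-Y : ∀ {z w} → g z ≡ true → T (G z w) → T (S z w)
    S-at-Y gz = S-local⁺ (apart gz gx) (apart gz ga) (apart gz gb) (apart gz gc) (apart gz gd)
    S-at-Y⁻ : ∀ {z w} → g z ≡ true → T (S z w) → T (G z w)
    S-at-Y⁻ gz = S-local⁻ (apart gz gx) (apart gz ga) (apart gz gb) (apart gz gc) (apart gz gd)
    side-y : deg E y ≡ 1 ⊎ deg E y ≡ 3 → ∃[ G₃ ] (TBRSide E S y x G₃ × S ≐ G₃)
    side-y (inj₁ z) = S , inj₁ (z , λ p q → refl) , λ p q → refl
    side-y (inj₂ z) with other-two-nbrs E z (isym xy)
    ... | p , q , p≢q , p≢x , q≢x , yp , yq = subdivide y p q K , inj₂ (p , q , p , q , z , p≢q , p≢x , q≢x , yp , yq ,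
        add-new p q K₂ p q (inj₁ (refl , refl)) , (_ , stop) , λ _ _ → refl) , λ v w → T⇒≡ into outof
      where
      K₁ = rem y q S
      K₂ = rem y p K₁
      K = suppress y p q S
      M₁ = rem p q K
      M₂ = add y q M₁
      G-y : ∀ {w} → T (E y w) → w ≢ x → T (G y w)
      G-y {w} h k′ = rem⁺ x y E y w h (λ { (inj₁ (e₁ , _)) → x≢y e₁ ; (inj₂ (e₁ , _)) → k′ (sym e₁) })
      g-nbr : ∀ {w} → T (G y w) → g w ≡ true
      g-nbr h with gE (proj₁ (G-E h))
      ... | inj₁ e₁ = trans (sym e₁) gy
      ... | inj₂ e₁ = ⊥-elim (proj₂ (G-E h) e₁)
      Gp = G-y yp p≢x
      Gq = G-y yq q≢x
      triangle : ¬ T (S p q)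
      triangle h with cut (proj₁ (G-E (S-at-Y⁻ (g-nbr Gp) h)))
      ... | γ , γ≢ , γc = γ≢ (trans (sym (same yp)) (same yq))
        where
        same : ∀ {w} → T (E y w) → γ y ≡ γ w
        same h′ with γc h′
        ... | inj₁ e₁ = e₁
        ... | inj₂ (inj₁ (refl , _)) = ⊥-elim (iirr yp)
        ... | inj₂ (inj₂ (_ , refl)) = ⊥-elim (iirr yq)
      Sp = S-at-Y gy Gp
      Sq = S-at-Y gy Gq
      along : ∀ {u v v′ w} → T (S u v) → SameEdge u v v′ w → T (S v′ w)
      along h (inj₁ (refl , refl)) = h
      along h (inj₂ (refl , refl)) = S-Sym h
      into : ∀ {v w} → T (S v w) → T (subdivide y p q K v w)
      into {v} {w} h with sameEdge? y p v w | sameEdge? y q v w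
      ... | yes e₁ | _ = add-new y p M₂ v w e₁
      ... | no _ | yes e₁ = add-old y p M₂ v w (add-new y q M₁ v w e₁)
      ... | no k₁ | no k₂ = add-old y p M₂ v w (add-old y q M₁ v w (rem⁺ p q K v w
            (add-old p q K₂ v w (rem⁺ y p K₁ v w (rem⁺ y q S v w h k₂) k₁))
            (λ e₁ → triangle (along h (sameEdge-sym e₁)))))
      outof : ∀ {v w} → T (subdivide y p q K v w) → T (S v w)
      outof {v} {w} h with add⁻ y p M₂ v w h
      ... | inj₂ e₁ = along Sp e₁
      ... | inj₁ h₁ with add⁻ y q M₁ v w h₁
      ... | inj₂ e₁ = along Sq e₁
      ... | inj₁ h₂ with rem⁻ p q K v w h₂
      ... | h₃ , k₁ with add⁻ p q K₂ v w h₃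
      ... | inj₂ e₁ = ⊥-elim (k₁ e₁)
      ... | inj₁ h₄ = proj₁ (rem⁻ y q S v w (proj₁ (rem⁻ y p K₁ v w h₄)))

  SPR⇒TBR : TBRMove E (sprResult x a b c d E)
  SPR⇒TBR with side-y (deg-1-3 y)
  ... | G₃ , sy , S≐ = x , y , S , G₃ , xy , side-x , sy , λ p q → trans (spr-≐ p q) (cong (_∨ isPair x y p q) (S≐ p q))

module _ {ℓ : Fin (suc n) → Fin m} where
  open Named ℓ
  open MkTree ℓ using (rep-Irr; rep-degree-1-3)

  Rep-↭ : {E : Adj m} {t t′ : Tr n m} → edges (ℓ F.zero) t ↭ edges (ℓ F.zero) t′ → verts t ↭ verts t′ → labels t ↭ labels t′ →
    Rep E ℓ t → Rep E ℓ t′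
  Rep-↭ e v l R = record
    { edge⁻ = λ x → InE-⊆ (∈-resp-↭ e) (edge⁻ x) ; edge⁺ = λ h → edge⁺ (∈-resp-↭ (↭-sym e) h) ; rsym = rsym
    ; uniq = Unique-resp-↭ (↭-prep _ v) uniq ; compl = λ z → ∈-resp-↭ (↭-prep _ v) (compl z)
    ; labs = ↭-trans (↭-sym l) labs }
    where open Rep R

  record Similar (Y Y′ : Tr n m) : Set where
    field
      s-top : top Y ≡ top Y′
      s-inner : inner Y ≡ inner Y′
      s-verts : verts Y ≡ verts Y′
      s-labels : labels Y ≡ labels Y′

  regraft : {E : Adj m} {Y Y′ t₀ t t′ : Tr n m} {x : Fin m} {k k′ : ℕ} → Rep E ℓ t → Ins Y x k t₀ t → Ins Y′ x k′ t₀ t′ →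
    Similar Y Y′ → ∃[ E′ ] ((∀ χ → Steps (Move χ (ℓ F.zero)) 1 E E′) × Rep E′ ℓ t′)
  regraft {E} {Y} {Y′} {t₀} {t} {t′} {x} R i i′ sim with Ins-edges i (ℓ F.zero) | Ins-edges i′ (ℓ F.zero)
  ... | a , b , V , e₀ , e | c , d , V′ , e₀′ , e′ = go (Productₚ.≡-dec _≟_ _≟_ (c , d) (a , b))
    where
    open Rep R
    open Similar sim
    r = ℓ F.zero
    y = top Y
    vv : verts t ↭ verts t′
    vv = ↭-trans (Ins-verts i) (↭-trans (↭-reflexive (cong (λ z → x ∷ z ++ verts t₀) s-verts)) (↭-sym (Ins-verts i′)))
    ll : labels t ↭ labels t′
    ll = ↭-trans (Ins-labels i) (↭-trans (↭-reflexive (cong (_++ labels t₀) s-labels)) (↭-sym (Ins-labels i′)))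
    stalk≡ : ∀ {p q} → stalk Y x p q ≡ stalk Y′ x p q
    stalk≡ {p} {q} = cong₂ (λ u v → (p , x) ∷ (x , q) ∷ (x , u) ∷ v) s-top s-inner
    go : Dec ((c , d) ≡ (a , b)) → ∃[ E′ ] ((∀ χ → Steps (Move χ r) 1 E E′) × Rep E′ ℓ t′)
    go (yes refl) = E , (λ χ → done) , Rep-↭ (↭-trans e (↭-trans (++⁺ˡ (stalk Y x a b) (drop-∷ (↭-trans (↭-sym e₀) e₀′)))
      (↭-trans (↭-reflexive (cong (_++ V′) stalk≡)) (↭-sym e′)))) vv ll R
    go (no k) = E′ , (λ χ → more (move χ) done) , rep′
      where
      cd∈S : (c , d) ∈ V
      cd∈S with ∈-resp-↭ (↭-trans (↭-sym e₀′) e₀) (here refl)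
      ... | here z = ⊥-elim (k z)
      ... | there z = z
      U = proj₁ (∈⇒↭ cd∈S)
      S↭ : V ↭ (c , d) ∷ U
      S↭ = proj₂ (∈⇒↭ cd∈S)
      both : edges r t₀ ↭ (a , b) ∷ (c , d) ∷ U
      both = ↭-trans e₀ (↭-prep _ S↭)
      S′↭ : V′ ↭ (a , b) ∷ U
      S′↭ = drop-∷ (↭-trans (↭-sym e₀′) (↭-trans both (↭-swap _ _ ↭-refl)))
      F₁ F₂ : List (Edge m)
      F₁ = (a , x) ∷ (x , b) ∷ (x , y) ∷ (c , d) ∷ inner Y ++ U
      F₂ = (c , x) ∷ (x , d) ∷ (x , y) ∷ (a , b) ∷ inner Y ++ U
      f₁ : edges r t ↭ F₁
      f₁ = ↭-trans e (↭-prep _ (↭-prep _ (↭-prep _ (↭-trans (++⁺ˡ (inner Y) S↭) (shift (c , d) (inner Y) U)))))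
      f₂ : edges r t′ ↭ F₂
      f₂ = ↭-trans e′ (↭-trans (↭-reflexive (cong (_++ V′) (sym stalk≡)))
        (↭-prep _ (↭-prep _ (↭-prep _ (↭-trans (++⁺ˡ (inner Y) S′↭) (shift (a , b) (inner Y) U))))))
      W : Unique (x ∷ verts Y ++ r ∷ verts t₀)
      W = Unique-resp-↭ (↭-trans (↭-prep r (Ins-verts i)) (↭-sym (shift r (x ∷ verts Y) (verts t₀)))) uniq
      UW = unique-++ (x ∷ verts Y) W
      D₁ : AllPairs DiffEdge F₁
      D₁ = DiffEdge-resp-↭ f₁ (edges-distinct r t uniq)
      D₀ : AllPairs DiffEdge ((a , b) ∷ (c , d) ∷ U)
      D₀ = DiffEdge-resp-↭ both (edges-distinct r t₀ (proj₁ (proj₂ UW)))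
      E₁ : ∀ {p q} → (p , q) ∈ F₁ → T (E p q)
      E₁ h = edge⁺ (∈-resp-↭ (↭-sym f₁) h)
      E⁻ : ∀ {p q} → T (E p q) → InE p q F₁
      E⁻ h = InE-⊆ (∈-resp-↭ f₁) (edge⁻ h)
      g : Fin m → Bool
      g z = ⌊ z ∈ᶠ? verts Y ⌋
      g-Y : ∀ {z} → z ∈ verts Y → g z ≡ true
      g-Y {z} h with z ∈ᶠ? verts Y
      ... | yes _ = refl
      ... | no w = ⊥-elim (w h)
      g-x : g x ≡ false
      g-x with x ∈ᶠ? verts Y
      ... | yes h = ⊥-elim (head∉ (proj₁ UW) h)
      ... | no _ = refl
      g-0 : ∀ {z} → z ∈ r ∷ verts t₀ → g z ≡ false
      g-0 {z} h with z ∈ᶠ? verts Y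
      ... | yes w = ⊥-elim (proj₂ (proj₂ UW) (there w) h)
      ... | no _ = refl
      old : ∀ {p q} → (p , q) ∈ (a , b) ∷ (c , d) ∷ U → g p ≡ false × g q ≡ false
      old h = let h₁ , h₂ = edges-ends r t₀ (∈-resp-↭ (↭-sym both) h) in g-0 h₁ , g-0 (there h₂)
      gF : ∀ {p q} → (p , q) ∈ F₁ → g p ≡ g q ⊎ SameEdge x y p q
      gF (here refl) = inj₁ (trans (proj₁ (old (here refl))) (sym g-x))
      gF (there (here refl)) = inj₁ (trans g-x (sym (proj₂ (old (here refl)))))
      gF (there (there (here refl))) = inj₂ (inj₁ (refl , refl))
      gF (there (there (there (here refl)))) = let h₁ , h₂ = old (there (here refl)) in inj₁ (trans h₁ (sym h₂))
      gF (there (there (there (there h)))) with ∈-++⁻ (inner Y) h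
      ... | inj₁ z = let h₁ , h₂ = inner-ends Y z in inj₁ (trans (g-Y h₁) (sym (g-Y h₂)))
      ... | inj₂ z = let h₁ , h₂ = old (there (there z)) in inj₁ (trans h₁ (sym h₂))
      gE : ∀ {p q} → T (E p q) → g p ≡ g q ⊎ SameEdge x y p q
      gE h with E⁻ h
      ... | inj₁ z = gF z
      ... | inj₂ z = [ inj₁ ∘ sym , inj₂ ∘ flipʳ ]′ (gF z)
      t≢f : true ≢ false
      t≢f ()
      through : ∀ {z} → z ∈ r ∷ verts t₀ → PathThrough E z y x
      through {z} h = path-through g gE (RepProps.rep-connected R z y)
        (λ eq → t≢f (trans (sym (g-Y (top∈ Y))) (trans (sym eq) (g-0 h))))
      diffs : ¬ SameEdge a x x b × ¬ SameEdge a x x y × ¬ SameEdge a x c d × ¬ SameEdge x b x y × ¬ SameEdge x b c d × ¬ SameEdge x y c d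
      diffs with D₁
      ... | (d₁ ∷ d₂ ∷ d₃ ∷ _) ∷ (d₄ ∷ d₅ ∷ _) ∷ (d₆ ∷ _) ∷ _ = d₁ , d₂ , d₃ , d₄ , d₅ , d₆
      n₁ = proj₁ diffs
      n₂ = proj₁ (proj₂ diffs)
      n₃ = proj₁ (proj₂ (proj₂ diffs))
      n₄ = proj₁ (proj₂ (proj₂ (proj₂ diffs)))
      n₅ = proj₁ (proj₂ (proj₂ (proj₂ (proj₂ diffs))))
      n₆ = proj₂ (proj₂ (proj₂ (proj₂ (proj₂ diffs))))
      far : ∀ {p q} → (p , q) ∈ inner Y ++ U → ¬ SameEdge a x p q × ¬ SameEdge x b p q × ¬ SameEdge c d p q
      far h with D₁
      ... | (_ ∷ _ ∷ _ ∷ p₁) ∷ (_ ∷ _ ∷ p₂) ∷ _ ∷ p₃ ∷ _ = All.lookup p₁ h , All.lookup p₂ h , All.lookup p₃ h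
      cd≁ab : ¬ SameEdge c d a b
      cd≁ab with D₀
      ... | (p ∷ _) ∷ _ = p ∘ sameEdge-sym
      data′ : SPRData E x y a b c d
      data′ = E₁ (there (there (here refl))) , E₁ (here refl) , E₁ (there (here refl)) , E₁ (there (there (there (here refl)))) ,
        (n₂ ∘ sameEdge-sym) , (n₄ ∘ sameEdge-sym) , n₆ , n₁ , n₃ , n₅ ,
        through (proj₁ (edges-ends r t₀ (∈-resp-↭ (↭-sym both) (there (here refl)))))
      R₁ = rem a x E
      R₂ = rem x b R₁
      R₃ = add a b R₂
      R₄ = rem c d R₃
      R₅ = add c x R₄
      E′ = sprResult x a b c d E
      sym′ : Sym E′
      sym′ = add-Sym {E = R₅} (add-Sym {E = R₄} (rem-Sym {E = R₃} (add-Sym {E = R₂} (rem-Sym {E = R₁} (rem-Sym {E = E} rsym)))))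
      out : ∀ {p q} → T (E′ p q) → InE p q F₂
      out {p} {q} h with add⁻ x d R₅ p q h
      ... | inj₂ z = ∈-InE (there (here refl)) z
      ... | inj₁ h₁ with add⁻ c x R₄ p q h₁
      ... | inj₂ z = ∈-InE (here refl) z
      ... | inj₁ h₂ with rem⁻ c d R₃ p q h₂
      ... | h₃ , ncd with add⁻ a b R₂ p q h₃
      ... | inj₂ z = ∈-InE (there (there (there (here refl)))) z
      ... | inj₁ h₄ with rem⁻ x b R₁ p q h₄
      ... | h₅ , nxb with rem⁻ a x E p q h₅
      ... | h₆ , nax with E⁻ h₆
      ... | inj₁ (here refl) = ⊥-elim (nax (inj₁ (refl , refl)))
      ... | inj₁ (there (here refl)) = ⊥-elim (nxb (inj₁ (refl , refl)))
      ... | inj₁ (there (there (here refl))) = inj₁ (there (there (here refl)))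
      ... | inj₁ (there (there (there (here refl)))) = ⊥-elim (ncd (inj₁ (refl , refl)))
      ... | inj₁ (there (there (there (there z)))) = inj₁ (there (there (there (there z))))
      ... | inj₂ (here refl) = ⊥-elim (nax (inj₂ (refl , refl)))
      ... | inj₂ (there (here refl)) = ⊥-elim (nxb (inj₂ (refl , refl)))
      ... | inj₂ (there (there (here refl))) = inj₂ (there (there (here refl)))
      ... | inj₂ (there (there (there (here refl)))) = ⊥-elim (ncd (inj₂ (refl , refl)))
      ... | inj₂ (there (there (there (there z)))) = inj₂ (there (there (there (there z))))
      keep : ∀ {p q} → T (E p q) → ¬ SameEdge a x p q → ¬ SameEdge x b p q → ¬ SameEdge c d p q → T (E′ p q)
      keep {p} {q} h k₁ k₂ k₃ = add-old x d R₅ p q (add-old c x R₄ p q (rem⁺ c d R₃ p q (add-old a b R₂ p q (rem⁺ x b R₁ p q (rem⁺ a x E p q h k₁) k₂)) k₃))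
      ins : ∀ {p q} → (p , q) ∈ F₂ → T (E′ p q)
      ins (here refl) = add-old x d R₅ c x (add-new c x R₄ c x (inj₁ (refl , refl)))
      ins (there (here refl)) = add-new x d R₅ x d (inj₁ (refl , refl))
      ins (there (there (here refl))) = keep (E₁ (there (there (here refl)))) n₂ n₄ (n₆ ∘ sameEdge-sym)
      ins (there (there (there (here refl)))) = add-old x d R₅ a b (add-old c x R₄ a b (rem⁺ c d R₃ a b (add-new a b R₂ a b (inj₁ (refl , refl))) cd≁ab))
      ins (there (there (there (there h)))) = let k₁ , k₂ , k₃ = far h in keep (E₁ (there (there (there (there h))))) k₁ k₂ k₃
      rep′ : Rep E′ ℓ t′
      rep′ = record { edge⁻ = λ h → InE-⊆ (∈-resp-↭ (↭-sym f₂)) (out h) ; edge⁺ = λ h → ins (∈-resp-↭ f₂ h) ; rsym = sym′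
        ; uniq = Unique-resp-↭ (↭-prep _ vv) uniq ; compl = λ z → ∈-resp-↭ (↭-prep _ vv) (compl z) ; labs = ↭-trans (↭-sym ll) labs }
      H₀ H : Adj m
      H₀ = rem x a (rem x b (rem x y E))
      H = suppress x a b (rem x y E)
      H-old : ∀ p q → T (E p q) → ¬ SameEdge x y p q → ¬ SameEdge x a p q → ¬ SameEdge x b p q → T (H p q)
      H-old p q h k₁ k₂ k₃ = add-old a b H₀ p q (rem⁺ x a (rem x b (rem x y E)) p q (rem⁺ x b (rem x y E) p q (rem⁺ x y E p q h k₁) k₃) k₂)
      H-edges : ∀ {p q} → (p , q) ∈ edges r t₀ → T (H p q)
      H-edges h with ∈-resp-↭ both h
      ... | here refl = add-new a b H₀ a b (inj₁ (refl , refl))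
      ... | there (here refl) = H-old c d (E₁ (there (there (there (here refl))))) n₆ (n₃ ∘ flipˡ) n₅
      ... | there (there z) with D₁
      ... | (_ ∷ _ ∷ _ ∷ p₁) ∷ (_ ∷ _ ∷ p₂) ∷ (_ ∷ p₃) ∷ _ = H-old _ _ (E₁ (there (there (there (there z′))))) (All.lookup p₃ z′)
          (All.lookup p₁ z′ ∘ flipˡ) (All.lookup p₂ z′)
        where z′ = ∈-++⁺ʳ (inner Y) z
      root-path : ∀ {z} → z ∈ r ∷ verts t₀ → PathIn H (λ _ → ⊤) r z
      root-path (here refl) = nil tt
      root-path (there h) = cons tt (H-edges (here refl)) (path-map (λ _ → tt) (down H t₀ (H-edges ∘ there) h))
      a∈ = proj₁ (edges-ends r t₀ (∈-resp-↭ (↭-sym both) (here refl)))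
      b∈ = there (proj₂ (edges-ends r t₀ (∈-resp-↭ (↭-sym both) (here refl))))
      c∈ = proj₁ (edges-ends r t₀ (∈-resp-↭ (↭-sym both) (there (here refl))))
      d∈ = there (proj₂ (edges-ends r t₀ (∈-resp-↭ (↭-sym both) (there (here refl)))))
      a-c : Conn H a c
      a-c = path-conn (path-++ (path-rev (add-Sym {E = H₀} (rem-Sym {E = rem x b (rem x y E)} (rem-Sym {E = rem x y E} (rem-Sym {E = E} rsym)))) (root-path a∈)) (root-path c∈))
      move : ∀ χ → Move χ r E E′
      move rSPR = x , y , a , b , c , d , data′ , through (here refl) , λ p q → refl
      move SPR = x , y , a , b , c , d , data′ , λ p q → refl
      move TBR = SPR⇒TBR E rsym (rep-Irr R) (RepProps.rep-Cut R) (rep-degree-1-3 R) x y a b c d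
        (E₁ (there (there (here refl)))) (E₁ (here refl)) (E₁ (there (here refl))) (E₁ (there (there (there (here refl)))))
        (n₂ ∘ sameEdge-sym) (n₄ ∘ sameEdge-sym) n₆ n₁ n₃ n₅ g gE (g-Y (top∈ Y)) g-x (g-0 a∈) (g-0 b∈) (g-0 c∈) (g-0 d∈) a-c

-- Displayed shapes and coloured paths

data Shape (n : ℕ) : Set where
  sl : Fin (suc n) → Shape n
  sn : Shape n → Shape n → Shape n

shapeLabels : Shape n → List (Fin (suc n))
shapeLabels (sl i) = i ∷ []
shapeLabels (sn a b) = shapeLabels a ++ shapeLabels b

cherry : Fin (suc n) → Fin (suc n) → Shape n
cherry x y = sn (sl x) (sl y)

data SIns (c : Shape n) : Shape n → Shape n → Set where
  here  : ∀ {s} → SIns c s (sn c s)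
  left  : ∀ {a a′ b} → SIns c a a′ → SIns c (sn a b) (sn a′ b)
  right : ∀ {a b b′} → SIns c b b′ → SIns c (sn a b) (sn a b′)

-- Core P s t: s is the restriction of t to the labels of s, and every node of t
-- from its top down to the subtree spanned by these labels has a colour in P.
data Core {n m} (P : ℕ → Set) : Shape n → Tr n m → Set where
  clf   : ∀ {i} → Core P (sl i) (lf i)
  cnd   : ∀ {a b v c l r} → P c → Core P a l → Core P b r → Core P (sn a b) (nd v c l r)
  cswap : ∀ {a b v c l r} → P c → Core P a r → Core P b l → Core P (sn a b) (nd v c l r)
  skipL : ∀ {s v c l r} → P c → Core P s l → Core P s (nd v c l r)
  skipR : ∀ {s v c l r} → P c → Core P s r → Core P s (nd v c l r)

Any-colour : ℕ → Set
Any-colour _ = ⊤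

Displays : Shape n → Tr n m → Set
Displays = Core Any-colour

Displays-label : (t : Tr n m) {i : Fin (suc n)} → i ∈ labels t → Displays (sl i) t
Displays-label (lf i) (here refl) = clf
Displays-label (nd v c l r) h with ∈-++⁻ (labels l) h
... | inj₁ k = skipL tt (Displays-label l k)
... | inj₂ k = skipR tt (Displays-label r k)

Displays-Ins : {Y t₀ t : Tr n m} {x : Fin m} {c : ℕ} {s : Shape n} → Ins Y x c t₀ t → Displays s Y → Displays s t
Displays-Ins hereL d = skipL tt d
Displays-Ins hereR d = skipR tt d
Displays-Ins (left i) d = skipL tt (Displays-Ins i d)
Displays-Ins (right i) d = skipR tt (Displays-Ins i d)

Displays-grow : {Y t₀ t : Tr n m} {x : Fin m} {c : ℕ} {s : Shape n} → Ins Y x c t₀ t → Displays s t₀ → Displays s t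
Displays-grow hereL d = skipR tt d
Displays-grow hereR d = skipL tt d
Displays-grow (left i) (cnd p a b) = cnd p (Displays-grow i a) b
Displays-grow (left i) (cswap p a b) = cswap p a (Displays-grow i b)
Displays-grow (left i) (skipL p a) = skipL p (Displays-grow i a)
Displays-grow (left i) (skipR p a) = skipR p a
Displays-grow (right i) (cnd p a b) = cnd p a (Displays-grow i b)
Displays-grow (right i) (cswap p a b) = cswap p (Displays-grow i a) b
Displays-grow (right i) (skipL p a) = skipL p a
Displays-grow (right i) (skipR p a) = skipR p (Displays-grow i a)

Displays-insert : {Y t₀ t : Tr n m} {x : Fin m} {c : ℕ} {s e : Shape n} → Ins Y x c t₀ t → Displays s t₀ → Displays e Y →
  ∃[ s′ ] (SIns e s s′ × Displays s′ t)
Displays-insert hereL d dY = _ , here , cnd tt dY d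
Displays-insert hereR d dY = _ , here , cswap tt dY d
Displays-insert (left i) (cnd p a b) dY = let _ , j , d = Displays-insert i a dY in _ , left j , cnd p d b
Displays-insert (left i) (cswap p a b) dY = let _ , j , d = Displays-insert i b dY in _ , right j , cswap p a d
Displays-insert (left i) (skipL p a) dY = let _ , j , d = Displays-insert i a dY in _ , j , skipL p d
Displays-insert (left i) (skipR p a) dY = _ , here , cnd tt (Displays-Ins i dY) a
Displays-insert (right i) (cnd p a b) dY = let _ , j , d = Displays-insert i b dY in _ , right j , cnd p a d
Displays-insert (right i) (cswap p a b) dY = let _ , j , d = Displays-insert i a dY in _ , left j , cswap p d b
Displays-insert (right i) (skipR p a) dY = let _ , j , d = Displays-insert i a dY in _ , j , skipR p d
Displays-insert (right i) (skipL p a) dY = _ , here , cswap tt (Displays-Ins i dY) a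

Displays-insert-leaf : {t : Tr n m} {s : Shape n} {z : Fin (suc n)} → Displays s t → z ∈ labels t → z ∉ shapeLabels s →
  ∃[ s′ ] (SIns (sl z) s s′ × Displays s′ t)
Displays-insert-leaf clf (here refl) k = ⊥-elim (k (here refl))
Displays-insert-leaf {t = nd v c l r} {s = sn s₁ s₂} (cnd p a b) h k with ∈-++⁻ (labels l) h
... | inj₁ x = let _ , j , d = Displays-insert-leaf a x (k ∘ ∈-++⁺ˡ) in _ , left j , cnd p d b
... | inj₂ x = let _ , j , d = Displays-insert-leaf b x (k ∘ ∈-++⁺ʳ (shapeLabels s₁)) in _ , right j , cnd p a d
Displays-insert-leaf {t = nd v c l r} {s = sn s₁ s₂} (cswap p a b) h k with ∈-++⁻ (labels l) h
... | inj₁ x = let _ , j , d = Displays-insert-leaf b x (k ∘ ∈-++⁺ʳ (shapeLabels s₁)) in _ , right j , cswap p a d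
... | inj₂ x = let _ , j , d = Displays-insert-leaf a x (k ∘ ∈-++⁺ˡ) in _ , left j , cswap p d b
Displays-insert-leaf {t = nd v c l r} (skipL p a) h k with ∈-++⁻ (labels l) h
... | inj₁ x = let _ , j , d = Displays-insert-leaf a x k in _ , j , skipL p d
... | inj₂ x = _ , here , cswap tt (Displays-label r x) a
Displays-insert-leaf {t = nd v c l r} (skipR p a) h k with ∈-++⁻ (labels l) h
... | inj₁ x = _ , here , cnd tt (Displays-label l x) a
... | inj₂ x = let _ , j , d = Displays-insert-leaf a x k in _ , j , skipR p d

SIns-labels : {c s s′ : Shape n} → SIns c s s′ → shapeLabels s′ ↭ shapeLabels c ++ shapeLabels s
SIns-labels here = ↭-refl
SIns-labels {c = c} (left {a} {b = b} i) = ↭-trans (++⁺ʳ (shapeLabels b) (SIns-labels i))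
    (↭-reflexive (++-assoc (shapeLabels c) (shapeLabels a) (shapeLabels b)))
SIns-labels {c = c} (right {a} i) = ↭-trans (++⁺ˡ (shapeLabels a) (SIns-labels i)) (shifts (shapeLabels a) (shapeLabels c))

data Path (c : ℕ) {n m} (i : Fin (suc n)) : Tr n m → Set where
  plf : Path c i (lf i)
  pL  : ∀ {v d l r} → d ≡ c → Path c i l → Path c i (nd v d l r)
  pR  : ∀ {v d l r} → d ≡ c → Path c i r → Path c i (nd v d l r)

data Top (c : ℕ) {n m} (x y : Fin (suc n)) : Tr n m → Set where
  tLR : ∀ {v d l r} → d ≡ c → Path c x l → Path c y r → Top c x y (nd v d l r)
  tRL : ∀ {v d l r} → d ≡ c → Path c x r → Path c y l → Top c x y (nd v d l r)

data Pair (c : ℕ) {n m} (x y : Fin (suc n)) : Tr n m → Set where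
  top : ∀ {t} → Top c x y t → Pair c x y t
  inL : ∀ {v d l r} → Pair c x y l → Pair c x y (nd v d l r)
  inR : ∀ {v d l r} → Pair c x y r → Pair c x y (nd v d l r)

locate : {c : ℕ} {x y : Fin (suc n)} {t : Tr n m} → Pair c x y t →
  Top c x y t ⊎ (∃[ Y ] ∃[ z ] ∃[ d ] ∃[ t₀ ] (Ins Y z d t₀ t × Top c x y Y))
locate (top p) = inj₁ p
locate (inL {v} {d} {l} {r} p) with locate p
... | inj₁ q = inj₂ (l , v , d , r , hereL , q)
... | inj₂ (Y , z , d′ , t₀ , i , q) = inj₂ (Y , z , d′ , nd v d t₀ r , left i , q)
locate (inR {v} {d} {l} {r} p) with locate p
... | inj₁ q = inj₂ (r , v , d , l , hereR , q)
... | inj₂ (Y , z , d′ , t₀ , i , q) = inj₂ (Y , z , d′ , nd v d l t₀ , right i , q)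

Pair-Ins : {c : ℕ} {x y : Fin (suc n)} {Y t₀ t : Tr n m} {z : Fin m} {d : ℕ} → Ins Y z d t₀ t → Pair c x y Y → Pair c x y t
Pair-Ins hereL p = inL p
Pair-Ins hereR p = inR p
Pair-Ins (left i) p = inL (Pair-Ins i p)
Pair-Ins (right i) p = inR (Pair-Ins i p)

Path-top : {c c′ : ℕ} {i x y : Fin (suc n)} {t : Tr n m} → c′ ≢ c → Top c x y t → ¬ Path c′ i t
Path-top k (tLR e _ _) (pL e′ _) = k (trans (sym e′) e)
Path-top k (tLR e _ _) (pR e′ _) = k (trans (sym e′) e)
Path-top k (tRL e _ _) (pL e′ _) = k (trans (sym e′) e)
Path-top k (tRL e _ _) (pR e′ _) = k (trans (sym e′) e)

Path-prune : {c c′ : ℕ} {i x y : Fin (suc n)} {Y t₀ t : Tr n m} {z : Fin m} {d : ℕ} → c′ ≢ c → Ins Y z d t₀ t → Top c x y Y →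
  Path c′ i t → Path c′ i t₀
Path-prune k hereL tp (pL _ p) = ⊥-elim (Path-top k tp p)
Path-prune k hereL tp (pR _ p) = p
Path-prune k hereR tp (pL _ p) = p
Path-prune k hereR tp (pR _ p) = ⊥-elim (Path-top k tp p)
Path-prune k (left i) tp (pL e p) = pL e (Path-prune k i tp p)
Path-prune k (left i) tp (pR e p) = pR e p
Path-prune k (right i) tp (pL e p) = pL e p
Path-prune k (right i) tp (pR e p) = pR e (Path-prune k i tp p)

Pair-prune : {c c′ : ℕ} {x y x′ y′ : Fin (suc n)} {Y t₀ t : Tr n m} {z : Fin m} {d : ℕ} → c′ ≢ c → Ins Y z d t₀ t →
  Top c x y Y → Pair c′ x′ y′ t → Pair c′ x′ y′ t₀ ⊎ Pair c′ x′ y′ Y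
Pair-prune k hereL tp (top (tLR _ p _)) = ⊥-elim (Path-top k tp p)
Pair-prune k hereL tp (top (tRL _ _ p)) = ⊥-elim (Path-top k tp p)
Pair-prune k hereL tp (inL p) = inj₂ p
Pair-prune k hereL tp (inR p) = inj₁ p
Pair-prune k hereR tp (top (tLR _ _ p)) = ⊥-elim (Path-top k tp p)
Pair-prune k hereR tp (top (tRL _ p _)) = ⊥-elim (Path-top k tp p)
Pair-prune k hereR tp (inL p) = inj₁ p
Pair-prune k hereR tp (inR p) = inj₂ p
Pair-prune k (left i) tp (top (tLR e p q)) = inj₁ (top (tLR e (Path-prune k i tp p) q))
Pair-prune k (left i) tp (top (tRL e p q)) = inj₁ (top (tRL e p (Path-prune k i tp q)))
Pair-prune k (left i) tp (inL p) = [ inj₁ ∘ inL , inj₂ ]′ (Pair-prune k i tp p)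
Pair-prune k (left i) tp (inR p) = inj₁ (inR p)
Pair-prune k (right i) tp (top (tLR e p q)) = inj₁ (top (tLR e p (Path-prune k i tp q)))
Pair-prune k (right i) tp (top (tRL e p q)) = inj₁ (top (tRL e (Path-prune k i tp p) q))
Pair-prune k (right i) tp (inL p) = inj₁ (inL p)
Pair-prune k (right i) tp (inR p) = [ inj₁ ∘ inR , inj₂ ]′ (Pair-prune k i tp p)

Zero : ℕ → Set
Zero c = c ≡ 0

Core-prune : {P : ℕ → Set} {s : Shape n} {Y t₀ t : Tr n m} {z : Fin m} {d : ℕ} → Ins Y z d t₀ t →
  (∀ {s′} → (∀ {i} → i ∈ shapeLabels s′ → i ∈ shapeLabels s) → ¬ Core P s′ Y) → Core P s t → Core P s t₀
Core-prune hereL k (cnd p a b) = ⊥-elim (k ∈-++⁺ˡ a)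
Core-prune {s = sn s₁ s₂} hereL k (cswap p a b) = ⊥-elim (k (∈-++⁺ʳ (shapeLabels s₁)) b)
Core-prune hereL k (skipL p a) = ⊥-elim (k id a)
Core-prune hereL k (skipR p a) = a
Core-prune {s = sn s₁ s₂} hereR k (cnd p a b) = ⊥-elim (k (∈-++⁺ʳ (shapeLabels s₁)) b)
Core-prune hereR k (cswap p a b) = ⊥-elim (k ∈-++⁺ˡ a)
Core-prune hereR k (skipL p a) = a
Core-prune hereR k (skipR p a) = ⊥-elim (k id a)
Core-prune (left i) k (cnd p a b) = cnd p (Core-prune i (λ f → k (∈-++⁺ˡ ∘ f)) a) b
Core-prune {s = sn s₁ s₂} (left i) k (cswap p a b) = cswap p a (Core-prune i (λ f → k (∈-++⁺ʳ (shapeLabels s₁) ∘ f)) b)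
Core-prune (left i) k (skipL p a) = skipL p (Core-prune i k a)
Core-prune (left i) k (skipR p a) = skipR p a
Core-prune {s = sn s₁ s₂} (right i) k (cnd p a b) = cnd p a (Core-prune i (λ f → k (∈-++⁺ʳ (shapeLabels s₁) ∘ f)) b)
Core-prune (right i) k (cswap p a b) = cswap p (Core-prune i (λ f → k (∈-++⁺ˡ ∘ f)) a) b
Core-prune (right i) k (skipL p a) = skipL p a
Core-prune (right i) k (skipR p a) = skipR p (Core-prune i k a)

Top-¬Core : {c : ℕ} {x y : Fin (suc n)} {t : Tr n m} {s : Shape n} → c ≢ 0 → Top c x y t → ¬ Core Zero s t
Top-¬Core k (tLR e _ _) (cnd p _ _) = k (trans (sym e) p)
Top-¬Core k (tLR e _ _) (cswap p _ _) = k (trans (sym e) p)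
Top-¬Core k (tLR e _ _) (skipL p _) = k (trans (sym e) p)
Top-¬Core k (tLR e _ _) (skipR p _) = k (trans (sym e) p)
Top-¬Core k (tRL e _ _) (cnd p _ _) = k (trans (sym e) p)
Top-¬Core k (tRL e _ _) (cswap p _ _) = k (trans (sym e) p)
Top-¬Core k (tRL e _ _) (skipL p _) = k (trans (sym e) p)
Top-¬Core k (tRL e _ _) (skipR p _) = k (trans (sym e) p)

PairsKept : Tr n m → Tr n m → Set
PairsKept {n} t t′ = ∀ {c} {x y : Fin (suc n)} → c ≢ 0 → Pair c x y t → Pair c x y t′

kept-left : {l l′ r : Tr n m} {v : Fin m} {c : ℕ} → c ≡ 0 → PairsKept l l′ → PairsKept (nd v c l r) (nd v c l′ r)
kept-left e f k (top (tLR e′ _ _)) = ⊥-elim (k (trans (sym e′) e))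
kept-left e f k (top (tRL e′ _ _)) = ⊥-elim (k (trans (sym e′) e))
kept-left e f k (inL p) = inL (f k p)
kept-left e f k (inR p) = inR p

kept-right : {l r r′ : Tr n m} {v : Fin m} {c : ℕ} → c ≡ 0 → PairsKept r r′ → PairsKept (nd v c l r) (nd v c l r′)
kept-right e f k (top (tLR e′ _ _)) = ⊥-elim (k (trans (sym e′) e))
kept-right e f k (top (tRL e′ _ _)) = ⊥-elim (k (trans (sym e′) e))
kept-right e f k (inL p) = inL p
kept-right e f k (inR p) = inR (f k p)

-- All nodes above the grafting place have colour 0, so no path of another colour is subdivided.
Core-graft : {Y t₀ : Tr n m} (z : Fin m) {e s s′ : Shape n} → Core Zero e Y → SIns e s s′ → Core Zero s t₀ →
  ∃[ t ] (Ins Y z 0 t₀ t × Core Zero s′ t × PairsKept t₀ t)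
Core-graft z cy here c = _ , hereL , cnd refl cy c , λ _ p → inR p
Core-graft z cy (left j) (cnd p a b) = let _ , i , c , f = Core-graft z cy j a in _ , left i , cnd p c b , kept-left p f
Core-graft z cy (left j) (cswap p a b) = let _ , i , c , f = Core-graft z cy j a in _ , right i , cswap p c b , kept-right p f
Core-graft z cy (right j) (cnd p a b) = let _ , i , c , f = Core-graft z cy j b in _ , right i , cnd p a c , kept-right p f
Core-graft z cy (right j) (cswap p a b) = let _ , i , c , f = Core-graft z cy j b in _ , left i , cswap p a c , kept-left p f
Core-graft z cy j@(left _) (skipL p a) = let _ , i , c , f = Core-graft z cy j a in _ , left i , skipL p c , kept-left p f
Core-graft z cy j@(left _) (skipR p a) = let _ , i , c , f = Core-graft z cy j a in _ , right i , skipR p c , kept-right p f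
Core-graft z cy j@(right _) (skipL p a) = let _ , i , c , f = Core-graft z cy j a in _ , left i , skipL p c , kept-left p f
Core-graft z cy j@(right _) (skipR p a) = let _ , i , c , f = Core-graft z cy j a in _ , right i , skipR p c , kept-right p f

recolour : (ℕ → ℕ) → Tr n m → Tr n m
recolour f (lf i) = lf i
recolour f (nd v c l r) = nd v (f c) (recolour f l) (recolour f r)

data _∼_ {n m} : Tr n m → Tr n m → Set where
  ∼lf : ∀ {i} → lf i ∼ lf i
  ∼nd : ∀ {v c d l l′ r r′} → l ∼ l′ → r ∼ r′ → nd v c l r ∼ nd v d l′ r′

recolour-∼ : (f : ℕ → ℕ) (t : Tr n m) → t ∼ recolour f t
recolour-∼ f (lf i) = ∼lf
recolour-∼ f (nd v c l r) = ∼nd (recolour-∼ f l) (recolour-∼ f r)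

∼-labels : {t t′ : Tr n m} → t ∼ t′ → labels t ≡ labels t′
∼-labels ∼lf = refl
∼-labels (∼nd a b) = cong₂ _++_ (∼-labels a) (∼-labels b)

module _ {ℓ : Fin (suc n) → Fin m} where
  open Named ℓ renaming (top to topv)

  ∼-top : ∀ {t t′} → t ∼ t′ → topv t ≡ topv t′
  ∼-top ∼lf = refl
  ∼-top (∼nd _ _) = refl

  ∼-inner : ∀ {t t′} → t ∼ t′ → inner t ≡ inner t′
  ∼-inner ∼lf = refl
  ∼-inner (∼nd {v} a b) = cong₂ _++_ (cong₂ (λ p q → (v , p) ∷ q) (∼-top a) (∼-inner a))
    (cong₂ (λ p q → (v , p) ∷ q) (∼-top b) (∼-inner b))

  ∼-verts : ∀ {t t′} → t ∼ t′ → verts t ≡ verts t′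
  ∼-verts ∼lf = refl
  ∼-verts (∼nd {v} a b) = cong₂ (λ p q → v ∷ p ++ q) (∼-verts a) (∼-verts b)

  ∼-similar : ∀ {t t′} → t ∼ t′ → Similar {ℓ = ℓ} t t′
  ∼-similar s = record { s-top = ∼-top s ; s-inner = ∼-inner s ; s-verts = ∼-verts s ; s-labels = ∼-labels s }

  Rep-∼ : {E : Adj m} {t t′ : Tr n m} → t ∼ t′ → Rep E ℓ t → Rep E ℓ t′
  Rep-∼ s R = Rep-↭ (↭-reflexive (cong₂ (λ a b → (ℓ F.zero , a) ∷ b) (∼-top s) (∼-inner s)))
    (↭-reflexive (∼-verts s)) (↭-reflexive (∼-labels s)) R

Path-recolour : {c : ℕ} {i : Fin (suc n)} {t : Tr n m} (f : ℕ → ℕ) → Path c i t → Path (f c) i (recolour f t)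
Path-recolour f plf = plf
Path-recolour f (pL e p) = pL (cong f e) (Path-recolour f p)
Path-recolour f (pR e p) = pR (cong f e) (Path-recolour f p)

Top-recolour : {c : ℕ} {x y : Fin (suc n)} {t : Tr n m} (f : ℕ → ℕ) → Top c x y t → Top (f c) x y (recolour f t)
Top-recolour f (tLR e p q) = tLR (cong f e) (Path-recolour f p) (Path-recolour f q)
Top-recolour f (tRL e p q) = tRL (cong f e) (Path-recolour f p) (Path-recolour f q)

Pair-recolour : {c : ℕ} {x y : Fin (suc n)} {t : Tr n m} (f : ℕ → ℕ) → Pair c x y t → Pair (f c) x y (recolour f t)
Pair-recolour f (top p) = top (Top-recolour f p)
Pair-recolour f (inL p) = inL (Pair-recolour f p)
Pair-recolour f (inR p) = inR (Pair-recolour f p)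

Path-Core : {i : Fin (suc n)} {t : Tr n m} → Path 0 i t → Core Zero (sl i) t
Path-Core plf = clf
Path-Core (pL e p) = skipL e (Path-Core p)
Path-Core (pR e p) = skipR e (Path-Core p)

Top-Core : {x y : Fin (suc n)} {t : Tr n m} → Top 0 x y t → Core Zero (cherry x y) t
Top-Core (tLR e p q) = cnd e (Path-Core p) (Path-Core q)
Top-Core (tRL e p q) = cswap e (Path-Core p) (Path-Core q)

erase : ℕ → ℕ → ℕ
erase c d with d ℕ.≟ c
... | yes _ = 0
... | no _ = d

erase-self : ∀ c → erase c c ≡ 0
erase-self c with c ℕ.≟ c
... | yes _ = refl
... | no k = ⊥-elim (k refl)

erase-other : ∀ {c d} → d ≢ c → erase c d ≡ d
erase-other {c} {d} k with d ℕ.≟ c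
... | yes e = ⊥-elim (k e)
... | no _ = refl

-- Pairs of leaves common to two trees

leaf-Ins : (t : Tr n m) {z : Fin (suc n)} → z ∈ labels t → t ≡ lf z ⊎ (∃[ x ] ∃[ c ] ∃[ t₀ ] Ins (lf z) x c t₀ t)
leaf-Ins (lf i) (here refl) = inj₁ refl
leaf-Ins (nd v c l r) h with ∈-++⁻ (labels l) h
... | inj₁ k with leaf-Ins l k
... | inj₁ refl = inj₂ (v , c , r , hereL)
... | inj₂ (x , d , t₀ , i) = inj₂ (x , d , nd v c t₀ r , left i)
leaf-Ins (nd v c l r) h | inj₂ k with leaf-Ins r k
... | inj₁ refl = inj₂ (v , c , l , hereR)
... | inj₂ (x , d , t₀ , i) = inj₂ (x , d , nd v c l t₀ , right i)

module _ {ℓ : Fin (suc n) → Fin m} where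

  Moved : ℕ → Adj m → (Tr n m → Set) → Set
  Moved k E Φ = ∃[ E′ ] ∃[ t′ ] ((∀ χ → Steps (Move χ (ℓ F.zero)) k E E′) × Rep E′ ℓ t′ × Φ t′)

  Others : ℕ → Tr n m → Tr n m → Set
  Others c t t′ = ∀ {d} {x y : Fin (suc n)} → d ≢ 0 → d ≢ c → Pair d x y t → Pair d x y t′

  erase-Others : ∀ c {t : Tr n m} → Others c t (recolour (erase c) t)
  erase-Others c k k′ p = subst (λ e → Pair e _ _ _) (erase-other k′) (Pair-recolour (erase c) p)

  erase-Core : ∀ {c x y} {t : Tr n m} → Top c x y t → Core Zero (cherry x y) (recolour (erase c) t)
  erase-Core {c} {x} {y} {t} tp = Top-Core (subst (λ e → Top e x y (recolour (erase c) t)) (erase-self c) (Top-recolour (erase c) tp))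

  first-pair : {E : Adj m} {t : Tr n m} {c : ℕ} {x y : Fin (suc n)} → Rep E ℓ t → Pair c x y t →
    Moved 1 E (λ t′ → Core Zero (cherry x y) t′ × Others c t t′)
  first-pair {E} {t} {c} R p with locate p
  ... | inj₁ tp = E , recolour (erase c) t , (λ χ → done) , Rep-∼ (recolour-∼ (erase c) t) R , erase-Core tp , erase-Others c
  ... | inj₂ (Y , z , d , t₀ , i , tp) with regraft R i (hereL {Y = recolour (erase c) Y} {x = z} {c = 0}) (∼-similar (recolour-∼ (erase c) Y))
  ... | E′ , st , R′ = E′ , _ , st , R′ , skipL refl (erase-Core tp) ,
    λ k k′ q → [ inR , (λ w → inL (erase-Others c k k′ w)) ]′ (Pair-prune k′ i tp q)

  pair-step : {E : Adj m} {t : Tr n m} {c : ℕ} {x y : Fin (suc n)} {s s′ : Shape n} → Rep E ℓ t → Core Zero s t → c ≢ 0 →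
    Pair c x y t → SIns (cherry x y) s s′ → Moved 1 E (λ t′ → Core Zero s′ t′ × Others c t t′)
  pair-step {E} {t} {c} R co c≢0 p j with locate p
  ... | inj₁ tp = ⊥-elim (Top-¬Core c≢0 tp co)
  ... | inj₂ (Y , z , d , t₀ , i , tp) with Core-graft z (erase-Core tp) j (Core-prune i (λ _ → Top-¬Core c≢0 tp) co)
  ... | t′ , i′ , co′ , kept with regraft R i i′ (∼-similar (recolour-∼ (erase c) Y))
  ... | E′ , st , R′ = E′ , t′ , st , R′ , co′ ,
    λ k k′ q → [ kept k , (λ w → Pair-Ins i′ (erase-Others c k k′ w)) ]′ (Pair-prune k′ i tp q)

  leaf-step : {E : Adj m} {t : Tr n m} {z : Fin (suc n)} {s s′ : Shape n} → Rep E ℓ t → Core Zero s t → z ∈ labels t →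
    z ∉ shapeLabels s → SIns (sl z) s s′ → Moved 1 E (Core Zero s′)
  leaf-step {E} {t} {z} {s} R co z∈ z∉ j with leaf-Ins t z∈
  leaf-step R clf z∈ z∉ j | inj₁ refl = ⊥-elim (z∉ (here refl))
  leaf-step {z = z} {s} R co z∈ z∉ j | inj₂ (x , d , t₀ , i) with Core-graft x (clf {i = z}) j (Core-prune i away co)
    where
    away : ∀ {s′} → (∀ {i} → i ∈ shapeLabels s′ → i ∈ shapeLabels s) → ¬ Core Zero s′ (lf z)
    away f clf = z∉ (f (here refl))
  ... | t′ , i′ , co′ , _ with regraft R i i′ (∼-similar (∼lf {i = z}))
  ... | E′ , st , R′ = E′ , t′ , st , R′ , co′

Displays-cherry : (t : Tr n m) {x y : Fin (suc n)} → x ≢ y → x ∈ labels t → y ∈ labels t → Displays (cherry x y) t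
Displays-cherry (lf i) k (here refl) (here refl) = ⊥-elim (k refl)
Displays-cherry (nd v c l r) k hx hy with ∈-++⁻ (labels l) hx | ∈-++⁻ (labels l) hy
... | inj₁ a | inj₁ b = skipL tt (Displays-cherry l k a b)
... | inj₂ a | inj₂ b = skipR tt (Displays-cherry r k a b)
... | inj₁ a | inj₂ b = cnd tt (Displays-label l a) (Displays-label r b)
... | inj₂ a | inj₁ b = cswap tt (Displays-label r a) (Displays-label l b)

LabelPair : ℕ → Set
LabelPair n = Fin (suc n) × Fin (suc n)

-- The head of the list is inserted last.
data Chain {n} : List (LabelPair n) → Shape n → Set where
  one : ∀ {x y} → Chain ((x , y) ∷ []) (cherry x y)
  onto : ∀ {x y ps s s′} → Chain ps s → SIns (cherry x y) s s′ → Chain ((x , y) ∷ ps) s′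

Valid : {A : Set} (P : Fin (suc n) → A) → List (Fin (suc n)) → LabelPair n → Set
Valid P W (x , y) = x ≢ y × x ∈ W × y ∈ W × P x ≡ P y

key : {A : Set} → (Fin (suc n) → A) → LabelPair n → A
key P (x , y) = P x

unique-map-cong : (f g : A → B) (xs : List A) → (∀ {x} → x ∈ xs → f x ≡ g x) → Unique (map f xs) → Unique (map g xs)
unique-map-cong f g xs h u = subst Unique (map-cong-∈ xs h) u
  where
  map-cong-∈ : ∀ xs → (∀ {x} → x ∈ xs → f x ≡ g x) → map f xs ≡ map g xs
  map-cong-∈ [] h = refl
  map-cong-∈ (x ∷ xs) h = cong₂ _∷_ (h (here refl)) (map-cong-∈ xs (h ∘ there))

Valid-prune : {s k : ℕ} {Y t₀ t : Tr n m} {z : Fin m} {c : ℕ} (j : Ins Y z c t₀ t) (a : s ≤ size Y) (b : size Y ≤ 2 * s)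
  (d : Dec-of s k t₀) {q : LabelPair n} → proj₁ q ∉ labels Y → Valid (piece (split j a b d)) (labels t) q → Valid (piece d) (labels t₀) q
Valid-prune {k = k} {Y} j a b d {x , y} out (x≢y , x∈ , y∈ , e) = x≢y , Ins-label-cases j x∈ out , Ins-label-cases j y∈ outy ,
    trans (sym (piece-out j a b d out)) (trans e (piece-out j a b d outy))
  where
  outy : y ∉ labels Y
  outy h = <-irrefl refl (subst (_≤ k) (trans (sym (piece-out j a b d out)) (trans e (piece-in j a b d h))) (piece-≤ d x))

chain : {s k : ℕ} {t : Tr n m} (d : Dec-of s k t) (p : LabelPair n) (ps : List (LabelPair n)) →
  (∀ {q} → q ∈ p ∷ ps → Valid (piece d) (labels t) q) → Unique (map (key (piece d)) (p ∷ ps)) →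
  ∃[ qs ] ∃[ sh ] (qs ↭ p ∷ ps × Chain qs sh × Displays sh t)
chain {t = t} (whole _) (x , y) [] v u = let k , a , b , _ = v (here refl) in
  _ , _ , ↭-refl , one , Displays-cherry t k a b
chain (whole _) p (q ∷ ps) v ((k ∷ _) ∷ _) = ⊥-elim (k refl)
chain {t = t} D@(split {k} {Y} j a b d) p ps v u with Any.any? (λ q → proj₁ q ∈ᶠ? labels Y) (p ∷ ps)
... | no none = let qs , sh , π , c , ds = chain d p ps (λ q∈ → Valid-prune j a b d (out q∈) (v q∈))
                      (unique-map-cong (key (piece D)) (key (piece d)) (p ∷ ps) (λ q∈ → piece-out j a b d (out q∈)) u) in
    qs , sh , π , c , Displays-grow j ds
  where
  out : ∀ {q} → q ∈ p ∷ ps → proj₁ q ∉ labels Y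
  out q∈ h = none (lose q∈ h)
... | yes some = go (find some)
  where
  go : ∃[ q ] (q ∈ p ∷ ps × proj₁ q ∈ labels Y) → ∃[ qs ] ∃[ sh ] (qs ↭ p ∷ ps × Chain qs sh × Displays sh t)
  go ((x , y) , q∈ , x∈Y) = rest (proj₁ (∈⇒↭ q∈)) (proj₂ (∈⇒↭ q∈))
    where
    kx : piece D x ≡ suc k
    kx = piece-in j a b d x∈Y
    vq = v q∈
    y∈Y : y ∈ labels Y
    y∈Y with y ∈ᶠ? labels Y
    ... | yes h = h
    ... | no h = ⊥-elim (<-irrefl refl (subst (_≤ k) (trans (sym (piece-out j a b d h)) (trans (sym (proj₂ (proj₂ (proj₂ vq)))) kx)) (piece-≤ d y)))
    dq : Displays (cherry x y) Y
    dq = Displays-cherry Y (proj₁ vq) x∈Y y∈Y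
    rest : ∀ rs → p ∷ ps ↭ (x , y) ∷ rs → ∃[ qs ] ∃[ sh ] (qs ↭ p ∷ ps × Chain qs sh × Displays sh t)
    rest [] π = _ , _ , ↭-sym π , one , Displays-Ins j dq
    rest (r ∷ rs) π with chain d r rs (λ q∈ → Valid-prune j a b d (out q∈) (v (∈-resp-↭ (↭-sym π) (there q∈))))
          (unique-map-cong (key (piece D)) (key (piece d)) (r ∷ rs) (λ q∈ → piece-out j a b d (out q∈)) (tail-unique uπ))
      where
      uπ : Unique (piece D x ∷ map (key (piece D)) (r ∷ rs))
      uπ = Unique-resp-↭ (PermP.map⁺ (key (piece D)) π) u
      out : ∀ {q} → q ∈ r ∷ rs → proj₁ q ∉ labels Y
      out {q} q∈ h = head∉ uπ (subst (_∈ map (key (piece D)) (r ∷ rs)) (trans (piece-in j a b d h) (sym kx)) (∈-map⁺ (key (piece D)) q∈))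
    ... | qs , sh , σ , c , ds with Displays-insert j ds dq
    ... | sh′ , ins , ds′ = (x , y) ∷ qs , sh′ , ↭-trans (↭-prep _ σ) (↭-sym π) , onto c ins , ds′

paint : ℕ → Tr n m → Tr n m
paint c = recolour (λ _ → c)

Path-paint : (c : ℕ) (t : Tr n m) {i : Fin (suc n)} → i ∈ labels t → Path c i (paint c t)
Path-paint c (lf i) (here refl) = plf
Path-paint c (nd v d l r) h with ∈-++⁻ (labels l) h
... | inj₁ k = pL refl (Path-paint c l k)
... | inj₂ k = pR refl (Path-paint c r k)

Pair-paint : (c : ℕ) (t : Tr n m) {x y : Fin (suc n)} → x ≢ y → x ∈ labels t → y ∈ labels t → Pair c x y (paint c t)
Pair-paint c (lf i) k (here refl) (here refl) = ⊥-elim (k refl)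
Pair-paint c (nd v d l r) k hx hy with ∈-++⁻ (labels l) hx | ∈-++⁻ (labels l) hy
... | inj₁ a | inj₁ b = inL (Pair-paint c l k a b)
... | inj₂ a | inj₂ b = inR (Pair-paint c r k a b)
... | inj₁ a | inj₂ b = top (tLR refl (Path-paint c l a) (Path-paint c r b))
... | inj₂ a | inj₁ b = top (tRL refl (Path-paint c r a) (Path-paint c l b))

-- The node that carries Y takes the colour of its parent, so that monochromatic paths stay so.
transfer : {Y Y* t₀ t₀* t : Tr n m} {z : Fin m} {d : ℕ} → Ins Y z d t₀ t → t₀ ∼ t₀* → Y ∼ Y* → (pc : ℕ) →
  ∃[ t* ] (t ∼ t* × (∀ {i} → Path pc i t₀* → Path pc i t*) × (∀ {c x y} → Pair c x y t₀* → Pair c x y t*) ×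
    (∀ {c x y} → Pair c x y Y* → Pair c x y t*))
transfer {z = z} hereL s sY pc = nd z pc _ _ , ∼nd sY s , pR refl , inR , inL
transfer {z = z} hereR s sY pc = nd z pc _ _ , ∼nd s sY , pL refl , inL , inR
transfer (left i) (∼nd {v} {d = d} {r′ = r} s s′) sY pc with transfer i s sY d
... | l* , e , f , g , h = nd v d l* r , ∼nd e s′ , path , pair , inL ∘ h
  where
  path : ∀ {i} → Path pc i (nd v d _ r) → Path pc i (nd v d l* r)
  path (pL refl p) = pL refl (f p)
  path (pR q p) = pR q p
  pair : ∀ {c x y} → Pair c x y (nd v d _ r) → Pair c x y (nd v d l* r)
  pair (top (tLR refl p q)) = top (tLR refl (f p) q)
  pair (top (tRL refl p q)) = top (tRL refl p (f q))
  pair (inL p) = inL (g p)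
  pair (inR p) = inR p
transfer (right i) (∼nd {v} {d = d} {l′ = l} s s′) sY pc with transfer i s′ sY d
... | r* , e , f , g , h = nd v d l r* , ∼nd s e , path , pair , inR ∘ h
  where
  path : ∀ {i} → Path pc i (nd v d l _) → Path pc i (nd v d l r*)
  path (pR refl p) = pR refl (f p)
  path (pL q p) = pL q p
  pair : ∀ {c x y} → Pair c x y (nd v d l _) → Pair c x y (nd v d l r*)
  pair (top (tLR refl p q)) = top (tLR refl p (f q))
  pair (top (tRL refl p q)) = top (tRL refl (f p) q)
  pair (inL p) = inL p
  pair (inR p) = inR (g p)

coloured-pieces : {s k : ℕ} {t : Tr n m} (d : Dec-of s k t) → ∃[ t* ] (t ∼ t* ×
  (∀ {x y} → Valid (piece d) (labels t) (x , y) → Pair (suc (piece d x)) x y t*))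
coloured-pieces {t = t} (whole _) = paint 1 t , recolour-∼ _ t , λ { (k , a , b , _) → Pair-paint 1 t k a b }
coloured-pieces {t = t} D@(split {k} {Y} {t₀ = t₀} j a b d) with coloured-pieces d
... | t₀* , s₀ , f with transfer j s₀ (recolour-∼ (λ _ → suc (suc k)) Y) 1
... | t* , s , _ , g , h = t* , s , go
  where
  go : ∀ {x y} → Valid (piece D) (labels t) (x , y) → Pair (suc (piece D x)) x y t*
  go {x} {y} (x≢y , x∈ , y∈ , e) with x ∈ᶠ? labels Y | y ∈ᶠ? labels Y
  ... | yes p | yes q = h (Pair-paint (suc (suc k)) Y x≢y p q)
  ... | no p | no q = g (f (x≢y , Ins-label-cases j x∈ p , Ins-label-cases j y∈ q , e))
  ... | yes p | no q = ⊥-elim (<-irrefl refl (subst (_≤ k) (sym e) (piece-≤ d y)))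
  ... | no p | yes q = ⊥-elim (<-irrefl refl (subst (_≤ k) e (piece-≤ d x)))

duplicate : (f : A → B) → DecidableEquality B → (W : List A) → Unique W →
  Unique (map f W) ⊎ (∃[ x ] ∃[ y ] (x ∈ W × y ∈ W × x ≢ y × f x ≡ f y))
duplicate f _≟B_ [] u = inj₁ []
duplicate f _≟B_ (x ∷ W) u with Any.any? (λ y → f x ≟B f y) W | duplicate f _≟B_ W (tail-unique u)
... | yes h | _ = let y , y∈ , e = find h in inj₂ (x , y , here refl , there y∈ , (λ e′ → head∉ u (subst (_∈ W) (sym e′) y∈)) , e)
... | no _ | inj₂ (a , b , a∈ , b∈ , k , e) = inj₂ (a , b , there a∈ , there b∈ , k , e)
... | no h | inj₁ u′ = inj₁ (∷-unique (λ k → let y , y∈ , e = ∈-map⁻ f k in h (lose y∈ e)) u′)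

filter-split : {P : A → Set} (P? : ∀ x → Dec (P x)) (W : List A) →
  length W ≡ length (filter P? W) + length (filter (λ x → ¬? (P? x)) W)
filter-split P? [] = refl
filter-split P? (x ∷ W) with P? x
... | yes _ = cong suc (filter-split P? W)
... | no _ = trans (cong suc (filter-split P? W)) (sym (+-suc _ _))

grid : ℕ → ℕ → List (ℕ × ℕ)
grid a b = cartesianProduct (upTo (suc a)) (upTo (suc b))

length-product : (xs : List A) (ys : List B) → length (cartesianProduct xs ys) ≡ length xs * length ys
length-product [] ys = refl
length-product (x ∷ xs) ys = trans (length-++ (map (x ,_) ys)) (cong₂ _+_ (length-map (x ,_) ys) (length-product xs ys))

select : (PA PB : Fin (suc n) → ℕ) (a b S : ℕ) → (∀ i → PA i ≤ a) → (∀ i → PB i ≤ b) →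
  (fuel : ℕ) (W : List (Fin (suc n))) → length W ≤ fuel → Unique W →
  (∀ c W′ → Unique W′ → (∀ {i} → i ∈ W′ → i ∈ W) → count PA c W′ ≤ S × count PB c W′ ≤ S) →
  ∃[ ps ] ((∀ {q} → q ∈ ps → Valid PA W q × Valid PB W q) × Unique (map (key PA) ps) × Unique (map (key PB) ps) ×
    length W ≤ length ps * (S + S) + suc a * suc b)
select PA PB a b S la lb fuel W le u small with duplicate (λ i → PA i , PB i) (Productₚ.≡-dec ℕ._≟_ ℕ._≟_) W u
... | inj₁ u′ = [] , (λ ()) , [] , [] , (≤-trans (≤-reflexive (sym (length-map (λ i → PA i , PB i) W)))
    (≤-trans (unique-⊆-length u′ sub) (≤-reflexive (trans (length-product (upTo (suc a)) (upTo (suc b)))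
      (cong₂ _*_ (length-upTo (suc a)) (length-upTo (suc b)))))))
  where
  sub : ∀ {z} → z ∈ map (λ i → PA i , PB i) W → z ∈ grid a b
  sub h with ∈-map⁻ (λ i → PA i , PB i) h
  ... | i , _ , refl = ∈-cartesianProduct⁺ (∈-upTo⁺ (s≤s (la i))) (∈-upTo⁺ (s≤s (lb i)))
select PA PB a b S la lb zero [] le u small | inj₂ (x , y , () , _)
select {n} PA PB a b S la lb (suc fuel) W le u small | inj₂ (x , y , x∈ , y∈ , x≢y , e) = result
  where
  hasA hasB : ∀ i → Dec _
  hasA i = PA i ℕ.≟ PA x
  hasB i = PB i ℕ.≟ PB x
  W₁ W₂ : List (Fin (suc n))
  W₁ = filter (λ i → ¬? (hasA i)) W
  W₂ = filter (λ i → ¬? (hasB i)) W₁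
  u₁ : Unique W₁
  u₁ = Uniq.filter⁺ (λ i → ¬? (hasA i)) u
  u₂ : Unique W₂
  u₂ = Uniq.filter⁺ (λ i → ¬? (hasB i)) u₁
  in₁ : ∀ {i} → i ∈ W₁ → i ∈ W × PA i ≢ PA x
  in₁ h = ∈-filter⁻ (λ i → ¬? (hasA i)) {xs = W} h
  in₂ : ∀ {i} → i ∈ W₂ → i ∈ W₁ × PB i ≢ PB x
  in₂ h = ∈-filter⁻ (λ i → ¬? (hasB i)) {xs = W₁} h
  sub : ∀ {i} → i ∈ W₂ → i ∈ W
  sub h = proj₁ (in₁ (proj₁ (in₂ h)))
  lenA : length W ≡ count PA (PA x) W + length W₁
  lenA = filter-split hasA W
  lenB : length W₁ ≡ count PB (PB x) W₁ + length W₂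
  lenB = filter-split hasB W₁
  shorter : length W₂ ≤ fuel
  shorter = ≤-pred (≤-trans (unique-⊆-length (∷-unique (λ h → proj₂ (in₁ (proj₁ (in₂ h))) refl) u₂)
    (λ { (here refl) → x∈ ; (there h) → sub h })) le)
  rec = select PA PB a b S la lb fuel W₂ shorter u₂ (λ c W′ v f → small c W′ v (sub ∘ f))
  qs = proj₁ rec
  ok = proj₁ (proj₂ rec)
  uA = proj₁ (proj₂ (proj₂ rec))
  uB = proj₁ (proj₂ (proj₂ (proj₂ rec)))
  len = proj₂ (proj₂ (proj₂ (proj₂ rec)))
  widen : ∀ {P : Fin (suc n) → ℕ} {q} → Valid P W₂ q → Valid P W q
  widen (k , h , h′ , r) = k , sub h , sub h′ , r
  all : ∀ {q} → q ∈ (x , y) ∷ qs → Valid PA W q × Valid PB W q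
  all (here refl) = (x≢y , x∈ , y∈ , cong proj₁ e) , (x≢y , x∈ , y∈ , cong proj₂ e)
  all (there h) = let v , w = ok h in widen {PA} v , widen {PB} w
  newA : PA x ∉ map (key PA) qs
  newA h with ∈-map⁻ (key PA) h
  ... | q , q∈ , r = proj₂ (in₁ (proj₁ (in₂ (proj₁ (proj₂ (proj₁ (ok q∈))))))) (sym r)
  newB : PB x ∉ map (key PB) qs
  newB h with ∈-map⁻ (key PB) h
  ... | q , q∈ , r = proj₂ (in₂ (proj₁ (proj₂ (proj₁ (ok q∈))))) (sym r)
  bound : length W ≤ S + (S + (length qs * (S + S) + suc a * suc b))
  bound = ≤-trans (≤-reflexive lenA) (+-mono-≤ (proj₁ (small (PA x) W u id))
    (≤-trans (≤-reflexive lenB) (+-mono-≤ (proj₂ (small (PB x) W₁ u₁ (proj₁ ∘ in₁))) len)))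
  shuffle : ∀ s l p → s + (s + (l + p)) ≡ (s + s + l) + p
  shuffle = solve-∀
  result : ∃[ ps ] ((∀ {q} → q ∈ ps → Valid PA W q × Valid PB W q) × Unique (map (key PA) ps) × Unique (map (key PB) ps) ×
    length W ≤ length ps * (S + S) + suc a * suc b)
  result = (x , y) ∷ qs , all , ∷-unique newA uA , ∷-unique newB uB ,
    ≤-trans bound (≤-reflexive (shuffle S (length qs * (S + S)) (suc a * suc b)))

-- Transforming one tree into the other

Steps-mono : {Mv : Adj m → Adj m → Set} {j k : ℕ} {E F : Adj m} → j ≤ k → Steps Mv j E F → Steps Mv k E F
Steps-mono le done = done
Steps-mono (s≤s le) (more s ss) = more s (Steps-mono le ss)

Steps-++ : {Mv : Adj m → Adj m → Set} {j k : ℕ} {E F G : Adj m} → Steps Mv j E F → Steps Mv k F G → Steps Mv (j + k) E G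
Steps-++ {j = j} {k} done ss = Steps-mono (m≤n+m k j) ss
Steps-++ (more s ss) ss′ = more s (Steps-++ ss ss′)

++-interleave : {xs ys : List A} (J a K : List A) {b : List A} → xs ↭ J ++ a → ys ↭ K ++ b → xs ++ ys ↭ (J ++ K) ++ (a ++ b)
++-interleave {xs = xs} {ys} J a K {b} π σ = begin
  xs ++ ys ↭⟨ PermP.++⁺ π σ ⟩
  (J ++ a) ++ (K ++ b) ≡⟨ ++-assoc J a _ ⟩
  J ++ (a ++ (K ++ b)) ↭⟨ ++⁺ˡ J (shifts a K) ⟩
  J ++ (K ++ (a ++ b)) ≡⟨ sym (++-assoc J K _) ⟩
  (J ++ K) ++ (a ++ b) ∎
  where open Perm.PermutationReasoning

Core-rest : {P : ℕ → Set} {s : Shape n} {t : Tr n m} → Core P s t → ∃[ J ] labels t ↭ J ++ shapeLabels s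
Core-rest clf = [] , ↭-refl
Core-rest {s = sn a b} (cnd _ c d) = let J , π = Core-rest c ; K , σ = Core-rest d in J ++ K , ++-interleave J (shapeLabels a) K π σ
Core-rest {s = sn a b} (cswap {l = l} {r} _ c d) = let J , π = Core-rest c ; K , σ = Core-rest d in
  J ++ K , ↭-trans (++-comm (labels l) (labels r)) (++-interleave J (shapeLabels a) K π σ)
Core-rest {s = s} (skipL {l = l} {r} _ c) = let J , π = Core-rest c in labels r ++ J , ↭-trans (++-comm (labels l) (labels r))
  (↭-trans (++⁺ˡ (labels r) π) (↭-reflexive (sym (++-assoc (labels r) J (shapeLabels s)))))
Core-rest {s = s} (skipR {l = l} {r} _ c) = let J , π = Core-rest c in labels l ++ J ,
  ↭-trans (++⁺ˡ (labels l) π) (↭-reflexive (sym (++-assoc (labels l) J (shapeLabels s))))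

Core-size : {P : ℕ → Set} {s : Shape n} {t : Tr n m} → Core P s t → length (shapeLabels s) ≤ size t
Core-size {s = s} c = let J , π = Core-rest c in
  ≤-trans (m≤n+m _ (length J)) (≤-reflexive (sym (trans (↭-length π) (length-++ J))))

module Phases {ℓ : Fin (suc n) → Fin m} (col : LabelPair n → ℕ) where

  HasPair : Tr n m → LabelPair n → Set
  HasPair t p = Pair (suc (col p)) (proj₁ p) (proj₂ p) t

  move-pairs : {qs : List (LabelPair n)} {sh : Shape n} → Chain qs sh → (rest : List (LabelPair n)) →
    {E : Adj m} {t : Tr n m} → Rep E ℓ t → (∀ {p} → p ∈ qs ++ rest → HasPair t p) → Unique (map col (qs ++ rest)) →
    Moved {ℓ = ℓ} (length qs) E (λ t′ → Core Zero sh t′ × (∀ {p} → p ∈ rest → HasPair t′ p))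
  move-pairs (one {x} {y}) rest R f u with first-pair R (f (here refl))
  ... | E′ , t′ , st , R′ , co , oth = E′ , t′ , st , R′ , co , λ {p} h → oth (λ ())
    (λ e → head∉ u (subst (_∈ map col rest) (ℕₚ.suc-injective e) (∈-map⁺ col h))) (f (there h))
  move-pairs (onto {x} {y} {ps} ch j) rest {E} {t} R f u with move-pairs ch ((x , y) ∷ rest) R
      (λ h → f (∈-resp-↭ (shift (x , y) ps rest) h))
      (Unique-resp-↭ (PermP.map⁺ col (↭-sym (shift (x , y) ps rest))) u)
  ... | E₁ , t₁ , st₁ , R₁ , co₁ , g with pair-step R₁ co₁ (λ ()) (g (here refl)) j
  ... | E′ , t′ , st , R′ , co , oth = E′ , t′ , (λ χ → Steps-mono (≤-reflexive (+-comm (length ps) 1)) (Steps-++ (st₁ χ) (st χ))) , R′ , co ,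
    λ {p} h → oth (λ ())
      (λ e → head∉ u (subst (_∈ map col (ps ++ rest)) (ℕₚ.suc-injective e) (∈-map⁺ col (∈-++⁺ʳ ps h)))) (g (there h))

module _ {ℓ : Fin (suc n) → Fin m} where

  move-leaves : {m′ : ℕ} {u : Tr n m′} → (∀ {i} → i ∈ proper-labels n → i ∈ labels u) → (J : List (Fin (suc n))) {sh : Shape n} {E : Adj m} {t : Tr n m} →
    Rep E ℓ t → Core Zero sh t → Displays sh u → labels t ↭ J ++ shapeLabels sh →
    ∃[ sh′ ] (Displays sh′ u × Moved {ℓ = ℓ} (length J) E (λ t′ → Core Zero sh′ t′ × labels t′ ↭ shapeLabels sh′))
  move-leaves in-u [] {sh} {E} {t} R co ds π = sh , ds , E , t , (λ χ → done) , R , co , π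
  move-leaves in-u (z ∷ J) {sh} R co ds π with Displays-insert-leaf ds (in-u (∈-resp-↭ (Rep.labs R) (∈-resp-↭ (↭-sym π) (here refl)))) z∉
    where
    z∉ : z ∉ shapeLabels sh
    z∉ h = head∉ (Unique-resp-↭ π (RepProps.labs-unique R)) (∈-++⁺ʳ J h)
  ... | sh₁ , j , ds₁ with leaf-step R co (∈-resp-↭ (↭-sym π) (here refl)) z∉ j
    where
    z∉ : z ∉ shapeLabels sh
    z∉ h = head∉ (Unique-resp-↭ π (RepProps.labs-unique R)) (∈-++⁺ʳ J h)
  ... | E₁ , t₁ , st₁ , R₁ , co₁ with move-leaves in-u J R₁ co₁ ds₁
        (↭-trans (Rep.labs R₁) (↭-trans (↭-sym (Rep.labs R)) (↭-trans π
          (↭-trans (↭-sym (shift z J (shapeLabels sh))) (++⁺ˡ J (↭-sym (SIns-labels j)))))))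
  ... | sh′ , ds′ , E′ , t′ , st , rest = sh′ , ds′ , E′ , t′ , (λ χ → Steps-++ (st₁ χ) (st χ)) , rest

data Shaped {n m} : Shape n → Tr n m → Set where
  slf : ∀ {i} → Shaped (sl i) (lf i)
  snd : ∀ {a b v c l r} → Shaped a l → Shaped b r → Shaped (sn a b) (nd v c l r)

module _ {ℓ : Fin (suc n) → Fin m} where
  open Named ℓ renaming (top to topv)

  record Straight (s : Shape n) (t : Tr n m) : Set where
    field
      st : Tr n m
      st-shaped : Shaped s st
      st-top : topv t ≡ topv st
      st-inner : inner t ↭ inner st
      st-verts : verts t ↭ verts st
      st-labels : labels t ↭ labels st

  straighten : {P : ℕ → Set} {s : Shape n} {t : Tr n m} → Core P s t → size t ≤ length (shapeLabels s) → Straight s t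
  straighten {t = t} clf le = record { st = t ; st-shaped = slf ; st-top = refl ; st-inner = ↭-refl ; st-verts = ↭-refl ; st-labels = ↭-refl }
  straighten {s = sn a b} (cnd {v = v} {c} {l} {r} _ cl cr) le = record
      { st = nd v c L.st R.st ; st-shaped = snd L.st-shaped R.st-shaped ; st-top = refl
      ; st-inner = PermP.++⁺ (↭-trans (↭-reflexive (cong (λ w → (v , w) ∷ inner l) L.st-top)) (↭-prep _ L.st-inner))
          (↭-trans (↭-reflexive (cong (λ w → (v , w) ∷ inner r) R.st-top)) (↭-prep _ R.st-inner))
      ; st-verts = ↭-prep v (PermP.++⁺ L.st-verts R.st-verts) ; st-labels = PermP.++⁺ L.st-labels R.st-labels }
    where
    le′ : size l + size r ≤ length (shapeLabels a) + length (shapeLabels b)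
    le′ = ≤-trans (≤-reflexive (sym (length-++ (labels l)))) (≤-trans le (≤-reflexive (length-++ (shapeLabels a))))
    module L = Straight (straighten cl (+-cancelʳ-≤ (size r) _ _ (≤-trans le′ (+-mono-≤ (≤-refl {length (shapeLabels a)}) (Core-size cr)))))
    module R = Straight (straighten cr (+-cancelˡ-≤ (size l) _ _ (≤-trans le′ (+-mono-≤ (Core-size cl) ≤-refl))))
  straighten {s = sn a b} (cswap {v = v} {c} {l} {r} _ cr cl) le = record
      { st = nd v c R.st L.st ; st-shaped = snd R.st-shaped L.st-shaped ; st-top = refl
      ; st-inner = ↭-trans (++-comm (edges v l) (edges v r)) (PermP.++⁺ (↭-trans (↭-reflexive (cong (λ w → (v , w) ∷ inner r) R.st-top)) (↭-prep _ R.st-inner))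
          (↭-trans (↭-reflexive (cong (λ w → (v , w) ∷ inner l) L.st-top)) (↭-prep _ L.st-inner)))
      ; st-verts = ↭-prep v (↭-trans (++-comm (verts l) (verts r)) (PermP.++⁺ R.st-verts L.st-verts))
      ; st-labels = ↭-trans (++-comm (labels l) (labels r)) (PermP.++⁺ R.st-labels L.st-labels) }
    where
    le′ : size r + size l ≤ length (shapeLabels a) + length (shapeLabels b)
    le′ = ≤-trans (≤-reflexive (trans (+-comm (size r) (size l)) (sym (length-++ (labels l))))) (≤-trans le (≤-reflexive (length-++ (shapeLabels a))))
    module R = Straight (straighten cr (+-cancelʳ-≤ (size l) _ _ (≤-trans le′ (+-mono-≤ (≤-refl {length (shapeLabels a)}) (Core-size cl)))))
    module L = Straight (straighten cl (+-cancelˡ-≤ (size r) _ _ (≤-trans le′ (+-mono-≤ (Core-size cr) ≤-refl))))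
  straighten {s = s} (skipL {l = l} {r} _ c) le = ⊥-elim (<-irrefl refl (≤-trans (≤-trans (≤-reflexive (+-comm 1 (size l))) (+-mono-≤ (≤-refl {size l}) (size-pos r)))
    (≤-trans (≤-reflexive (sym (length-++ (labels l)))) (≤-trans le (Core-size c)))))
  straighten {s = s} (skipR {l = l} {r} _ c) le = ⊥-elim (<-irrefl refl (≤-trans (+-mono-≤ (size-pos l) (≤-refl {size r}))
    (≤-trans (≤-reflexive (sym (length-++ (labels l)))) (≤-trans le (Core-size c)))))

  Rep-straight : {E : Adj m} {s : Shape n} {t : Tr n m} (S : Straight s t) → Rep E ℓ t → Rep E ℓ (Straight.st S)
  Rep-straight {t = t} S R = Rep-↭ (↭-trans (↭-reflexive (cong (λ w → (ℓ F.zero , w) ∷ inner t) st-top)) (↭-prep _ st-inner)) st-verts st-labels R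
    where open Straight S

module Match {n m₁ m₂} (ℓ₁ : Fin (suc n) → Fin m₁) (ℓ₂ : Fin (suc n) → Fin m₂) where
  module N₁ = Named ℓ₁
  module N₂ = Named ℓ₂

  zipV : {s : Shape n} {t₁ : Tr n m₁} {t₂ : Tr n m₂} → Shaped s t₁ → Shaped s t₂ → List (Fin m₁ × Fin m₂)
  zipV (slf {i}) slf = (ℓ₁ i , ℓ₂ i) ∷ []
  zipV (snd {v = v} a b) (snd {v = w} c d) = (v , w) ∷ zipV a c ++ zipV b d

  zip-fst : {s : Shape n} {t₁ : Tr n m₁} {t₂ : Tr n m₂} (a : Shaped s t₁) (b : Shaped s t₂) → map proj₁ (zipV a b) ≡ N₁.verts t₁
  zip-fst slf slf = refl
  zip-fst (snd {v = v} a b) (snd c d) = cong (v ∷_) (trans (map-++ proj₁ (zipV a c) _) (cong₂ _++_ (zip-fst a c) (zip-fst b d)))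

  zip-snd : {s : Shape n} {t₁ : Tr n m₁} {t₂ : Tr n m₂} (a : Shaped s t₁) (b : Shaped s t₂) → map proj₂ (zipV a b) ≡ N₂.verts t₂
  zip-snd slf slf = refl
  zip-snd (snd a b) (snd {v = w} c d) = cong (w ∷_) (trans (map-++ proj₂ (zipV a c) _) (cong₂ _++_ (zip-snd a c) (zip-snd b d)))

  zip-top : {s : Shape n} {t₁ : Tr n m₁} {t₂ : Tr n m₂} (a : Shaped s t₁) (b : Shaped s t₂) → (N₁.top t₁ , N₂.top t₂) ∈ zipV a b
  zip-top slf slf = here refl
  zip-top (snd _ _) (snd _ _) = here refl

  zip-label : {s : Shape n} {t₁ : Tr n m₁} {t₂ : Tr n m₂} (a : Shaped s t₁) (b : Shaped s t₂) {i : Fin (suc n)} →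
    i ∈ labels t₁ → (ℓ₁ i , ℓ₂ i) ∈ zipV a b
  zip-label slf slf (here refl) = here refl
  zip-label (snd {l = l} a b) (snd c d) h with ∈-++⁻ (labels l) h
  ... | inj₁ k = there (∈-++⁺ˡ (zip-label a c k))
  ... | inj₂ k = there (∈-++⁺ʳ (zipV a c) (zip-label b d k))

  zipE : {s : Shape n} {t₁ : Tr n m₁} {t₂ : Tr n m₂} → Shaped s t₁ → Shaped s t₂ → List (Edge m₁ × Edge m₂)
  zipE slf slf = []
  zipE (snd {v = v} {l = l} {r = r} a b) (snd {v = w} {l = l′} {r = r′} c d) =
    (((v , N₁.top l) , (w , N₂.top l′)) ∷ zipE a c) ++ (((v , N₁.top r) , (w , N₂.top r′)) ∷ zipE b d)

  zipE-fst : {s : Shape n} {t₁ : Tr n m₁} {t₂ : Tr n m₂} (a : Shaped s t₁) (b : Shaped s t₂) → map proj₁ (zipE a b) ≡ N₁.inner t₁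
  zipE-fst slf slf = refl
  zipE-fst (snd {v = v} {l = l} {r = r} a b) (snd {v = w} {l = l′} c d) =
    trans (map-++ proj₁ (((v , N₁.top l) , (w , N₂.top l′)) ∷ zipE a c) _)
      (cong₂ (λ x y → ((v , N₁.top l) ∷ x) ++ ((v , N₁.top r) ∷ y)) (zipE-fst a c) (zipE-fst b d))

  zipE-snd : {s : Shape n} {t₁ : Tr n m₁} {t₂ : Tr n m₂} (a : Shaped s t₁) (b : Shaped s t₂) → map proj₂ (zipE a b) ≡ N₂.inner t₂
  zipE-snd slf slf = refl
  zipE-snd (snd {v = v} {l = l} a b) (snd {v = w} {l = l′} {r = r′} c d) =
    trans (map-++ proj₂ (((v , N₁.top l) , (w , N₂.top l′)) ∷ zipE a c) _)
      (cong₂ (λ x y → ((w , N₂.top l′) ∷ x) ++ ((w , N₂.top r′) ∷ y)) (zipE-snd a c) (zipE-snd b d))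

  zipE-ends : {s : Shape n} {t₁ : Tr n m₁} {t₂ : Tr n m₂} (a : Shaped s t₁) (b : Shaped s t₂) {p q : Fin m₁} {p′ q′ : Fin m₂} →
    ((p , q) , (p′ , q′)) ∈ zipE a b → (p , p′) ∈ zipV a b × (q , q′) ∈ zipV a b
  zipE-ends slf slf ()
  zipE-ends (snd {v = v} {l = l} a b) (snd {v = w} {l = l′} c d) h with ∈-++⁻ (((v , N₁.top l) , (w , N₂.top l′)) ∷ zipE a c) h
  ... | inj₁ (here refl) = here refl , there (∈-++⁺ˡ (zip-top a c))
  ... | inj₂ (here refl) = here refl , there (∈-++⁺ʳ (zipV a c) (zip-top b d))
  ... | inj₁ (there k) = let x , y = zipE-ends a c k in there (∈-++⁺ˡ x) , there (∈-++⁺ˡ y)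
  ... | inj₂ (there k) = let x , y = zipE-ends b d k in there (∈-++⁺ʳ (zipV a c) x) , there (∈-++⁺ʳ (zipV a c) y)

  unique-fst : (zs : List (A × B)) → Unique (map proj₁ zs) → ∀ {a b b′} → (a , b) ∈ zs → (a , b′) ∈ zs → b ≡ b′
  unique-fst (z ∷ zs) u (here refl) (here refl) = refl
  unique-fst (z ∷ zs) u (here refl) (there h) = ⊥-elim (head∉ u (∈-map⁺ proj₁ h))
  unique-fst (z ∷ zs) u (there h) (here refl) = ⊥-elim (head∉ u (∈-map⁺ proj₁ h))
  unique-fst (z ∷ zs) u (there h) (there k) = unique-fst zs (tail-unique u) h k

  unique-snd : (zs : List (A × B)) → Unique (map proj₂ zs) → ∀ {a a′ b} → (a , b) ∈ zs → (a′ , b) ∈ zs → a ≡ a′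
  unique-snd (z ∷ zs) u (here refl) (here refl) = refl
  unique-snd (z ∷ zs) u (here refl) (there h) = ⊥-elim (head∉ u (∈-map⁺ proj₂ h))
  unique-snd (z ∷ zs) u (there h) (here refl) = ⊥-elim (head∉ u (∈-map⁺ proj₂ h))
  unique-snd (z ∷ zs) u (there h) (there k) = unique-snd zs (tail-unique u) h k

  module _ {E₁ : Adj m₁} {E₂ : Adj m₂} {s : Shape n} {t₁ : Tr n m₁} {t₂ : Tr n m₂} (a : Shaped s t₁) (b : Shaped s t₂)
    (R₁ : Rep E₁ ℓ₁ t₁) (R₂ : Rep E₂ ℓ₂ t₂) where
    private
      module R₁ = Rep R₁
      module R₂ = Rep R₂
      r₁ = ℓ₁ F.zero
      r₂ = ℓ₂ F.zero
      zs : List (Fin m₁ × Fin m₂)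
      zs = (r₁ , r₂) ∷ zipV a b
      es : List (Edge m₁ × Edge m₂)
      es = ((r₁ , N₁.top t₁) , (r₂ , N₂.top t₂)) ∷ zipE a b
      fst≡ : map proj₁ zs ≡ r₁ ∷ N₁.verts t₁
      fst≡ = cong (r₁ ∷_) (zip-fst a b)
      snd≡ : map proj₂ zs ≡ r₂ ∷ N₂.verts t₂
      snd≡ = cong (r₂ ∷_) (zip-snd a b)
      es-fst : map proj₁ es ≡ N₁.edges r₁ t₁
      es-fst = cong ((r₁ , N₁.top t₁) ∷_) (zipE-fst a b)
      es-snd : map proj₂ es ≡ N₂.edges r₂ t₂
      es-snd = cong ((r₂ , N₂.top t₂) ∷_) (zipE-snd a b)
      ends : ∀ {p q p′ q′} → ((p , q) , (p′ , q′)) ∈ es → (p , p′) ∈ zs × (q , q′) ∈ zs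
      ends (here refl) = here refl , there (zip-top a b)
      ends (there h) = let x , y = zipE-ends a b h in there x , there y
      fwd : ∀ p → ∃[ p′ ] (p , p′) ∈ zs
      fwd p with ∈-map⁻ proj₁ (subst (p ∈_) (sym fst≡) (R₁.compl p))
      ... | (p , p′) , h , refl = p′ , h
      bwd : ∀ p′ → ∃[ p ] (p , p′) ∈ zs
      bwd p′ with ∈-map⁻ proj₂ (subst (p′ ∈_) (sym snd≡) (R₂.compl p′))
      ... | (p , p′) , h , refl = p , h
      to : Fin m₁ → Fin m₂
      to p = proj₁ (fwd p)
      from : Fin m₂ → Fin m₁
      from p = proj₁ (bwd p)
      to-≡ : ∀ {p p′} → (p , p′) ∈ zs → to p ≡ p′
      to-≡ {p} h = unique-fst zs (subst Unique (sym fst≡) R₁.uniq) (proj₂ (fwd p)) h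
      from-≡ : ∀ {p p′} → (p , p′) ∈ zs → from p′ ≡ p
      from-≡ {p} {p′} h = unique-snd zs (subst Unique (sym snd≡) R₂.uniq) (proj₂ (bwd p′)) h
      edge→ : ∀ {p q} → (p , q) ∈ N₁.edges r₁ t₁ → (to p , to q) ∈ N₂.edges r₂ t₂
      edge→ {p} {q} h with ∈-map⁻ proj₁ (subst ((p , q) ∈_) (sym es-fst) h)
      ... | ((p , q) , (p′ , q′)) , k , refl = let x , y = ends k in
        subst (_∈ N₂.edges r₂ t₂) (cong₂ _,_ (sym (to-≡ x)) (sym (to-≡ y)))
          (subst ((p′ , q′) ∈_) es-snd (∈-map⁺ proj₂ {xs = es} k))
      edge← : ∀ {p q} → (to p , to q) ∈ N₂.edges r₂ t₂ → (p , q) ∈ N₁.edges r₁ t₁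
      edge← {p} {q} h with ∈-map⁻ proj₂ (subst ((to p , to q) ∈_) (sym es-snd) h)
      ... | ((p′ , q′) , (_ , _)) , k , refl = let x , y = ends k in
        subst (_∈ N₁.edges r₁ t₁) (cong₂ _,_ (trans (sym (from-≡ x)) (from-≡ (proj₂ (fwd p)))) (trans (sym (from-≡ y)) (from-≡ (proj₂ (fwd q)))))
          (subst ((p′ , q′) ∈_) es-fst (∈-map⁺ proj₁ {xs = es} k))
      T→ : ∀ {p q} → T (E₁ p q) → T (E₂ (to p) (to q))
      T→ h with R₁.edge⁻ h
      ... | inj₁ k = R₂.edge⁺ (edge→ k)
      ... | inj₂ k = R₂.rsym (R₂.edge⁺ (edge→ k))
      T← : ∀ {p q} → T (E₂ (to p) (to q)) → T (E₁ p q)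
      T← h with R₂.edge⁻ h
      ... | inj₁ k = R₁.edge⁺ (edge← k)
      ... | inj₂ k = R₁.rsym (R₁.edge⁺ (edge← k))
      leaf≡ : ∀ i → to (ℓ₁ i) ≡ ℓ₂ i
      leaf≡ F.zero = to-≡ (here refl)
      leaf≡ (F.suc i) = to-≡ (there (zip-label a b (RepProps.labs-∈ R₁ (λ ()))))

    isomorphism : Σ (Fin m₁ ↔ Fin m₂) λ φ → (∀ p q → E₂ (Inverse.to φ p) (Inverse.to φ q) ≡ E₁ p q) ×
      (∀ i → Inverse.to φ (ℓ₁ i) ≡ ℓ₂ i)
    isomorphism = mk↔ₛ′ to from (λ q → to-≡ (proj₂ (bwd q))) (λ p → from-≡ (proj₂ (fwd p))) , (λ p q → T⇒≡ T← T→) , leaf≡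

-- The upper bound

Chain-labels : {qs : List (LabelPair n)} {sh : Shape n} → Chain qs sh → length (shapeLabels sh) ≡ length qs + length qs
Chain-labels one = refl
Chain-labels (onto {ps = ps} ch j) = trans (↭-length (SIns-labels j)) (trans (cong (λ k → suc (suc k)) (Chain-labels ch))
  (cong suc (sym (+-suc (length ps) (length ps)))))

reach-by-pairs : {m₁ m₂ s k k′ : ℕ} (A : BTree n m₁) (B : BTree n m₂) {tA : Tr n m₁} {tB : Tr n m₂} →
  Rep (adj A) (leaf A) tA → Rep (adj B) (leaf B) tB → (dA : Dec-of s k tA) (dB : Dec-of s k′ tB) →
  (p : LabelPair n) (ps : List (LabelPair n)) →
  (∀ {q} → q ∈ p ∷ ps → Valid (piece dA) (labels tA) q × Valid (piece dB) (labels tB) q) →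
  Unique (map (key (piece dA)) (p ∷ ps)) → Unique (map (key (piece dB)) (p ∷ ps)) →
  ∃[ j ] (length (p ∷ ps) + j ≡ n × (∀ χ → Reach χ j A B))
reach-by-pairs {n} A B {tA} {tB} RA RB dA dB p ps ok uA uB with chain dB p ps (proj₂ ∘ ok) uB | coloured-pieces dA
... | qs , sh , π , ch , ds | tA* , sim , pair with Phases.move-pairs {ℓ = leaf A} (key (piece dA)) ch [] (Rep-∼ sim RA)
        (λ {q} h → pair (proj₁ (ok (∈-resp-↭ π (subst (q ∈_) (++-identityʳ qs) h)))))
        (Unique-resp-↭ (PermP.map⁺ (key (piece dA)) (↭-trans (↭-sym π) (↭-reflexive (sym (++-identityʳ qs))))) uA)
... | E₁ , t₁ , st₁ , R₁ , co₁ , _ with Core-rest co₁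
... | J , σ with move-leaves {ℓ = leaf A} {u = tB} (∈-resp-↭ (↭-sym (Rep.labs RB))) J R₁ co₁ ds σ
... | sh′ , ds′ , E₂ , t₂ , st₂ , R₂ , co₂ , τ = length qs + length J , total , λ χ →
    E₂ , Steps-++ (st₁ χ) (st₂ χ) , Match.isomorphism (leaf A) (leaf B) (Straight.st-shaped SA) (Straight.st-shaped SB)
      (Rep-straight SA R₂) (Rep-straight SB RB)
  where
  SA : Straight {ℓ = leaf A} sh′ t₂
  SA = straighten co₂ (≤-reflexive (↭-length τ))
  SB : Straight {ℓ = leaf B} sh′ tB
  SB = straighten ds′ (≤-reflexive (trans (RepProps.labs-length RB) (trans (sym (RepProps.labs-length R₂)) (↭-length τ))))
  total : length (p ∷ ps) + (length qs + length J) ≡ n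
  total = trans (cong (_+ (length qs + length J)) (sym (↭-length π)))
    (trans (shuffle (length qs) (length J))
      (trans (cong (length J +_) (sym (Chain-labels ch))) (trans (sym (length-++ J)) (trans (sym (↭-length σ)) (RepProps.labs-length R₁)))))
    where
    shuffle : ∀ a b → a + (a + b) ≡ b + (a + a)
    shuffle = solve-∀

close-trees : {m₁ m₂ : ℕ} (s : ℕ) → 1 ≤ s → (A : BTree n m₁) (B : BTree n m₂) → ∃[ M ] ∃[ k ] ∃[ k′ ]
  (k * s ≤ n × k′ * s ≤ n × n ≤ M * (2 * s + 2 * s) + suc k * suc k′ ×
    (1 ≤ M → ∃[ j ] (M + j ≡ n × (∀ χ → Reach χ j A B))))
close-trees {n} s 1≤s A B with Traverse.represent A | Traverse.represent B
... | tA , RA | tB , RB with decompose s 1≤s (size tA) tA ≤-refl | decompose s 1≤s (size tB) tB ≤-refl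
... | k , dA | k′ , dB with select (piece dA) (piece dB) k k′ (2 * s) (piece-≤ dA) (piece-≤ dB) (length (proper-labels n))
        (proper-labels n) ≤-refl (proper-unique n) (λ c W u f →
          piece-size dA c W u (λ h → ∈-resp-↭ (↭-sym (Rep.labs RA)) (f h)) , piece-size dB c W u (λ h → ∈-resp-↭ (↭-sym (Rep.labs RB)) (f h)))
... | ps , ok , uA , uB , le = length ps , k , k′ , subst (k * s ≤_) (RepProps.labs-length RA) (pieces-bound dA) ,
    subst (k′ * s ≤_) (RepProps.labs-length RB) (pieces-bound dB) , subst (_≤ length ps * (2 * s + 2 * s) + suc k * suc k′) (proper-length n) le ,
    go ps ok uA uB
  where
  go : ∀ ps → (∀ {q} → q ∈ ps → Valid (piece dA) (proper-labels n) q × Valid (piece dB) (proper-labels n) q) →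
    Unique (map (key (piece dA)) ps) → Unique (map (key (piece dB)) ps) → 1 ≤ length ps →
    ∃[ j ] (length ps + j ≡ n × (∀ χ → Reach χ j A B))
  go (p ∷ ps) ok uA uB _ = reach-by-pairs A B RA RB dA dB p ps (λ h → let (a , b , c , d) , (a′ , b′ , c′ , d′) = ok h in
    (a , ∈-resp-↭ (↭-sym (Rep.labs RA)) b , ∈-resp-↭ (↭-sym (Rep.labs RA)) c , d) ,
    (a′ , ∈-resp-↭ (↭-sym (Rep.labs RB)) b′ , ∈-resp-↭ (↭-sym (Rep.labs RB)) c′ , d′)) uA uB

-- Arithmetic

Reach-mono : {n m m′ j k : ℕ} (χ : Model) (A : BTree n m) (B : BTree n m′) → j ≤ k → Reach χ j A B → Reach χ k A B
Reach-mono χ A B le (E , st , iso) = E , Steps-mono le st , iso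

square-root : ∀ n → ∃[ q ] (q * q ≤ n × n < suc q * suc q)
square-root zero = 0 , z≤n , s≤s z≤n
square-root (suc n) with square-root n
... | q , lo , hi with suc q * suc q ≤? suc n
... | yes p = suc q , p , ≤-trans (s≤s hi) (ℕₚ.*-mono-< (ℕₚ.n<1+n (suc q)) (ℕₚ.n<1+n (suc q)))
... | no p = q , ≤-trans lo (n≤1+n n) , ≰⇒> p

many-pairs : ∀ n q M k k′ → let Q = suc q ; s = 2 * Q in 32 ≤ q → q * q ≤ n → n < Q * Q → k * s ≤ n → k′ * s ≤ n →
  n ≤ M * (2 * s + 2 * s) + suc k * suc k′ → q ≤ 32 * M
many-pairs n q@(suc _) M k k′ 32≤q lo hi kn k′n le = ℕₚ.*-cancelˡ-≤ (q + q) (begin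
    (q + q) * q ≡⟨ r₁ q ⟩
    2 * (q * q) ≤⟨ +-cancelʳ-≤ (2 * (q * q)) _ _ main ⟩
    32 * M * Q ≤⟨ ℕₚ.*-monoʳ-≤ (32 * M) (+-mono-≤ (≤-trans (s≤s z≤n) 32≤q) ≤-refl) ⟩
    32 * M * (q + q) ≡⟨ *-comm (32 * M) (q + q) ⟩
    (q + q) * (32 * M) ∎)
  where
  open ℕₚ.≤-Reasoning
  Q = suc q
  half : ∀ k → k * (2 * Q) ≤ n → 2 * suc k ≤ suc Q
  half k h = ≤-trans (≤-reflexive (r k)) (s≤s (ℕₚ.*-cancelʳ-< Q (2 * k) Q (≤-trans (s≤s (≤-trans (≤-reflexive (r′ k Q)) h)) hi)))
    where
    r : ∀ k → 2 * suc k ≡ suc (suc (2 * k))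
    r = solve-∀
    r′ : ∀ k Q → 2 * k * Q ≡ k * (2 * Q)
    r′ = solve-∀
  r₁ : ∀ q → (q + q) * q ≡ 2 * (q * q)
  r₁ = solve-∀
  square : suc Q * suc Q ≤ 2 * (q * q)
  square = begin
    suc Q * suc Q ≡⟨ r₂ q ⟩
    (4 * q + 4) + q * q ≤⟨ +-mono-≤ (≤-trans (+-mono-≤ (≤-refl {4 * q}) (≤-trans (ℕₚ.m≤m+n 4 28) 32≤q)) (≤-trans (≤-reflexive (r₃ q)) (*-mono-≤ (≤-trans (ℕₚ.m≤m+n 5 27) 32≤q) (≤-refl {q})))) ≤-refl ⟩
    q * q + q * q ≡⟨ r₄ q ⟩
    2 * (q * q) ∎
    where
    r₂ : ∀ q → suc (suc q) * suc (suc q) ≡ (4 * q + 4) + q * q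
    r₂ = solve-∀
    r₃ : ∀ q → 4 * q + q ≡ 5 * q
    r₃ = solve-∀
    r₄ : ∀ q → q * q + q * q ≡ 2 * (q * q)
    r₄ = solve-∀
  main : 2 * (q * q) + 2 * (q * q) ≤ 32 * M * Q + 2 * (q * q)
  main = begin
    2 * (q * q) + 2 * (q * q) ≡⟨ r₅ q ⟩
    4 * (q * q) ≤⟨ ℕₚ.*-monoʳ-≤ 4 (≤-trans lo le) ⟩
    4 * (M * (2 * (2 * Q) + 2 * (2 * Q)) + suc k * suc k′) ≡⟨ r₆ M Q (suc k) (suc k′) ⟩
    32 * M * Q + (2 * suc k) * (2 * suc k′) ≤⟨ +-mono-≤ (≤-refl {32 * M * Q}) (≤-trans (*-mono-≤ (half k kn) (half k′ k′n)) square) ⟩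
    32 * M * Q + 2 * (q * q) ∎
    where
    r₅ : ∀ q → 2 * (q * q) + 2 * (q * q) ≡ 4 * (q * q)
    r₅ = solve-∀
    r₆ : ∀ M Q a b → 4 * (M * (2 * (2 * Q) + 2 * (2 * Q)) + a * b) ≡ 32 * M * Q + (2 * a) * (2 * b)
    r₆ = solve-∀

root-≥-32 : ∀ n q → 1024 ≤ n → n < suc q * suc q → 32 ≤ q
root-≥-32 n q big hi with 32 ≤? q
... | yes p = p
... | no p = ⊥-elim (<-irrefl refl (≤-trans hi (≤-trans (*-mono-≤ (≰⇒> p) (≰⇒> p)) big)))

square-scale : ∀ c g → c * g * (c * g) ≡ c * c * (g * g)
square-scale = solve-∀

quotient : ∀ c q → .⦃ _ : NonZero c ⦄ → ∃[ g ] (g * c ≤ q × suc q ≤ c + g * c)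
quotient c q = q / c , m/n*n≤m q c , ≤-trans (s≤s (≤-reflexive (m≡m%n+[m/n]*n q c))) (ℕₚ.+-monoˡ-≤ (q / c * c) (m%n<n q c))

square-bound : ∀ c n q g K → n < suc q * suc q → 1 ≤ g → suc q ≤ c + g * c → (c + c) * (c + c) ≤ K → n ≤ K * (g * g)
square-bound c n q g K hi 1≤g q< le = begin
  n ≤⟨ <⇒≤ hi ⟩
  suc q * suc q ≤⟨ *-mono-≤ Q≤ Q≤ ⟩
  (c + c) * g * ((c + c) * g) ≡⟨ square-scale (c + c) g ⟩
  (c + c) * (c + c) * (g * g) ≤⟨ *-mono-≤ le (≤-refl {g * g}) ⟩
  K * (g * g) ∎
  where
  open ℕₚ.≤-Reasoning
  twice : ∀ c g → c * g + g * c ≡ (c + c) * g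
  twice = solve-∀
  Q≤ : suc q ≤ (c + c) * g
  Q≤ = ≤-trans q< (≤-trans (+-mono-≤ (≤-trans (≤-reflexive (sym (ℕₚ.*-identityʳ c))) (*-mono-≤ (≤-refl {c}) 1≤g)) (≤-refl {g * c}))
    (≤-reflexive (twice c g)))

cancel-factor : ∀ c g q M → .⦃ _ : NonZero c ⦄ → g * c ≤ q → q ≤ c * M → g ≤ M
cancel-factor c g q M a b = ℕₚ.*-cancelˡ-≤ c (≤-trans (≤-trans (≤-reflexive (*-comm c g)) a) b)

reach-weaken : ∀ {n m m′ g M} χ (A : BTree n m) (B : BTree n m′) → 1 ≤ g → g ≤ M →
  (1 ≤ M → ∃[ j ] (M + j ≡ n × (∀ χ → Reach χ j A B))) → Reach χ (n ∸ g) A B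
reach-weaken {n} {M = M} χ A B 1≤g g≤M f with f (≤-trans 1≤g g≤M)
... | j , e , re = Reach-mono χ A B (≤-trans (≤-reflexive (trans (sym (ℕₚ.m+n∸m≡n M j)) (cong (_∸ M) e))) (ℕₚ.∸-monoʳ-≤ n g≤M)) (re χ)

module Upper (n q K g : ℕ) (lo : q * q ≤ n) (hi : n < suc q * suc q) (32≤q : 32 ≤ q) (64²≤K : 64 * 64 ≤ K)
  (g*32≤q : g * 32 ≤ q) (q<32+ : suc q ≤ 32 + g * 32) where
  open ℕₚ.≤-Reasoning

  1≤g : 1 ≤ g
  1≤g with 1 ≤? g
  ... | yes p = p
  ... | no p = ⊥-elim (<-irrefl refl (≤-trans (s≤s 32≤q) (≤-trans q<32+ (+-mono-≤ (≤-refl {32}) (*-mono-≤ (≤-pred (≰⇒> p)) (≤-refl {32}))))))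

  g≤n : g ≤ n
  g≤n = begin
    g ≡⟨ sym (ℕₚ.*-identityʳ g) ⟩
    g * 1 ≤⟨ *-mono-≤ (≤-refl {g}) (s≤s z≤n) ⟩
    g * 32 ≤⟨ g*32≤q ⟩
    q ≡⟨ sym (ℕₚ.*-identityʳ q) ⟩
    q * 1 ≤⟨ *-mono-≤ (≤-refl {q}) (≤-trans (s≤s z≤n) 32≤q) ⟩
    q * q ≤⟨ lo ⟩
    n ∎

  n≤Kg² : n ≤ K * (g * g)
  n≤Kg² = square-bound 32 n q g K hi 1≤g q<32+ 64²≤K

  many : ∀ {M k k′} → k * (2 * suc q) ≤ n → k′ * (2 * suc q) ≤ n →
    n ≤ M * (2 * (2 * suc q) + 2 * (2 * suc q)) + suc k * suc k′ → g ≤ M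
  many {M} {k} {k′} kn k′n le = cancel-factor 32 g q M g*32≤q (many-pairs n q M k k′ 32≤q lo hi kn k′n le)

  reach : ∀ χ {m m′} (A : BTree n m) (B : BTree n m′) → Reach χ (n ∸ g) A B
  reach χ A B = let M , k , k′ , kn , k′n , le , f = close-trees (2 * suc q) (s≤s z≤n) A B in
    reach-weaken χ A B 1≤g (many {M} {k} {k′} kn k′n le) f

module Lower (n′ q K : ℕ) (lo : q * q ≤ suc n′) (hi : suc n′ < suc q * suc q) (32≤q : 32 ≤ q) (64²≤K : 64 * 64 ≤ K) where
  open ℕₚ.≤-Reasoning
  private
    N h : ℕ
    N = suc n′
    h = 3 * q + 3

  h≤4q : h ≤ 4 * q
  h≤4q = ≤-trans (+-mono-≤ (≤-refl {3 * q}) (≤-trans (ℕₚ.m≤m+n 3 29) 32≤q)) (≤-reflexive (r q))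
    where
    r : ∀ q → 3 * q + q ≡ 4 * q
    r = solve-∀

  h≤n : h ≤ N
  h≤n = ≤-trans h≤4q (≤-trans (*-mono-≤ (≤-trans (ℕₚ.m≤m+n 4 28) 32≤q) (≤-refl {q})) lo)

  h²≤Kn : h * h ≤ K * N
  h²≤Kn = begin
    h * h ≤⟨ *-mono-≤ h≤4q h≤4q ⟩
    4 * q * (4 * q) ≡⟨ square-scale 4 q ⟩
    4 * 4 * (q * q) ≤⟨ *-mono-≤ (≤-trans (*-mono-≤ 4≤64 4≤64) 64²≤K) lo ⟩
    K * N ∎
    where
    4≤64 : 4 ≤ 64
    4≤64 = ℕₚ.m≤m+n 4 60

  enough : ∀ j k → k * suc q ≤ N → N ≤ suc (j + 2 * suc q + k) → N ∸ h ≤ j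
  enough j k kn le = ℕₚ.m≤n+o⇒m∸n≤o N h (begin
    N ≤⟨ le ⟩
    suc (j + 2 * suc q + k) ≤⟨ s≤s (+-mono-≤ (≤-refl {j + 2 * suc q}) k≤q) ⟩
    suc (j + 2 * suc q + q) ≡⟨ r j q ⟩
    h + j ∎)
    where
    k≤q : k ≤ q
    k≤q = ≤-pred (ℕₚ.*-cancelʳ-< (suc q) k (suc q) (≤-trans (s≤s kn) hi))
    r : ∀ j q → suc (j + 2 * suc q + q) ≡ 3 * q + 3 + j
    r = solve-∀

  far : ∀ χ m (C : BTree N m) → ∃[ m′ ] Σ (BTree N m′) λ B → DistGe χ (N ∸ h) B C
  far χ m C = let m′ , B , k , kn , bound = far-tree n′ (suc q) (s≤s z≤n) C in
    m′ , B , λ j lt re → ℕₚ.<⇒≱ lt (enough j k kn (bound χ j re))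

upper : ∀ n K → 1024 ≤ n → 64 * 64 ≤ K →
  ∃[ g ] (g ≤ n × n ≤ K * (g * g) × (∀ χ {m m′} (A : BTree n m) (B : BTree n m′) → Reach χ (n ∸ g) A B))
upper n K big 64²≤K with square-root n
... | q , lo , hi with quotient 32 q
... | g , a , b = g , g≤n , n≤Kg² , reach
  where open Upper n q K g lo hi (root-≥-32 n q big hi) 64²≤K a b

lower : ∀ n K → 1024 ≤ n → 64 * 64 ≤ K →
  ∃[ h ] (h ≤ n × h * h ≤ K * n × (∀ χ m (C : BTree n m) → ∃[ m′ ] Σ (BTree n m′) λ B → DistGe χ (n ∸ h) B C))
lower n@(suc n′) K big 64²≤K with square-root n
... | q , lo , hi = 3 * q + 3 , h≤n , h²≤Kn , far
  where open Lower n′ q K lo hi (root-≥-32 n q big hi) 64²≤K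

some-tree : ∀ n → 1024 ≤ n → ∃[ m ] BTree n m
some-tree (suc n′) _ = _ , SortedCaterpillar.tree (sorted-caterpillar n′ (λ _ → 0) 1 (λ _ → s≤s z≤n))

-- The constants come from g = ⌊q / 32⌋ with q = ⌊√n⌋: the gain is positive once q ≥ 32, and then q < 64 g.
theorem1p10 : ∀ (χ : Model) →
    NMinusThetaSqrt (DiamLe χ) (DiamGe χ) × NMinusThetaSqrt (RadLe χ) (RadGe χ)
theorem1p10 χ = (K , N , λ n big → below n big , above n big) , (K , N , λ n big → around n big , away n big)
  where
  K N : ℕ
  K = 4096
  N = 1024
  below : ∀ n → N ≤ n → ∃[ g ] (g ≤ n × n ≤ K * (g * g) × DiamLe χ n (n ∸ g))
  below n big = let g , g≤n , n≤ , reach = upper n K big ≤-refl in g , g≤n , n≤ , λ _ _ A B → reach χ A B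
  above : ∀ n → N ≤ n → ∃[ h ] (h ≤ n × h * h ≤ K * n × DiamGe χ n (n ∸ h))
  above n big = let h , h≤n , ≤n , far = lower n K big ≤-refl ; m , C = some-tree n big ; m′ , B , dist = far χ m C in
    h , h≤n , ≤n , m′ , m , B , C , dist
  around : ∀ n → N ≤ n → ∃[ g ] (g ≤ n × n ≤ K * (g * g) × RadLe χ n (n ∸ g))
  around n big = let g , g≤n , n≤ , reach = upper n K big ≤-refl ; m , C = some-tree n big in
    g , g≤n , n≤ , m , C , λ _ B → reach χ B C
  away : ∀ n → N ≤ n → ∃[ h ] (h ≤ n × h * h ≤ K * n × RadGe χ n (n ∸ h))
  away n big = let h , h≤n , ≤n , far = lower n K big ≤-refl in h , h≤n , ≤n , far χ
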